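{- Let $b_1,\dots,b_n$ be a finite sequence of positive integers and $c$ a positive integer. Let $t=2+\sum_{i=1}^n b_i$, $k=\mathrm{lcm}(b_1,\dots,b_n,c)$, and let $q_0$ be the smallest positive integer satisfying $q_0k^{ -t}-(t-1-t/k+k^{ -t})\sqrt{q_0}-t/k>1$. Let $q$ be a prime power with $k\mid(q-1)$ and $q\ge q_0$. Then for any orthomorphisms $\theta_1,\dots,\theta_n$ over $\mathbb{F}_q$ with $\theta_i\in\mathscr{C}_{b_i}(q)$ for $1\le i\le n$, there exists a near-linear orthomorphism $\phi\in\mathscr{D}_c(q)$ which is orthogonal to each of $\theta_1,\dots,\theta_n$.
   Context: Let $\mathbb{F}_q$ be the finite field of order $q$. An orthomorphism is a permutation $\theta$ of $\mathbb{F}_q$ such that $x\mapsto\theta(x)-x$ is also a permutation. Two orthomorphisms $\theta,\theta'$ are orthogonal if $x\mapsto\theta(x)-\theta'(x)$ is a permutation. For $k\mid(q-1)$, fix a generator $g$ of $\mathbb{F}_q^*$ and let $C_{k,i}=\{g^j: j\equiv i\pmod k\}$, $0\le i<k$. A cyclotomic map of index $k$ with multipliers $[a_0,\dots,a_{k-1}]$ is $\theta(0)=0$, $\theta(x)=a_ix$ for $x\in C_{k,i}$. $\mathscr{C}_k(q)$ is the set of orthomorphisms that are cyclotomic maps of index $k$, and $\mathscr{D}_k(q)=\mathscr{C}_k(q)\setminus\bigcup_{\ell<k,\ \ell\mid(q-1)}\mathscr{C}_\ell(q)$. An element of $\mathscr{C}_k(q)$ with multipliers $[a_0,\dots,a_{k-1}]$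 is near-linear if $a_0\neq a_1=\cdots=a_{k-1}$. -}

module Defs where

open import Level using (0ℓ)
open import Data.Nat as ℕ using (ℕ; zero; suc; _≤_; _<_; NonZero; _∸_)
open import Data.Nat.DivMod using (_mod_)
open import Data.Nat.Divisibility using (_∣_)
open import Data.Nat.LCM using (lcm)
open import Data.Nat.Primality using (Prime)
open import Data.Fin using (Fin; toℕ)
open import Data.List using (List; foldr; tabulate)
open import Data.Nat.ListAction using (sum)
open import Data.Integer using (+_)
open import Data.Rational as ℚ using (ℚ; 0ℚ; 1ℚ)
open import Data.Product using (Σ; ∃; ∃-syntax; _×_)
open import Data.Sum using (_⊎_)
open import Relation.Nullary using (¬_)
open import Relation.Binary.PropositionalEquality using (_≡_; _≢_)
open import Algebra.Structures using (IsCommutativeRing)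
open import Function.Definitions using (Bijective)
open import Function.Bundles using (_↔_)

IsPrimePower : ℕ → Set
IsPrimePower q = ∃[ p ] ∃[ e ] (Prime p × 1 ≤ e × q ≡ p ℕ.^ e)

record FiniteField (q : ℕ) : Set₁ where
  infixl 7 _*_
  infixl 6 _+_ _-_
  field
    Carrier : Set
    _+_ _*_ : Carrier → Carrier → Carrier
    -_ : Carrier → Carrier
    0# 1# : Carrier
    isCommutativeRing : IsCommutativeRing _≡_ _+_ _*_ -_ 0# 1#
    0≢1 : 0# ≢ 1#
    inverse : ∀ x → x ≢ 0# → ∃[ y ] (x * y ≡ 1#)
    card : Carrier ↔ Fin q

  _-_ : Carrier → Carrier → Carrier
  x - y = x + (- y)

  _^_ : Carrier → ℕ → Carrier
  x ^ zero  = 1#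
  x ^ suc n = x * (x ^ n)

module _ {q : ℕ} (F : FiniteField q) where
  open FiniteField F

  IsPerm : (Carrier → Carrier) → Set
  IsPerm f = Bijective _≡_ _≡_ f

  IsOrthomorphism : (Carrier → Carrier) → Set
  IsOrthomorphism θ = IsPerm θ × IsPerm (λ x → θ x - x)

  Orthogonal : (Carrier → Carrier) → (Carrier → Carrier) → Set
  Orthogonal θ θ' = IsPerm (λ x → θ x - θ' x)

  IsGenerator : Carrier → Set
  IsGenerator g = g ≢ 0# × (∀ x → x ≢ 0# → ∃[ j ] (g ^ j ≡ x))

  -- θ is the cyclotomic map of index k (w.r.t. g) with multipliers a:
  -- θ(0) = 0 and θ(x) = a_i x for x = g^j ∈ C_{k,i}, i = j mod k.
  IsCyclotomicWith : (g : Carrier) (k : ℕ) .{{_ : NonZero k}} →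
                     (Fin k → Carrier) → (Carrier → Carrier) → Set
  IsCyclotomicWith g k a θ =
    θ 0# ≡ 0# × (∀ j → θ (g ^ j) ≡ a (j mod k) * (g ^ j))

  InC : (g : Carrier) (k : ℕ) .{{_ : NonZero k}} → (Carrier → Carrier) → Set
  InC g k θ = IsOrthomorphism θ × (∃[ a ] IsCyclotomicWith g k a θ)

  InD : (g : Carrier) (k : ℕ) .{{_ : NonZero k}} → (Carrier → Carrier) → Set
  InD g k θ = InC g k θ ×
    (∀ ℓ → (nz : NonZero ℓ) → ℓ < k → ℓ ∣ (q ∸ 1) → ¬ InC g ℓ {{nz}} θ)

  IsNearLinear : (g : Carrier) (k : ℕ) .{{_ : NonZero k}} → (Carrier → Carrier) → Set
  IsNearLinear g k θ = InC g k θ × (∃[ a ] (IsCyclotomicWith g k a θ ×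
    (∀ i j → toℕ i ≡ 0 → toℕ j ≢ 0 → a i ≢ a j) ×
    (∀ i j → toℕ i ≢ 0 → toℕ j ≢ 0 → a i ≡ a j)))

-- 1/n as a rational (0 for n = 0; only used with n ≥ 1)
recipℕ : ℕ → ℚ
recipℕ zero    = 0ℚ
recipℕ (suc n) = + 1 ℚ./ suc n

fromℕ : ℕ → ℚ
fromℕ n = + n ℚ./ 1

-- "A · √x < r" for rationals A, r and natural x, decided without reals
MulSqrtLt : ℚ → ℕ → ℚ → Set
MulSqrtLt A x r =
  (0ℚ ℚ.≤ A × 0ℚ ℚ.< r × A ℚ.* A ℚ.* fromℕ x ℚ.< r ℚ.* r)
  ⊎ (A ℚ.< 0ℚ × (0ℚ ℚ.< r ⊎ r ℚ.* r ℚ.< A ℚ.* A ℚ.* fromℕ x))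

-- x k^{-t} - (t - 1 - t/k + k^{-t}) √x - t/k > 1
Q0Cond : (t k x : ℕ) → Set
Q0Cond t k x =
  MulSqrtLt (fromℕ t ℚ.- 1ℚ ℚ.- fromℕ t ℚ.* recipℕ k ℚ.+ recipℕ (k ℕ.^ t))
            x
            (fromℕ x ℚ.* recipℕ (k ℕ.^ t) ℚ.- fromℕ t ℚ.* recipℕ k ℚ.- 1ℚ)

IsLeastQ0 : (t k q₀ : ℕ) → Set
IsLeastQ0 t k q₀ = 1 ≤ q₀ × Q0Cond t k q₀ × (∀ m → 1 ≤ m → m < q₀ → ¬ Q0Cond t k m)

tOf : (n : ℕ) → (Fin n → ℕ) → ℕ
tOf n b = 2 ℕ.+ sum (tabulate b)

kOf : (n : ℕ) → (Fin n → ℕ) → ℕ → ℕ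
kOf n b c = foldr lcm c (tabulate b)

{-# OPTIONS --safe #-}

-- Let S be the set of the multipliers of all θ_i, and let classes mean discrete logarithms modulo k. If a ≠ a′
-- lie outside S ∪ {0, 1}, all a - s and a′ - s with s ∈ S have one common class, a and a′ have the same class, and
-- so do a - 1 and a′ - 1, then φ = [a, a′, …, a′] works: φ, φ - id and φ - θ_i multiply x by a factor of constant
-- class that depends only on the class of x. By the pigeonhole principle it is enough to find more than k³
-- points x ∉ S ∪ {0, 1} for which all x - s have one common class.
--
-- No Weil bound is used. For exponents e on S and o ∣ k let χ_e(x) = Σ e_s ind(x - s) modulo o. Stepanov's method
-- bounds a class χ_e = v from above by a polynomial Σ r_jim y^m (y^q)^i G_j(y) with G_j a product of powers of the
-- y - s such that G_j = ζ^j on the class; it vanishes to high order on the class. If some e_s is coprime to o,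
-- it is not identically zero because its terms have distinct orders at s. In general one uses only λ
-- values of j, where λ is the number of classes with many points; a Vandermonde argument then replaces the local one.
-- This gives about q/λ points per class, and equidistribution modulo the prime powers dividing o forces λ = o.
-- Finally a weight w ≥ 0 on ℤ/k with w(0) = 0 and mean 1 on each coset of each nontrivial subgroup is summed over
-- all χ_e(x): the upper bounds for the nontrivial χ_e leave many x on which all characters are trivial.
module Submission where

open import Defs
open import Data.Nat using (ℕ; _≤_; _∸_; NonZero)
open import Data.Nat.Divisibility using (_∣_)
open import Data.Fin using (Fin)
open import Data.Product using (∃-syntax; _×_)

open import Level using (Level; 0ℓ)
open import Algebra.Bundles using (CommutativeRing; CommutativeSemiring)
open import Algebra.Morphism.Structures using (module RingMorphisms)
import Algebra.Morphism.Construct.Identity as IdHom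
import Algebra.Properties.Semiring.Exp as SemiringExp
open import Data.Empty using (⊥; ⊥-elim)
open import Data.Fin as Fin using (toℕ; fromℕ<)
import Data.Fin.Properties as Finₚ
import Data.Integer as ℤ
import Data.Integer.Properties as ℤₚ
open import Data.List using (List; []; _∷_; _++_; map; length; upTo; applyUpTo; allFin; filter; foldr; concat; concatMap; zip; tabulate; lookup; deduplicate)
open import Data.List.Membership.Propositional using (_∈_; find; lose)
open import Data.List.Membership.Propositional.Properties using (∈-upTo⁺; ∈-upTo⁻; ∈-map⁺; ∈-map⁻; ∈-filter⁻; ∈-concatMap⁻; ∈-deduplicate⁺; ∈-concat⁺′; ∈-tabulate⁺; ∈-lookup)
import Data.List.Properties as Listₚ
open import Data.List.Relation.Unary.All as All using (All; []; _∷_)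
import Data.List.Relation.Unary.All.Properties as Allₚ
open import Data.List.Relation.Unary.AllPairs using ([]; _∷_)
open import Data.List.Relation.Unary.Any as Any using (Any; here; there)
open import Data.List.Relation.Unary.Unique.DecPropositional.Properties using (deduplicate-!)
open import Data.List.Relation.Unary.Unique.Propositional using (Unique)
open import Data.List.Relation.Unary.Unique.Propositional.Properties using (map⁺; allFin⁺; filter⁺; upTo⁺)
open import Data.Nat as ℕ using (zero; suc; z≤n; s≤s; _%_; _/_)
open import Data.Nat.Coprimality as Cop using (Coprime; coprime?)
import Data.Nat.DivMod as DM
open import Data.Nat.Divisibility as Div using (_∤_; divides; _∣?_)
open import Data.Nat.GCD as GCD using (gcd; gcd-GCD; module Bézout)
open import Data.Nat.Induction using (<-wellFounded; Acc; acc)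
open import Data.Nat.LCM using (lcm; m∣lcm[m,n]; n∣lcm[m,n]; gcd*lcm)
open import Data.Nat.ListAction using (product; sum)
open import Data.Nat.Primality using (Prime; prime?; euclidsLemma; prime⇒nonZero; prime⇒nonTrivial; prime⇒irreducible; ¬prime[1])
open import Data.Nat.Primality.Factorisation using (factorise)
import Data.Nat.Properties as ℕₚ
open import Data.Nat.Tactic.RingSolver using (solve-∀)
open import Data.Product using (_,_; proj₁; proj₂)
open import Data.Rational as ℚ using (ℚ; 0ℚ; 1ℚ)
import Data.Rational.Properties as ℚₚ
open import Data.Rational.Solver using (module +-*-Solver)
import Data.Rational.Unnormalised as ℚᵘ
import Data.Rational.Unnormalised.Properties as ℚᵘₚ
open import Data.Sum using (_⊎_; inj₁; inj₂)
open import Function using (_∘_; id; Inverse)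
open import Function.Definitions using (Injective)
import Relation.Binary.Reasoning.Setoid as SetoidReasoning
open import Relation.Binary.Definitions using (DecidableEquality; tri<; tri≈; tri>)
open import Relation.Binary.PropositionalEquality as ≡ using (_≡_; _≢_; refl; cong; cong₂; sym; trans; subst; subst₂; module ≡-Reasoning)
open import Relation.Nullary using (¬_; Dec; yes; no; ¬?)
open import Relation.Nullary.Decidable using () renaming (map′ to mapDec)
open import Relation.Unary using (Pred; Decidable)

-- Power series and polynomials

-- Stepanov's method bounds classes only from above. A lower bound can therefore come only from a
-- total: a class is large because the others together cannot fill the field, and in the final count
-- a nonnegative weight makes one-sided estimates sufficient. The sum over k^r characters multiplies
-- every relative error by k^r, where d = |S| = r + 1. Taking `I = d k^d` powers of y^q brings the
-- error of one character down to the order of k^(-d), which is small enough because k ≥ 2. The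
-- method then asks for q > (k (k - 1) I)². The hypothesis on q₀ supplies this as α² < q, where α is
-- k^t times the coefficient of the square root. The obstacle is a composite order `o`. With all
-- exponents among 2, 3, 4 modulo 6, say, none is coprime to 6, so at no point s do the 6 functions
-- G_j have distinct orders, although the character is faithful. Modulo each prime power dividing
-- `o`, however, some exponent is coprime, and this partial information is what pins down λ. If |S|
-- ≤ 1 or k = 1, all classes in question agree trivially, and only the size of q matters.

module ListSum {c ℓ} (S : CommutativeSemiring c ℓ) where
  open CommutativeSemiring S renaming (refl to ≈-refl; sym to ≈-sym; trans to ≈-trans)
  open SetoidReasoning setoid
  private variable
      a : Level
      A B : Set a

  open import Algebra.Properties.CommutativeSemigroup +-commutativeSemigroup using () renaming (interchange to +-interchange)

  ∑ : List A → (A → Carrier) → Carrier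
  ∑ []       f = 0#
  ∑ (x ∷ xs) f = f x + ∑ xs f

  ∑< : ℕ → (ℕ → Carrier) → Carrier
  ∑< n = ∑ (upTo n)

  ∑-cong : ∀ (xs : List A) {f g} → (∀ {x} → x ∈ xs → f x ≈ g x) → ∑ xs f ≈ ∑ xs g
  ∑-cong []       eq = ≈-refl
  ∑-cong (x ∷ xs) eq = +-cong (eq (here refl)) (∑-cong xs (eq ∘ there))

  ∑<-cong : ∀ n {f g} → (∀ i → i ℕ.< n → f i ≈ g i) → ∑< n f ≈ ∑< n g
  ∑<-cong n eq = ∑-cong (upTo n) (λ i∈ → eq _ (∈-upTo⁻ i∈))

  ∑-0 : ∀ (xs : List A) → ∑ xs (λ _ → 0#) ≈ 0#
  ∑-0 []       = ≈-refl
  ∑-0 (x ∷ xs) = ≈-trans (+-identityˡ _) (∑-0 xs)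

  ∑-zero : ∀ (xs : List A) {f} → (∀ {x} → x ∈ xs → f x ≈ 0#) → ∑ xs f ≈ 0#
  ∑-zero xs eq = ≈-trans (∑-cong xs eq) (∑-0 xs)

  ∑-+ : ∀ (xs : List A) f g → ∑ xs (λ x → f x + g x) ≈ ∑ xs f + ∑ xs g
  ∑-+ []       f g = ≈-sym (+-identityˡ _)
  ∑-+ (x ∷ xs) f g = ≈-trans (+-congˡ (∑-+ xs f g)) (+-interchange _ _ _ _)

  ∑-*ˡ : ∀ (xs : List A) c f → ∑ xs (λ x → c * f x) ≈ c * ∑ xs f
  ∑-*ˡ []       c f = ≈-sym (zeroʳ c)
  ∑-*ˡ (x ∷ xs) c f = ≈-trans (+-congˡ (∑-*ˡ xs c f)) (≈-sym (distribˡ _ _ _))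

  ∑-*ʳ : ∀ (xs : List A) c f → ∑ xs (λ x → f x * c) ≈ ∑ xs f * c
  ∑-*ʳ xs c f = ≈-trans (∑-cong xs (λ _ → *-comm _ c)) (≈-trans (∑-*ˡ xs c f) (*-comm c _))

  ∑-++ : ∀ (xs ys : List A) f → ∑ (xs ++ ys) f ≈ ∑ xs f + ∑ ys f
  ∑-++ []       ys f = ≈-sym (+-identityˡ _)
  ∑-++ (x ∷ xs) ys f = ≈-trans (+-congˡ (∑-++ xs ys f)) (≈-sym (+-assoc _ _ _))

  ∑-map : ∀ (h : A → B) xs f → ∑ (map h xs) f ≡ ∑ xs (f ∘ h)
  ∑-map h []       f = refl
  ∑-map h (x ∷ xs) f = cong (f (h x) +_) (∑-map h xs f)

  ∑-swap : ∀ (xs : List A) (ys : List B) (f : A → B → Carrier) →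
           ∑ xs (λ x → ∑ ys (f x)) ≈ ∑ ys (λ y → ∑ xs (λ x → f x y))
  ∑-swap []       ys f = ≈-sym (∑-0 ys)
  ∑-swap (x ∷ xs) ys f = ≈-trans (+-congˡ (∑-swap xs ys f)) (≈-sym (∑-+ ys _ _))

  ∑<-suc : ∀ n f → ∑< (suc n) f ≡ f 0 + ∑< n (f ∘ suc)
  ∑<-suc n f = cong (f 0 +_)
    (trans (cong (λ xs → ∑ xs f) (sym (Listₚ.map-upTo suc n))) (∑-map suc (upTo n) f))

  ∑<-+ : ∀ m n f → ∑< (m ℕ.+ n) f ≈ ∑< m f + ∑< n (λ i → f (m ℕ.+ i))
  ∑<-+ zero    n f = ≈-sym (+-identityˡ _)
  ∑<-+ (suc m) n f = begin
    ∑< (suc m ℕ.+ n) f                                   ≡⟨ ∑<-suc (m ℕ.+ n) f ⟩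
    f 0 + ∑< (m ℕ.+ n) (f ∘ suc)                         ≈⟨ +-congˡ (∑<-+ m n (f ∘ suc)) ⟩
    f 0 + (∑< m (f ∘ suc) + ∑< n (λ i → f (suc m ℕ.+ i))) ≈⟨ +-assoc _ _ _ ⟨
    f 0 + ∑< m (f ∘ suc) + ∑< n (λ i → f (suc m ℕ.+ i))  ≡⟨ cong (_+ ∑< n (λ i → f (suc m ℕ.+ i))) (∑<-suc m f) ⟨
    ∑< (suc m) f + ∑< n (λ i → f (suc m ℕ.+ i))          ∎

  ∑<-* : ∀ m n f → ∑< (m ℕ.* n) f ≈ ∑< m (λ i → ∑< n (λ j → f (i ℕ.* n ℕ.+ j)))
  ∑<-* zero    n f = ≈-refl
  ∑<-* (suc m) n f = begin
    ∑< (n ℕ.+ m ℕ.* n) f                                    ≈⟨ ∑<-+ n (m ℕ.* n) f ⟩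
    ∑< n f + ∑< (m ℕ.* n) (λ i → f (n ℕ.+ i))               ≈⟨ +-congˡ (∑<-* m n _) ⟩
    ∑< n f + ∑< m (λ i → ∑< n (λ j → f (n ℕ.+ (i ℕ.* n ℕ.+ j))))
      ≈⟨ +-congˡ (∑-cong (upTo m) (λ {i} _ → ∑-cong (upTo n) (λ {j} _ →
           reflexive (cong f (sym (ℕₚ.+-assoc n (i ℕ.* n) j)))))) ⟩
    ∑< n f + ∑< m (λ i → ∑< n (λ j → f (suc i ℕ.* n ℕ.+ j))) ≡⟨ ∑<-suc m _ ⟨
    ∑< (suc m) (λ i → ∑< n (λ j → f (i ℕ.* n ℕ.+ j)))       ∎

  ∑<-single : ∀ n f j → j ℕ.< n → (∀ i → i ℕ.< n → i ≢ j → f i ≈ 0#) → ∑< n f ≈ f j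
  ∑<-single (suc n) f zero    j<n eq = ≈-trans (reflexive (∑<-suc n f))
    (≈-trans (+-congˡ (∑-zero (upTo n) (λ {i} i∈ → eq (suc i) (s≤s (∈-upTo⁻ i∈)) λ ()))) (+-identityʳ _))
  ∑<-single (suc n) f (suc j) (s≤s j<n) eq = ≈-trans (reflexive (∑<-suc n f))
    (≈-trans (+-cong (eq 0 (s≤s z≤n) λ ())
      (∑<-single n (f ∘ suc) j j<n (λ i i<n i≢j → eq (suc i) (s≤s i<n) (i≢j ∘ ℕₚ.suc-injective))))
      (+-identityˡ _))

module PowerSeries {c ℓ} (R : CommutativeRing c ℓ) where
  open CommutativeRing R renaming (refl to ≈-refl; sym to ≈-sym; trans to ≈-trans)
  open SetoidReasoning setoid
  open import Algebra.Solver.Ring.NaturalCoefficients.Default commutativeSemiring using (solve; _:+_; _:*_; _:=_)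
  private
    assoc-step : ∀ a b x u v → a * b * x + (a * u + v) ≈ a * (b * x + u) + v
    assoc-step = solve 5 (λ a b x u v → a :* b :* x :+ (a :* u :+ v) := a :* (b :* x :+ u) :+ v) ≈-refl
    distrib-step : ∀ a b x u v → (a + b) * x + (u + v) ≈ a * x + u + (b * x + v)
    distrib-step = solve 5 (λ a b x u v → (a :+ b) :* x :+ (u :+ v) := a :* x :+ u :+ (b :* x :+ v)) ≈-refl
    scale-step : ∀ a b x u → a * b * x + a * u ≈ a * (b * x + u)
    scale-step a b x u = ≈-trans (+-congʳ (*-assoc a b x)) (≈-sym (distribˡ a _ u))

  Ser : Set c
  Ser = ℕ → Carrier

  tail : Ser → Ser
  tail f n = f (suc n)

  infixl 7 _⊛_
  -- The Cauchy product, by recursion on the degree through f = f(0) + h · `tail` f.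
  _⊛_ : Ser → Ser → Ser
  (f ⊛ g) zero    = f 0 * g 0
  (f ⊛ g) (suc n) = f 0 * g (suc n) + (tail f ⊛ g) n

  ⊛-cong≤ : ∀ n {f f′ g g′} → (∀ l → l ℕ.≤ n → f l ≈ f′ l) → (∀ l → l ℕ.≤ n → g l ≈ g′ l) →
            (f ⊛ g) n ≈ (f′ ⊛ g′) n
  ⊛-cong≤ zero    ef eg = *-cong (ef 0 z≤n) (eg 0 z≤n)
  ⊛-cong≤ (suc n) ef eg = +-cong (*-cong (ef 0 z≤n) (eg (suc n) ℕₚ.≤-refl))
    (⊛-cong≤ n (λ l l≤n → ef (suc l) (s≤s l≤n)) (λ l l≤n → eg l (ℕₚ.m≤n⇒m≤1+n l≤n)))

  ⊛-cong : ∀ {f f′ g g′} → (∀ l → f l ≈ f′ l) → (∀ l → g l ≈ g′ l) → ∀ n → (f ⊛ g) n ≈ (f′ ⊛ g′) n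
  ⊛-cong ef eg n = ⊛-cong≤ n (λ l _ → ef l) (λ l _ → eg l)

  ⊛-sucʳ : ∀ f g n → (f ⊛ g) (suc n) ≈ (f ⊛ tail g) n + f (suc n) * g 0
  ⊛-sucʳ f g zero    = ≈-refl
  ⊛-sucʳ f g (suc n) = ≈-trans (+-congˡ (⊛-sucʳ (tail f) g n)) (≈-sym (+-assoc _ _ _))

  ⊛-comm : ∀ f g n → (f ⊛ g) n ≈ (g ⊛ f) n
  ⊛-comm f g zero    = *-comm _ _
  ⊛-comm f g (suc n) = begin
    f 0 * g (suc n) + (tail f ⊛ g) n ≈⟨ +-cong (*-comm _ _) (⊛-comm (tail f) g n) ⟩
    g (suc n) * f 0 + (g ⊛ tail f) n ≈⟨ +-comm _ _ ⟩
    (g ⊛ tail f) n + g (suc n) * f 0 ≈⟨ ⊛-sucʳ g f n ⟨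
    (g ⊛ f) (suc n)                  ∎

  ⊛-distribʳ : ∀ h f g n → ((λ l → f l + g l) ⊛ h) n ≈ (f ⊛ h) n + (g ⊛ h) n
  ⊛-distribʳ h f g zero    = distribʳ _ _ _
  ⊛-distribʳ h f g (suc n) = ≈-trans (+-congˡ (⊛-distribʳ h (tail f) (tail g) n)) (distrib-step _ _ _ _ _)

  ⊛-scaleˡ : ∀ c f g n → ((λ l → c * f l) ⊛ g) n ≈ c * (f ⊛ g) n
  ⊛-scaleˡ c f g zero    = *-assoc _ _ _
  ⊛-scaleˡ c f g (suc n) = ≈-trans (+-congˡ (⊛-scaleˡ c (tail f) g n)) (scale-step _ _ _ _)

  ⊛-assoc : ∀ f g h n → ((f ⊛ g) ⊛ h) n ≈ (f ⊛ (g ⊛ h)) n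
  ⊛-assoc f g h zero    = *-assoc _ _ _
  ⊛-assoc f g h (suc n) = begin
    f 0 * g 0 * h (suc n) + (tail (f ⊛ g) ⊛ h) n
      ≈⟨ +-congˡ (⊛-distribʳ h (λ l → f 0 * tail g l) (tail f ⊛ g) n) ⟩
    f 0 * g 0 * h (suc n) + (((λ l → f 0 * tail g l) ⊛ h) n + ((tail f ⊛ g) ⊛ h) n)
      ≈⟨ +-congˡ (+-cong (⊛-scaleˡ (f 0) (tail g) h n) (⊛-assoc (tail f) g h n)) ⟩
    f 0 * g 0 * h (suc n) + (f 0 * (tail g ⊛ h) n + (tail f ⊛ (g ⊛ h)) n)
      ≈⟨ assoc-step _ _ _ _ _ ⟩
    f 0 * (g 0 * h (suc n) + (tail g ⊛ h) n) + (tail f ⊛ (g ⊛ h)) n ∎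

  ι : Carrier → Ser
  ι c zero    = c
  ι c (suc n) = 0#

  ⊛-0ˡ : ∀ {f} g → (∀ l → f l ≈ 0#) → ∀ n → (f ⊛ g) n ≈ 0#
  ⊛-0ˡ g f≈0 zero    = ≈-trans (*-congʳ (f≈0 0)) (zeroˡ _)
  ⊛-0ˡ g f≈0 (suc n) =
    ≈-trans (+-cong (≈-trans (*-congʳ (f≈0 0)) (zeroˡ _)) (⊛-0ˡ g (f≈0 ∘ suc) n)) (+-identityˡ _)

  ι-⊛ : ∀ c f n → (ι c ⊛ f) n ≈ c * f n
  ι-⊛ c f zero    = ≈-refl
  ι-⊛ c f (suc n) = ≈-trans (+-congˡ (⊛-0ˡ f (λ _ → ≈-refl) n)) (+-identityʳ _)

  series : CommutativeRing c ℓ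
  series = record
    { Carrier = Ser
    ; _≈_ = λ f g → ∀ n → f n ≈ g n
    ; _+_ = λ f g n → f n + g n
    ; _*_ = _⊛_
    ; -_ = λ f n → - f n
    ; 0# = λ _ → 0#
    ; 1# = ι 1#
    ; isCommutativeRing = record
      { isRing = record
        { +-isAbelianGroup = record
          { isGroup = record
            { isMonoid = record
              { isSemigroup = record
                { isMagma = record
                  { isEquivalence = record
                    { refl = λ _ → ≈-refl ; sym = λ e n → ≈-sym (e n) ; trans = λ e e′ n → ≈-trans (e n) (e′ n) }
                  ; ∙-cong = λ e e′ n → +-cong (e n) (e′ n) }
                ; assoc = λ f g h n → +-assoc _ _ _ }
              ; identity = (λ f n → +-identityˡ _) , (λ f n → +-identityʳ _) }
            ; inverse = (λ f n → -‿inverseˡ _) , (λ f n → -‿inverseʳ _)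
            ; ⁻¹-cong = λ e n → -‿cong (e n) }
          ; comm = λ f g n → +-comm _ _ }
        ; *-cong = ⊛-cong
        ; *-assoc = ⊛-assoc
        ; *-identity = (λ f n → ≈-trans (ι-⊛ 1# f n) (*-identityˡ _)) ,
                       (λ f n → ≈-trans (⊛-comm f (ι 1#) n) (≈-trans (ι-⊛ 1# f n) (*-identityˡ _)))
        ; distrib = (λ h f g n → ≈-trans (⊛-comm h _ n) (≈-trans (⊛-distribʳ h f g n)
                                   (+-cong (⊛-comm f h n) (⊛-comm g h n))))
                  , ⊛-distribʳ }
      ; *-comm = ⊛-comm } }

  open RingMorphisms rawRing (CommutativeRing.rawRing series) using (IsRingHomomorphism)

  ι-isRingHomomorphism : IsRingHomomorphism ι
  ι-isRingHomomorphism = record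
    { isSemiringHomomorphism = record
      { isNearSemiringHomomorphism = record
        { +-isMonoidHomomorphism = record
          { isMagmaHomomorphism = record
            { isRelHomomorphism = record { cong = λ { e zero → e ; e (suc n) → ≈-refl } }
            ; homo = λ { x y zero → ≈-refl ; x y (suc n) → ≈-sym (+-identityˡ _) } }
          ; ε-homo = λ { zero → ≈-refl ; (suc n) → ≈-refl } }
        ; *-homo = λ { x y zero → ≈-refl
                     ; x y (suc n) → ≈-sym (≈-trans (ι-⊛ x (ι y) (suc n)) (zeroʳ _)) } }
      ; 1#-homo = λ n → ≈-refl }
    ; -‿homo = λ { x zero → ≈-refl ; x (suc n) → ≈-sym -0≈0 } }
    where
    -0≈0 : - 0# ≈ 0#
    -0≈0 = ≈-trans (≈-sym (+-identityˡ _)) (-‿inverseʳ 0#)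

  -- The variable of the power series ring; it serves as the increment in Taylor expansions.
  h : Ser
  h zero          = 0#
  h (suc zero)    = 1#
  h (suc (suc _)) = 0#

  h-⊛-zero : ∀ f → (h ⊛ f) 0 ≈ 0#
  h-⊛-zero f = zeroˡ _

  h-⊛-suc : ∀ f n → (h ⊛ f) (suc n) ≈ f n
  h-⊛-suc f n = ≈-trans (+-cong (zeroˡ _) (≈-trans (⊛-cong (λ { zero → ≈-refl ; (suc _) → ≈-refl }) (λ _ → ≈-refl) n)
    (≈-trans (ι-⊛ 1# f n) (*-identityˡ _)))) (+-identityˡ _)

-- Coefficients lie in `K`, arguments in a `K`-algebra `B`: the same coefficient list is evaluated
-- at field elements and, to obtain Taylor expansions, at power series.
module Polynomial {c ℓ c′ ℓ′} (K : CommutativeRing c ℓ) (B : CommutativeRing c′ ℓ′)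
  (ι : CommutativeRing.Carrier K → CommutativeRing.Carrier B)
  (hom : RingMorphisms.IsRingHomomorphism (CommutativeRing.rawRing K) (CommutativeRing.rawRing B) ι) where

  private module K = CommutativeRing K
  open CommutativeRing B renaming (refl to ≈-refl; sym to ≈-sym; trans to ≈-trans)
  open RingMorphisms.IsRingHomomorphism hom public
    using () renaming (+-homo to ι-+; *-homo to ι-*; 0#-homo to ι-0; 1#-homo to ι-1; ⟦⟧-cong to ι-cong; -‿homo to ι-neg)
  open SetoidReasoning setoid
  open import Algebra.Solver.Ring.NaturalCoefficients.Default commutativeSemiring using (solve; _:+_; _:*_; _:=_)
  open import Algebra.Properties.Semiring.Exp semiring using (_^_)
  open ListSum commutativeSemiring using (∑; ∑<; ∑<-suc; ∑-*ˡ; ∑-cong)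

  eval : List K.Carrier → Carrier → Carrier
  eval []       y = 0#
  eval (c ∷ cs) y = ι c + y * eval cs y

  infixl 6 _⊕_
  _⊕_ : List K.Carrier → List K.Carrier → List K.Carrier
  []       ⊕ ds       = ds
  (c ∷ cs) ⊕ []       = c ∷ cs
  (c ∷ cs) ⊕ (d ∷ ds) = (c K.+ d) ∷ (cs ⊕ ds)

  scale : K.Carrier → List K.Carrier → List K.Carrier
  scale c = map (c K.*_)

  infixl 7 _⊗_
  _⊗_ : List K.Carrier → List K.Carrier → List K.Carrier
  []       ⊗ ds = []
  (c ∷ cs) ⊗ ds = scale c ds ⊕ (K.0# ∷ (cs ⊗ ds))

  eval-⊕ : ∀ cs ds y → eval (cs ⊕ ds) y ≈ eval cs y + eval ds y
  eval-⊕ []       ds       y = ≈-sym (+-identityˡ _)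
  eval-⊕ (c ∷ cs) []       y = ≈-sym (+-identityʳ _)
  eval-⊕ (c ∷ cs) (d ∷ ds) y = ≈-trans (+-cong (ι-+ c d) (*-congˡ (eval-⊕ cs ds y)))
    (solve 5 (λ c d y u v → c :+ d :+ y :* (u :+ v) := c :+ y :* u :+ (d :+ y :* v)) ≈-refl (ι c) (ι d) y _ _)

  eval-scale : ∀ c ds y → eval (scale c ds) y ≈ ι c * eval ds y
  eval-scale c []       y = ≈-sym (zeroʳ _)
  eval-scale c (d ∷ ds) y = ≈-trans (+-cong (ι-* c d) (*-congˡ (eval-scale c ds y)))
    (solve 4 (λ c d y u → c :* d :+ y :* (c :* u) := c :* (d :+ y :* u)) ≈-refl (ι c) (ι d) y _)

  eval-⊗ : ∀ cs ds y → eval (cs ⊗ ds) y ≈ eval cs y * eval ds y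
  eval-⊗ []       ds y = ≈-sym (zeroˡ _)
  eval-⊗ (c ∷ cs) ds y = begin
    eval (scale c ds ⊕ (K.0# ∷ (cs ⊗ ds))) y            ≈⟨ eval-⊕ (scale c ds) (K.0# ∷ (cs ⊗ ds)) y ⟩
    eval (scale c ds) y + (ι K.0# + y * eval (cs ⊗ ds) y) ≈⟨ +-cong (eval-scale c ds y) (+-cong ι-0 (*-congˡ (eval-⊗ cs ds y))) ⟩
    ι c * eval ds y + (0# + y * (eval cs y * eval ds y)) ≈⟨ +-congˡ (+-identityˡ _) ⟩
    ι c * eval ds y + y * (eval cs y * eval ds y)        ≈⟨ solve 4 (λ c d y u → c :* d :+ y :* (u :* d) := (c :+ y :* u) :* d) ≈-refl (ι c) (eval ds y) y (eval cs y) ⟩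
    (ι c + y * eval cs y) * eval ds y                    ∎

  length-⊕ : ∀ {n} cs ds → length cs ℕ.≤ n → length ds ℕ.≤ n → length (cs ⊕ ds) ℕ.≤ n
  length-⊕ []       ds       p       q       = q
  length-⊕ (c ∷ cs) []       p       q       = p
  length-⊕ (c ∷ cs) (d ∷ ds) (s≤s p) (s≤s q) = s≤s (length-⊕ cs ds p q)

  length-scale : ∀ {n} c ds → length ds ℕ.≤ n → length (scale c ds) ℕ.≤ n
  length-scale c ds p = subst (ℕ._≤ _) (sym (Listₚ.length-map _ ds)) p

  length-⊗ : ∀ {m n} cs ds → length cs ℕ.≤ suc m → length ds ℕ.≤ suc n → length (cs ⊗ ds) ℕ.≤ suc (m ℕ.+ n)
  length-⊗ []       ds p q = z≤n
  length-⊗ {zero}  (c ∷ [])     ds p       q = length-⊕ (scale c ds) (K.0# ∷ []) (length-scale c ds q) (s≤s z≤n)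
  length-⊗ {zero}  (c ∷ _ ∷ _) ds (s≤s ()) q
  length-⊗ {suc m} (c ∷ cs) ds (s≤s p) q = length-⊕ (scale c ds) (K.0# ∷ (cs ⊗ ds))
    (length-scale c ds (ℕₚ.≤-trans q (s≤s (ℕₚ.m≤n+m _ (suc m))))) (s≤s (length-⊗ cs ds p q))

  -- n bounds the number of coefficients, so the degree is below n.
  Poly : ℕ → (Carrier → Carrier) → Set _
  Poly n f = ∃[ cs ] (length cs ℕ.≤ n × ∀ y → f y ≈ eval cs y)

  poly-cong : ∀ {n f g} → (∀ y → g y ≈ f y) → Poly n f → Poly n g
  poly-cong e (cs , p , eq) = cs , p , λ y → ≈-trans (e y) (eq y)

  poly-mono : ∀ {m n f} → m ℕ.≤ n → Poly m f → Poly n f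
  poly-mono m≤n (cs , p , eq) = cs , ℕₚ.≤-trans p m≤n , eq

  poly-const : ∀ c → Poly 1 (λ _ → ι c)
  poly-const c = c ∷ [] , s≤s z≤n , λ y → ≈-sym (≈-trans (+-congˡ (zeroʳ y)) (+-identityʳ _))

  poly-0 : ∀ {n} → Poly n (λ _ → 0#)
  poly-0 = [] , z≤n , λ y → ≈-refl

  poly-y* : ∀ {n f} → Poly n f → Poly (suc n) (λ y → y * f y)
  poly-y* (cs , p , eq) = K.0# ∷ cs , s≤s p , λ y → ≈-sym
    (≈-trans (+-cong ι-0 (*-congˡ (≈-sym (eq y)))) (+-identityˡ _))

  poly-+ : ∀ {n f g} → Poly n f → Poly n g → Poly n (λ y → f y + g y)
  poly-+ (cs , p , eq) (ds , p′ , eq′) = cs ⊕ ds , length-⊕ cs ds p p′ ,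
    λ y → ≈-trans (+-cong (eq y) (eq′ y)) (≈-sym (eval-⊕ cs ds y))

  poly-scale : ∀ {n f} c → Poly n f → Poly n (λ y → ι c * f y)
  poly-scale c (cs , p , eq) = scale c cs , length-scale c cs p , λ y → ≈-trans (*-congˡ (eq y)) (≈-sym (eval-scale c cs y))

  poly-* : ∀ {m n f g} → Poly (suc m) f → Poly (suc n) g → Poly (suc (m ℕ.+ n)) (λ y → f y * g y)
  poly-* (cs , p , eq) (ds , p′ , eq′) = cs ⊗ ds , length-⊗ cs ds p p′ ,
    λ y → ≈-trans (*-cong (eq y) (eq′ y)) (≈-sym (eval-⊗ cs ds y))

  poly-^ : ∀ {m f} n → Poly (suc m) f → Poly (suc (n ℕ.* m)) (λ y → f y ^ n)
  poly-^ zero    p = poly-cong (λ y → ≈-sym ι-1) (poly-const K.1#)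
  poly-^ (suc n) p = poly-* p (poly-^ n p)

  poly-id : Poly 2 (λ y → y)
  poly-id = poly-cong (λ y → ≈-sym (*-identityʳ y)) (poly-y* (poly-cong (λ y → ≈-sym ι-1) (poly-const K.1#)))

  poly-∑ : ∀ {a n} {A : Set a} (xs : List A) {f : A → Carrier → Carrier} → (∀ x → Poly n (f x)) → Poly n (λ y → ∑ xs (λ x → f x y))
  poly-∑ []       p = poly-0
  poly-∑ (x ∷ xs) p = poly-+ (p x) (poly-∑ xs p)

  poly-neg : ∀ {n f} → Poly n f → Poly n (λ y → - f y)
  poly-neg p = poly-cong (λ y → ≈-trans (≈-sym (-1*x≈-x _)) (*-congʳ (≈-sym (≈-trans (ι-neg _) (-‿cong ι-1)))))
    (poly-scale (K.- K.1#) p)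
    where open import Algebra.Properties.Ring ring using (-1*x≈-x)

  coeff : List K.Carrier → ℕ → K.Carrier
  coeff []       t       = K.0#
  coeff (c ∷ cs) zero    = c
  coeff (c ∷ cs) (suc t) = coeff cs t

  eval-coeff : ∀ {n} cs y → length cs ℕ.≤ n → eval cs y ≈ ∑< n (λ t → ι (coeff cs t) * y ^ t)
  eval-coeff {zero} [] y p = ≈-refl
  eval-coeff {suc n} [] y p = ≈-sym (ListSum.∑-zero commutativeSemiring (upTo (suc n)) (λ {t} _ → ≈-trans (*-congʳ ι-0) (zeroˡ _)))
  eval-coeff {suc n} (c ∷ cs) y (s≤s p) = begin
    ι c + y * eval cs y                                    ≈⟨ +-cong (≈-sym (*-identityʳ _)) (*-congˡ (eval-coeff cs y p)) ⟩
    ι c * 1# + y * ∑< n (λ t → ι (coeff cs t) * y ^ t)     ≈⟨ +-congˡ (∑-*ˡ (upTo n) y _) ⟨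
    ι c * 1# + ∑< n (λ t → y * (ι (coeff cs t) * y ^ t))   ≈⟨ +-congˡ (∑-cong (upTo n) (λ {t} _ →
      solve 3 (λ y c z → y :* (c :* z) := c :* (y :* z)) ≈-refl y (ι (coeff cs t)) (y ^ t))) ⟩
    ι c * 1# + ∑< n (λ t → ι (coeff cs t) * (y * y ^ t))   ≡⟨ ∑<-suc n _ ⟨
    ∑< (suc n) (λ t → ι (coeff (c ∷ cs) t) * y ^ t)        ∎

  -- The leading term is split off so that (a + y)^q - y^q visibly has degree below q, as the proof
  -- of `frobenius` requires.
  [ιa+y]^n : ∀ a n → ∃[ cs ] (length cs ℕ.≤ n × ∀ y → (ι a + y) ^ n ≈ eval cs y + y ^ n)
  [ιa+y]^n a zero    = [] , z≤n , λ y → ≈-sym (+-identityˡ _)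
  [ιa+y]^n a (suc n) with ([ιa+y]^n a n)
  ... | cs , p , eq with poly-+ (poly-+ (poly-mono (ℕₚ.n≤1+n n) (poly-scale a (cs , p , λ _ → ≈-refl))) (poly-y* (cs , p , λ _ → ≈-refl)))
                                (poly-scale a (subst (λ m → Poly m (_^ n)) (cong suc (ℕₚ.*-identityʳ n)) (poly-^ n poly-id)))
  ... | ds , p′ , eq′ = ds , p′ , λ y → begin
    (ι a + y) * (ι a + y) ^ n               ≈⟨ *-congˡ (eq y) ⟩
    (ι a + y) * (eval cs y + y ^ n)         ≈⟨ solve 4 (λ a y e z → (a :+ y) :* (e :+ z) := a :* e :+ y :* e :+ a :* z :+ y :* z) ≈-refl (ι a) y _ _ ⟩
    ι a * eval cs y + y * eval cs y + ι a * y ^ n + y * y ^ n ≈⟨ +-congʳ (eq′ y) ⟩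
    eval ds y + y * y ^ n                   ∎

module SyntheticDivision {c ℓ c′ ℓ′} (K : CommutativeRing c ℓ) (B : CommutativeRing c′ ℓ′)
  (ι : CommutativeRing.Carrier K → CommutativeRing.Carrier B)
  (hom : RingMorphisms.IsRingHomomorphism (CommutativeRing.rawRing K) (CommutativeRing.rawRing B) ι) where

  private
    module K = CommutativeRing K
    module PK = Polynomial K K id (IdHom.isRingHomomorphism K.rawRing K.refl)
  open CommutativeRing B renaming (refl to ≈-refl; sym to ≈-sym; trans to ≈-trans)
  open SetoidReasoning setoid
  open import Algebra.Solver.Ring.NaturalCoefficients.Default commutativeSemiring using (solve; _:+_; _:*_; _:=_)
  open Polynomial K B ι hom

  -- Horner's scheme: the coefficients of the quotient by y - a are the values at `a` of the
  -- successive tails.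
  quot : K.Carrier → List K.Carrier → List K.Carrier
  quot a []           = []
  quot a (c ∷ [])     = []
  quot a (c ∷ d ∷ cs) = PK.eval (d ∷ cs) a ∷ quot a (d ∷ cs)

  length-quot : ∀ {n} a cs → length cs ℕ.≤ suc n → length (quot a cs) ℕ.≤ n
  length-quot a []           p = z≤n
  length-quot a (c ∷ [])     p = z≤n
  length-quot {suc n} a (c ∷ d ∷ cs) (s≤s p) = s≤s (length-quot a (d ∷ cs) p)
  length-quot {zero} a (c ∷ d ∷ cs) (s≤s ())

  -- Here `d` is y - a. Introducing it by an equation keeps subtraction out of the identities, which
  -- are solved over a semiring.
  eval-quot : ∀ a cs {y d} → y ≈ d + ι a → eval cs y ≈ ι (PK.eval cs a) + d * eval (quot a cs) y
  eval-quot a []       {y} {d} y≈ = ≈-sym (≈-trans (+-cong ι-0 (zeroʳ d)) (+-identityˡ _))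
  eval-quot a (c ∷ []) {y} {d} y≈ = begin
    ι c + y * 0#                        ≈⟨ +-congˡ (zeroʳ y) ⟩
    ι c + 0#                            ≈⟨ +-cong (ι-cong (K.trans (K.+-congˡ (K.zeroʳ a)) (K.+-identityʳ c))) (zeroʳ d) ⟨
    ι (c K.+ a K.* K.0#) + d * 0#       ∎
  eval-quot a (c ∷ e ∷ cs) {y} {d} y≈ = begin
    ι c + y * eval (e ∷ cs) y                ≈⟨ +-congˡ (*-congˡ (eval-quot a (e ∷ cs) y≈)) ⟩
    ι c + y * (ι A + d * X)                  ≈⟨ solve 5 (λ c y A d X → c :+ y :* (A :+ d :* X) := c :+ y :* A :+ d :* (y :* X)) ≈-refl (ι c) y (ι A) d X ⟩
    ι c + y * ι A + d * (y * X)              ≈⟨ +-congʳ (+-congˡ (*-congʳ y≈)) ⟩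
    ι c + (d + ι a) * ι A + d * (y * X)      ≈⟨ solve 6 (λ c y A d X a → c :+ (d :+ a) :* A :+ d :* (y :* X) := c :+ a :* A :+ d :* (A :+ y :* X)) ≈-refl (ι c) y (ι A) d X (ι a) ⟩
    ι c + ι a * ι A + d * (ι A + y * X)      ≈⟨ +-congʳ (≈-trans (ι-+ c _) (+-congˡ (ι-* a A))) ⟨
    ι (c K.+ a K.* A) + d * (ι A + y * X)    ∎
    where
    A = PK.eval (e ∷ cs) a
    X = eval (quot a (e ∷ cs)) y

-- Finite fields

∑ℕ-const : ∀ {a} {A : Set a} (xs : List A) c → ListSum.∑ ℕₚ.+-*-commutativeSemiring xs (λ _ → c) ≡ length xs ℕ.* c
∑ℕ-const []       c = refl
∑ℕ-const (x ∷ xs) c = cong (c ℕ.+_) (∑ℕ-const xs c)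

module FieldTheory {q : ℕ} (F : FiniteField q) where
  open FiniteField F using (Carrier; isCommutativeRing; 0≢1; inverse; card)

  fieldRing : CommutativeRing 0ℓ 0ℓ
  fieldRing = record { isCommutativeRing = isCommutativeRing }

  open CommutativeRing fieldRing public using (_+_; _*_; -_; _-_; 0#; 1#;
    +-assoc; +-comm; +-identityˡ; +-identityʳ; *-assoc; *-comm; *-identityˡ; *-identityʳ; zeroˡ; zeroʳ;
    distribˡ; distribʳ; -‿inverseˡ; -‿inverseʳ; rawRing)
  open import Algebra.Properties.Semiring.Exp (CommutativeRing.semiring fieldRing) public
    using (_^_; ^-homo-*; ^-assocʳ)
  open import Algebra.Properties.CommutativeSemiring.Exp (CommutativeRing.commutativeSemiring fieldRing) public
    using (^-distrib-*)
  open import Algebra.Properties.Group (CommutativeRing.+-group fieldRing) public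
    using () renaming (⁻¹-involutive to neg-involutive; ε⁻¹≈ε to -0≡0; x∙y⁻¹≈ε⇒x≈y to x-y≡0⇒x≡y)

  private module card = Inverse card

  _≟_ : DecidableEquality Carrier
  x ≟ y = mapDec (λ e → trans (sym (card.strictlyInverseʳ x)) (trans (cong card.from e) (card.strictlyInverseʳ y)))
                 (cong card.to) (card.to x Finₚ.≟ card.to y)

  elements : List Carrier
  elements = map card.from (allFin q)

  from-injective : ∀ {i j} → card.from i ≡ card.from j → i ≡ j
  from-injective {i} {j} e = trans (sym (card.strictlyInverseˡ i)) (trans (cong card.to e) (card.strictlyInverseˡ j))

  elements-unique : Unique elements
  elements-unique = map⁺ from-injective (allFin⁺ q)

  length-elements : length elements ≡ q
  length-elements = trans (Listₚ.length-map card.from (allFin q)) (Listₚ.length-tabulate {n = q} id)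

  x*y≡0⇒y≡0 : ∀ {x y} → x ≢ 0# → x * y ≡ 0# → y ≡ 0#
  x*y≡0⇒y≡0 {x} {y} x≢0 xy≡0 with inverse x x≢0
  ... | x′ , xx′≡1 = begin
    y            ≡⟨ *-identityˡ y ⟨
    1# * y       ≡⟨ cong (_* y) (trans (sym xx′≡1) (*-comm x x′)) ⟩
    x′ * x * y   ≡⟨ *-assoc x′ x y ⟩
    x′ * (x * y) ≡⟨ cong (x′ *_) xy≡0 ⟩
    x′ * 0#      ≡⟨ zeroʳ x′ ⟩
    0#           ∎
    where open ≡-Reasoning

  *-≢0 : ∀ {x y} → x ≢ 0# → y ≢ 0# → x * y ≢ 0#
  *-≢0 x≢0 y≢0 xy≡0 = y≢0 (x*y≡0⇒y≡0 x≢0 xy≡0)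

  ^-≢0 : ∀ {x} n → x ≢ 0# → x ^ n ≢ 0#
  ^-≢0 zero    x≢0 e = 0≢1 (sym e)
  ^-≢0 (suc n) x≢0   = *-≢0 x≢0 (^-≢0 n x≢0)

  -≢0 : ∀ {x y} → x ≢ y → x - y ≢ 0#
  -≢0 x≢y e = x≢y (x-y≡0⇒x≡y _ _ e)

  *-cancelˡ : ∀ {c x y} → c ≢ 0# → c * x ≡ c * y → x ≡ y
  *-cancelˡ {c} {x} {y} c≢0 e = x-y≡0⇒x≡y x y (x*y≡0⇒y≡0 c≢0 (begin
    c * (x - y)       ≡⟨ distribˡ c x (- y) ⟩
    c * x + c * - y   ≡⟨ cong₂ _+_ e (sym (-‿distribʳ-* c y)) ⟩
    c * y - c * y     ≡⟨ -‿inverseʳ _ ⟩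
    0#                ∎))
    where
    open ≡-Reasoning
    open import Algebra.Properties.Ring (CommutativeRing.ring fieldRing) using (-‿distribʳ-*)

  module S = PowerSeries fieldRing
  open S public using (Ser; ι; h; series; _⊛_; tail; ⊛-cong; ⊛-cong≤; ι-⊛; h-⊛-suc; h-⊛-zero; ⊛-comm; ι-isRingHomomorphism)
  module 𝔸 = CommutativeRing series
  module Exp𝔸 = SemiringExp 𝔸.semiring

  module PF = Polynomial fieldRing fieldRing id (IdHom.isRingHomomorphism rawRing (CommutativeRing.refl fieldRing))
  module PA = Polynomial fieldRing series ι ι-isRingHomomorphism
  module SD = SyntheticDivision fieldRing series ι ι-isRingHomomorphism

  infix 4 _≗_
  _≗_ : Ser → Ser → Set
  f ≗ g = ∀ n → f n ≡ g n

  ⊛-lowest : ∀ u g n → (∀ l → l ℕ.< n → g l ≡ 0#) → (u ⊛ g) n ≡ u 0 * g n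
  ⊛-lowest u g zero    low = refl
  ⊛-lowest u g (suc n) low = trans (cong (u 0 * g (suc n) +_)
    (trans (⊛-cong≤ n {tail u} {tail u} {g} {λ _ → 0#} (λ _ _ → refl) (λ l l≤n → low l (s≤s l≤n)))
           (trans (⊛-comm (tail u) (λ _ → 0#) n) (S.⊛-0ˡ (tail u) (λ _ → refl) n))))
    (+-identityʳ _)

  -- A series with nonzero constant term is a unit; `⊛-lowest` isolates the coefficients of `g` one
  -- degree at a time.
  ⊛-cancel : ∀ {M} u g → u 0 ≢ 0# → (∀ l → l ℕ.< M → (u ⊛ g) l ≡ 0#) → ∀ l → l ℕ.< M → g l ≡ 0#
  ⊛-cancel {M} u g u₀≢0 low l l<M = below (suc l) l ℕₚ.≤-refl l<M
    where
    below : ∀ n l → l ℕ.< n → l ℕ.< M → g l ≡ 0#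
    below (suc n) l (s≤s l≤n) l<M = x*y≡0⇒y≡0 u₀≢0 (trans
      (sym (⊛-lowest u g l (λ l′ l′<l → below n l′ (ℕₚ.≤-trans l′<l l≤n) (ℕₚ.<-trans l′<l l<M)))) (low l l<M))

  -- Expanding along a + W(a) h instead of a + h preserves orders of vanishing where W(a) ≠ 0, and a
  -- suitable `W` clears denominators.
  line : (Carrier → Carrier) → Carrier → Ser
  line W a = ι a 𝔸.+ ι (W a) ⊛ h

  eval-0 : ∀ cs {y} → PA.eval cs y 0 ≡ PF.eval cs (y 0)
  eval-0 []       = refl
  eval-0 (c ∷ cs) {y} = cong (λ z → c + y 0 * z) (eval-0 cs)

  line-0 : ∀ W a → line W a 0 ≡ a
  line-0 W a = trans (cong (a +_) (zeroʳ (W a))) (+-identityʳ a)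

  VanishesTo : ℕ → Ser → Set
  VanishesTo M f = ∀ l → l ℕ.< M → f l ≡ 0#

  open ListSum ℕₚ.+-*-commutativeSemiring using () renaming (∑ to ∑ℕ; ∑-map to ∑ℕ-map)

  -- Induction on the degree bound, dividing out y - a. Along the line through a this factor is W(a)
  -- h, so the order there drops by exactly one. Along the line through b ≠ a its constant term is b
  -- - a ≠ 0, so no order is lost. The conclusion covers every series `y`; at y = `h` it says that
  -- the coefficients vanish.
  roots-with-multiplicity : (W : Carrier → Carrier) → ∀ D cs → length cs ℕ.≤ D →
    (ps : List (Carrier × ℕ)) → Unique (map proj₁ ps) →
    All (λ (a , m) → W a ≢ 0# × VanishesTo m (PA.eval cs (line W a))) ps →
    D ℕ.≤ ∑ℕ ps proj₂ → ∀ y → PA.eval cs y ≗ 𝔸.0#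
  roots-with-multiplicity W zero [] p ps un van D≤ y = λ _ → refl
  roots-with-multiplicity W (suc D) cs p [] un van () y
  roots-with-multiplicity W (suc D) cs p ((a , zero) ∷ ps) (_ ∷ un) (_ ∷ van) D≤ y =
    roots-with-multiplicity W (suc D) cs p ps un van D≤ y
  roots-with-multiplicity W (suc D) cs p ((a , suc m) ∷ ps) (a∉ ∷ un) ((Wa≢0 , va) ∷ van) (s≤s D≤) y = vanishes
    where
    cs′ = SD.quot a cs
    E : Ser → Ser
    E = PA.eval cs′
    c[a]≡0 : PF.eval cs a ≡ 0#
    c[a]≡0 = trans (cong (PF.eval cs) (sym (line-0 W a))) (trans (sym (eval-0 cs)) (va 0 (s≤s z≤n)))
    factor : ∀ {y d} → y ≗ d 𝔸.+ ι a → PA.eval cs y ≗ d ⊛ E y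
    factor {y} {d} e n = trans (SD.eval-quot a cs e n) (trans (cong (_+ (d ⊛ E y) n) (zero-ι n)) (+-identityˡ _))
      where
      zero-ι : ι (PF.eval cs a) ≗ 𝔸.0#
      zero-ι n = trans (PA.ι-cong c[a]≡0 n) (PA.ι-0 n)
    at-a : VanishesTo m (E (line W a))
    at-a l l<m = x*y≡0⇒y≡0 Wa≢0 (begin
      W a * E (line W a) l              ≡⟨ cong (W a *_) (h-⊛-suc (E (line W a)) l) ⟨
      W a * (h ⊛ E (line W a)) (suc l)  ≡⟨ ι-⊛ (W a) _ (suc l) ⟨
      (ι (W a) ⊛ (h ⊛ E (line W a))) (suc l) ≡⟨ 𝔸.*-assoc (ι (W a)) h _ (suc l) ⟨
      ((ι (W a) ⊛ h) ⊛ E (line W a)) (suc l) ≡⟨ factor (𝔸.+-comm (ι a) (ι (W a) ⊛ h)) (suc l) ⟨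
      PA.eval cs (line W a) (suc l)     ≡⟨ va (suc l) (s≤s l<m) ⟩
      0#                                ∎)
      where open ≡-Reasoning
    elsewhere : ∀ {b n} → a ≢ b → VanishesTo n (PA.eval cs (line W b)) → VanishesTo n (E (line W b))
    elsewhere {b} {n} a≢b vb = ⊛-cancel d (E (line W b)) d₀≢0 (λ l l<n → trans (sym (factor split l)) (vb l l<n))
      where
      d : Ser
      d = line W b 𝔸.+ 𝔸.- ι a
      d₀≢0 : d 0 ≢ 0#
      d₀≢0 e = a≢b (sym (x-y≡0⇒x≡y b a (trans (cong (_- a) (sym (line-0 W b))) e)))
      split : line W b ≗ d 𝔸.+ ι a
      split n = sym (trans (+-assoc _ _ _) (trans (cong (line W b n +_) (-‿inverseˡ (ι a n))) (+-identityʳ _)))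
    van′ : ∀ {ps} → All (a ≢_) (map proj₁ ps) →
      All (λ (b , n) → W b ≢ 0# × VanishesTo n (PA.eval cs (line W b))) ps →
      All (λ (b , n) → W b ≢ 0# × VanishesTo n (E (line W b))) ps
    van′ {[]} [] [] = []
    van′ {_ ∷ _} (a≢b ∷ a∉) ((w , vb) ∷ van) = (w , elsewhere a≢b vb) ∷ van′ a∉ van
    E≗0 : E y ≗ 𝔸.0#
    E≗0 = roots-with-multiplicity W D cs′ (SD.length-quot a cs p) ((a , m) ∷ ps) (a∉ ∷ un) ((Wa≢0 , at-a) ∷ van′ a∉ van) D≤ y
    vanishes : PA.eval cs y ≗ 𝔸.0#
    vanishes n = trans (factor {y} {y 𝔸.+ 𝔸.- ι a} split n)
      (trans (⊛-cong {y 𝔸.+ 𝔸.- ι a} (λ _ → refl) E≗0 n) (𝔸.zeroʳ (y 𝔸.+ 𝔸.- ι a) n))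
      where
      split : y ≗ (y 𝔸.+ 𝔸.- ι a) 𝔸.+ ι a
      split n = sym (trans (+-assoc _ _ _) (trans (cong (y n +_) (-‿inverseˡ (ι a n))) (+-identityʳ _)))

  roots-bound : (W : Carrier → Carrier) → ∀ {D f} → PA.Poly D f → (X : List Carrier) → Unique X → (M : ℕ) →
    (∀ {a} → a ∈ X → W a ≢ 0# × VanishesTo M (f (line W a))) →
    D ℕ.≤ length X ℕ.* M → ∀ y → f y ≗ 𝔸.0#
  roots-bound W {D} {f} (cs , p , eq) X un M van D≤ y n = trans (eq y n)
    (roots-with-multiplicity W D cs p (map (_, M) X)
      (subst Unique (trans (sym (Listₚ.map-id X)) (Listₚ.map-∘ X)) un)
      (All.tabulate λ {am} am∈ → hyp (∈-map⁻ (_, M) am∈))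
      (subst (D ℕ.≤_) (sym (trans (∑ℕ-map (_, M) X proj₂) (∑ℕ-const X M))) D≤) y n)
    where
    hyp : ∀ {am} → ∃[ a ] (a ∈ X × am ≡ (a , M)) → W (proj₁ am) ≢ 0# × VanishesTo (proj₂ am) (PA.eval cs (line W (proj₁ am)))
    hyp (a , a∈ , refl) = proj₁ (van a∈) , λ l l<M → trans (sym (eq (line W a) l)) (proj₂ (van a∈) l l<M)

  h-coeff : ∀ cs n → PA.eval cs h n ≡ PF.coeff cs n
  h-coeff []       n       = refl
  h-coeff (c ∷ cs) zero    = trans (cong (c +_) (h-⊛-zero (PA.eval cs h))) (+-identityʳ c)
  h-coeff (c ∷ cs) (suc n) = trans (+-identityˡ _) (trans (h-⊛-suc (PA.eval cs h) n) (h-coeff cs n))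

-- Linear systems, the cyclic multiplicative group and Frobenius

module FieldFacts {q : ℕ} (F : FiniteField q) where
  open FiniteField F using (Carrier; 0≢1; card)
  open FieldTheory F public
  private module card = Inverse card
  open ListSum (CommutativeRing.commutativeSemiring fieldRing) public
  open ≡-Reasoning

  1<q : 1 ℕ.< q
  1<q = ℕₚ.≤∧≢⇒< (ℕₚ.≤-trans (s≤s z≤n) (Finₚ.toℕ<n (card.to 0#))) λ { refl → 0≢1 (trans (sym (card.strictlyInverseʳ 0#))
    (trans (cong card.from (Fin1 (card.to 0#) (card.to 1#))) (card.strictlyInverseʳ 1#))) }
    where
    Fin1 : ∀ (i j : Fin 1) → i ≡ j
    Fin1 Fin.zero Fin.zero = refl

  infixr 8 _^ₐ_
  _^ₐ_ : Ser → ℕ → Ser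
  _^ₐ_ = Exp𝔸._^_

  ^ₐ-0 : ∀ f n → (f ^ₐ n) 0 ≡ f 0 ^ n
  ^ₐ-0 f zero    = refl
  ^ₐ-0 f (suc n) = cong (f 0 *_) (^ₐ-0 f n)

  ⊛-vanishes : ∀ {m} f g → f 0 ≡ 0# → VanishesTo m g → VanishesTo (suc m) (f ⊛ g)
  ⊛-vanishes f g f₀≡0 low l (s≤s l≤m) = trans (⊛-lowest f g l (λ l′ l′<l → low l′ (ℕₚ.<-≤-trans l′<l l≤m)))
    (trans (cong (_* g l) f₀≡0) (zeroˡ _))

  ^ₐ-vanishes : ∀ f n → f 0 ≡ 0# → VanishesTo n (f ^ₐ n)
  ^ₐ-vanishes f (suc n) f₀≡0 = ⊛-vanishes f (f ^ₐ n) f₀≡0 (^ₐ-vanishes f n f₀≡0)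

  h^-⊛ : ∀ n f m → ((h ^ₐ n) ⊛ f) (n ℕ.+ m) ≡ f m
  h^-⊛ zero    f m = 𝔸.*-identityˡ f m
  h^-⊛ (suc n) f m = trans (𝔸.*-assoc h (h ^ₐ n) f (suc n ℕ.+ m)) (trans (h-⊛-suc ((h ^ₐ n) ⊛ f) (n ℕ.+ m)) (h^-⊛ n f m))

  h^-⊛-vanishes : ∀ n f → VanishesTo n ((h ^ₐ n) ⊛ f)
  h^-⊛-vanishes (suc n) f l l<1+n = trans (𝔸.*-assoc h (h ^ₐ n) f l)
    (⊛-vanishes h ((h ^ₐ n) ⊛ f) refl (h^-⊛-vanishes n f) l l<1+n)

  h^-coeff : ∀ n → (h ^ₐ n) n ≡ 1#
  h^-coeff n = trans (sym (𝔸.*-identityʳ (h ^ₐ n) n))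
    (trans (cong ((h ^ₐ n) ⊛ ι 1#) (sym (ℕₚ.+-identityʳ n))) (h^-⊛ n (ι 1#) 0))

  coeff-applyUpTo : ∀ c D t → t ℕ.< D → PF.coeff (applyUpTo c D) t ≡ c t
  coeff-applyUpTo c (suc D) zero    t<D       = refl
  coeff-applyUpTo c (suc D) (suc t) (s≤s t<D) = coeff-applyUpTo (c ∘ suc) D t t<D

  -- The substitute for a Vandermonde determinant: a nonzero polynomial of degree below `D` has
  -- fewer than `D` roots.
  coefficients-zero : ∀ c D X → Unique X → D ℕ.≤ length X →
    (∀ {a} → a ∈ X → ∑< D (λ t → c t * a ^ t) ≡ 0#) → ∀ t → t ℕ.< D → c t ≡ 0#
  coefficients-zero c D X un D≤ van t t<D = trans (sym (coeff-applyUpTo c D t t<D)) (trans (sym (h-coeff cs t))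
    (roots-bound (λ _ → 1#) {D} (cs , length≤ , λ y n → refl) X un 1
      (λ {a} a∈ → 0≢1 ∘ sym , λ { zero _ → trans (eval-0 cs) (trans (cong (PF.eval cs) (line-0 _ a)) (eval≡0 a∈)) ; (suc l) (s≤s ()) })
      (subst (D ℕ.≤_) (sym (ℕₚ.*-identityʳ _)) D≤) h t))
    where
    cs = applyUpTo c D
    length≤ : length cs ℕ.≤ D
    length≤ = ℕₚ.≤-reflexive (Listₚ.length-applyUpTo c D)
    eval≡0 : ∀ {a} → a ∈ X → PF.eval cs a ≡ 0#
    eval≡0 {a} a∈ = trans (PF.eval-coeff cs a length≤)
      (trans (∑<-cong D (λ i i<D → cong (_* a ^ i) (coeff-applyUpTo c D i i<D))) (van a∈))

  -- Counting replaces elimination: q^n vectors have at most q^c < q^n images, so two of them share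
  -- an image, and their difference is a nontrivial solution.
  kernel : ∀ {n c} → c ℕ.< n → (Λ : ℕ → ℕ → Carrier) → ∃[ ρ ] ((∃[ ν ] (ν ℕ.< n × ρ ν ≢ 0#)) ×
    ∀ row → row ℕ.< c → ∑< n (λ ν → ρ ν * Λ ν row) ≡ 0#)
  kernel {n} {c} c<n Λ = let i , j , i<j , fi≡fj = Finₚ.pigeonhole (ℕₚ.^-monoʳ-< q 1<q c<n) f in difference i j i<j fi≡fj
    where
    val : Fin (q ℕ.^ n) → ℕ → Carrier
    val i ν with ν ℕ.<? n
    ... | yes ν<n = card.from (Fin.finToFun i (fromℕ< ν<n))
    ... | no  _   = 0#
    val-toℕ : ∀ i (ν : Fin n) → val i (toℕ ν) ≡ card.from (Fin.finToFun i ν)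
    val-toℕ i ν with toℕ ν ℕ.<? n
    ... | yes ν<n = cong (card.from ∘ Fin.finToFun i) (Finₚ.fromℕ<-toℕ ν ν<n)
    ... | no  ν≮n = ⊥-elim (ν≮n (Finₚ.toℕ<n ν))
    image : Fin (q ℕ.^ n) → ℕ → Carrier
    image i row = ∑< n (λ ν → val i ν * Λ ν row)
    rows : Fin (q ℕ.^ n) → Fin c → Fin q
    rows i row = card.to (image i (toℕ row))
    f : Fin (q ℕ.^ n) → Fin (q ℕ.^ c)
    f i = Fin.funToFin (rows i)
    funToFin-cong : ∀ {m k} {u v : Fin m → Fin k} → (∀ x → u x ≡ v x) → Fin.funToFin u ≡ Fin.funToFin v
    funToFin-cong {zero}  e = refl
    funToFin-cong {suc m} e = cong₂ Fin.combine (e Fin.zero) (funToFin-cong (e ∘ Fin.suc))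
    image≡rows : ∀ i {row} (row<c : row ℕ.< c) → image i row ≡ card.from (rows i (fromℕ< row<c))
    image≡rows i row<c = trans (cong (image i) (sym (Finₚ.toℕ-fromℕ< row<c))) (sym (card.strictlyInverseʳ _))
    difference : ∀ i j → toℕ i ℕ.< toℕ j → f i ≡ f j → ∃[ ρ ] ((∃[ ν ] (ν ℕ.< n × ρ ν ≢ 0#)) ×
      ∀ row → row ℕ.< c → ∑< n (λ ν → ρ ν * Λ ν row) ≡ 0#)
    difference i j i<j fi≡fj = ρ , nonzero , solves
      where
      ρ : ℕ → Carrier
      ρ ν = val i ν - val j ν
      rows≡ : ∀ row → rows i row ≡ rows j row
      rows≡ row = trans (sym (Finₚ.finToFun-funToFin (rows i) row))
        (trans (cong (λ z → Fin.finToFun {q} {c} z row) fi≡fj) (Finₚ.finToFun-funToFin (rows j) row))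
      ¬same : ¬ (∀ ν → Fin.finToFun i ν ≡ Fin.finToFun {q} {n} j ν)
      ¬same e = ℕₚ.<⇒≢ i<j (cong toℕ (trans (sym (Finₚ.funToFin-finToFin {n} {q} i)) (trans (funToFin-cong e) (Finₚ.funToFin-finToFin {n} {q} j))))
      nonzero : ∃[ ν ] (ν ℕ.< n × ρ ν ≢ 0#)
      nonzero with Finₚ.¬∀⟶∃¬ n _ (λ ν → Fin.finToFun i ν Finₚ.≟ Fin.finToFun {q} {n} j ν) ¬same
      ... | ν , ≢ = toℕ ν , Finₚ.toℕ<n ν , λ e → ≢ (from-injective
        (trans (sym (val-toℕ i ν)) (trans (x-y≡0⇒x≡y _ _ e) (val-toℕ j ν))))
      image≡ : ∀ row → row ℕ.< c → image i row ≡ image j row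
      image≡ row row<c = begin
        image i row ≡⟨ image≡rows i row<c ⟩
        card.from (rows i (fromℕ< row<c)) ≡⟨ cong card.from (rows≡ (fromℕ< row<c)) ⟩
        card.from (rows j (fromℕ< row<c)) ≡⟨ image≡rows j row<c ⟨
        image j row ∎
      solves : ∀ row → row ℕ.< c → ∑< n (λ ν → ρ ν * Λ ν row) ≡ 0#
      solves row row<c = begin
        ∑< n (λ ν → (val i ν - val j ν) * Λ ν row)
          ≡⟨ ∑<-cong n (λ ν _ → trans (distribʳ (Λ ν row) (val i ν) (- val j ν)) (cong (val i ν * Λ ν row +_)
               (trans (sym (-‿distribˡ-* _ _)) (sym (-1*x≈-x _))))) ⟩
        ∑< n (λ ν → val i ν * Λ ν row + - 1# * (val j ν * Λ ν row))
          ≡⟨ trans (∑-+ (upTo n) _ _) (cong (image i row +_) (∑-*ˡ (upTo n) (- 1#) _)) ⟩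
        image i row + - 1# * image j row ≡⟨ cong₂ _+_ (image≡ row row<c) (-1*x≈-x _) ⟩
        image j row - image j row        ≡⟨ -‿inverseʳ _ ⟩
        0# ∎
        where open import Algebra.Properties.Ring (CommutativeRing.ring fieldRing) using (-‿distribˡ-*; -1*x≈-x)

  module Generator (g : Carrier) (isGen : IsGenerator F g) where
    ^-agrees : ∀ x n → FiniteField._^_ F x n ≡ x ^ n
    ^-agrees x zero    = refl
    ^-agrees x (suc n) = cong (x *_) (^-agrees x n)

    g≢0 : g ≢ 0#
    g≢0 = proj₁ isGen

    N : ℕ
    N = q ∸ 1

    1+N≡q : suc N ≡ q
    1+N≡q = ℕₚ.m+[n∸m]≡n (ℕₚ.<⇒≤ 1<q)

    instance
      N-nonZero : NonZero N
      N-nonZero = ℕ.>-nonZero (ℕₚ.m<n⇒0<n∸m 1<q)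

    -- Some discrete logarithm, not reduced modulo `N`; the value at 0 is a placeholder.
    ind : Carrier → ℕ
    ind x with x ≟ 0#
    ... | yes _   = 0
    ... | no  x≢0 = proj₁ (proj₂ isGen x x≢0)

    g^ind : ∀ {x} → x ≢ 0# → g ^ ind x ≡ x
    g^ind {x} x≢0 with x ≟ 0#
    ... | yes x≡0 = ⊥-elim (x≢0 x≡0)
    ... | no  x≢0 = trans (sym (^-agrees g (proj₁ (proj₂ isGen x x≢0)))) (proj₂ (proj₂ isGen x x≢0))

    g^-∸ : ∀ {i j} → i ℕ.≤ j → g ^ i ≡ g ^ j → g ^ (j ∸ i) ≡ 1#
    g^-∸ {i} {j} i≤j e = *-cancelˡ (^-≢0 i g≢0) (begin
      g ^ i * g ^ (j ∸ i)  ≡⟨ ^-homo-* g i (j ∸ i) ⟨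
      g ^ (i ℕ.+ (j ∸ i))  ≡⟨ cong (g ^_) (ℕₚ.m+[n∸m]≡n i≤j) ⟩
      g ^ j                ≡⟨ e ⟨
      g ^ i                ≡⟨ *-identityʳ (g ^ i) ⟨
      g ^ i * 1#           ∎)

    1^ : ∀ n → 1# ^ n ≡ 1#
    1^ zero    = refl
    1^ (suc n) = trans (*-identityˡ _) (1^ n)

    -- If the order n were smaller, y^(n+1) - y would have q > n+1 roots.
    order-bound : ∀ n → g ^ suc n ≡ 1# → N ℕ.≤ suc n
    order-bound n e with N ℕ.≤? suc n
    ... | yes p = p
    ... | no  p = ⊥-elim (0≢1 (sym (begin
      1#                                   ≡⟨ trans (cong (λ z → 1# + z) -0≡0) (+-identityʳ 1#) ⟨
      1# - h (suc (suc n))                 ≡⟨ cong (_- h (suc (suc n))) (h^-coeff (suc (suc n))) ⟨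
      (h ^ₐ suc (suc n)) (suc (suc n)) - h (suc (suc n)) ≡⟨ roots-bound (λ _ → 1#) poly elements elements-unique 1 van
        enough h (suc (suc n)) ⟩
      0# ∎)))
      where
      enough : suc (suc (suc n)) ℕ.≤ length elements ℕ.* 1
      enough = ℕₚ.≤-trans (s≤s (ℕₚ.≰⇒> p)) (ℕₚ.≤-reflexive (trans 1+N≡q (trans (sym length-elements) (sym (ℕₚ.*-identityʳ (length elements))))))
      f : Ser → Ser
      f y = y ^ₐ suc (suc n) 𝔸.+ 𝔸.- y
      poly : PA.Poly (suc (suc (suc n))) f
      poly = PA.poly-+ (subst (λ m → PA.Poly (suc m) (_^ₐ suc (suc n))) (ℕₚ.*-identityʳ _) (PA.poly-^ (suc (suc n)) PA.poly-id))
                       (PA.poly-mono (s≤s (s≤s z≤n)) (PA.poly-neg PA.poly-id))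
      fixed : ∀ x → x ^ suc (suc n) ≡ x
      fixed x with x ≟ 0#
      ... | yes refl = zeroˡ _
      ... | no  x≢0  = trans (cong (x *_) (begin
        x ^ suc n             ≡⟨ cong (_^ suc n) (g^ind x≢0) ⟨
        (g ^ ind x) ^ suc n   ≡⟨ ^-assocʳ g (ind x) (suc n) ⟩
        g ^ (ind x ℕ.* suc n) ≡⟨ cong (g ^_) (ℕₚ.*-comm (ind x) (suc n)) ⟩
        g ^ (suc n ℕ.* ind x) ≡⟨ ^-assocʳ g (suc n) (ind x) ⟨
        (g ^ suc n) ^ ind x   ≡⟨ cong (_^ ind x) e ⟩
        1# ^ ind x            ≡⟨ 1^ (ind x) ⟩
        1#                    ∎)) (*-identityʳ x)
      van : ∀ {a} → a ∈ elements → 1# ≢ 0# × VanishesTo 1 (f (line (λ _ → 1#) a))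
      van {a} _ = 0≢1 ∘ sym , λ { zero _ → begin
          (L ^ₐ suc (suc n)) 0 - L 0 ≡⟨ cong (_- L 0) (^ₐ-0 L (suc (suc n))) ⟩
          L 0 ^ suc (suc n) - L 0    ≡⟨ cong (_- L 0) (fixed (L 0)) ⟩
          L 0 - L 0                  ≡⟨ -‿inverseʳ (L 0) ⟩
          0# ∎ ; (suc _) (s≤s ()) }
        where L = line (λ _ → 1#) a

    to-injective : ∀ {x y} → card.to x ≡ card.to y → x ≡ y
    to-injective {x} {y} e = trans (sym (card.strictlyInverseʳ x)) (trans (cong card.from e) (card.strictlyInverseʳ y))

    -- Two of the q + 1 elements 0, g^0, ..., g^(q-1) coincide, which yields a positive exponent of
    -- at most `N` that kills `g`; by `order-bound` it is no smaller than `N`.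
    g^N≡1 : g ^ N ≡ 1#
    g^N≡1 with Finₚ.pigeonhole ℕₚ.≤-refl f
      where
      f : Fin (suc q) → Fin q
      f Fin.zero    = card.to 0#
      f (Fin.suc i) = card.to (g ^ toℕ i)
    ... | Fin.zero , Fin.suc j , _ , e = ⊥-elim (^-≢0 (toℕ j) g≢0 (to-injective (sym e)))
    ... | Fin.suc i , Fin.suc j , s≤s i<j , e with toℕ j ∸ toℕ i in eq
    ... | zero  = ⊥-elim (ℕₚ.<⇒≱ i<j (ℕₚ.m∸n≡0⇒m≤n eq))
    ... | suc n = subst (λ m → g ^ m ≡ 1#) (ℕₚ.≤-antisym (ℕₚ.≤-trans (ℕₚ.≤-trans (ℕₚ.≤-reflexive (sym eq)) (ℕₚ.m∸n≤m (toℕ j) (toℕ i)))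
                      (ℕₚ.≤-pred (subst (suc (toℕ j) ℕ.≤_) (sym 1+N≡q) (Finₚ.toℕ<n j)))) (order-bound n g^1+n≡1)) g^1+n≡1
      where
      g^1+n≡1 : g ^ suc n ≡ 1#
      g^1+n≡1 = subst (λ m → g ^ m ≡ 1#) eq (g^-∸ (ℕₚ.<⇒≤ i<j) (to-injective e))

    g^N*≡1 : ∀ m → g ^ (N ℕ.* m) ≡ 1#
    g^N*≡1 m = trans (sym (^-assocʳ g N m)) (trans (cong (_^ m) g^N≡1) (1^ m))

    g^-% : ∀ m → g ^ m ≡ g ^ (m % N)
    g^-% m = begin
      g ^ m                               ≡⟨ cong (g ^_) (DM.m≡m%n+[m/n]*n m N) ⟩
      g ^ (m % N ℕ.+ m / N ℕ.* N)         ≡⟨ ^-homo-* g (m % N) _ ⟩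
      g ^ (m % N) * g ^ (m / N ℕ.* N)     ≡⟨ cong (λ z → g ^ (m % N) * g ^ z) (ℕₚ.*-comm (m / N) N) ⟩
      g ^ (m % N) * g ^ (N ℕ.* (m / N))   ≡⟨ cong (g ^ (m % N) *_) (g^N*≡1 (m / N)) ⟩
      g ^ (m % N) * 1#                    ≡⟨ *-identityʳ (g ^ (m % N)) ⟩
      g ^ (m % N)                         ∎

    g^-distinct : ∀ {i j} → i ℕ.< j → j ℕ.< N → g ^ i ≢ g ^ j
    g^-distinct {i} {j} i<j j<N e with j ∸ i in eq
    ... | zero  = ℕₚ.<⇒≱ i<j (ℕₚ.m∸n≡0⇒m≤n eq)
    ... | suc n = ℕₚ.<⇒≱ (ℕₚ.≤-<-trans (ℕₚ.≤-trans (ℕₚ.≤-reflexive (sym eq)) (ℕₚ.m∸n≤m j i)) j<N)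
      (order-bound n (subst (λ m → g ^ m ≡ 1#) eq (g^-∸ (ℕₚ.<⇒≤ i<j) e)))

    g^-injective : ∀ i j → g ^ i ≡ g ^ j → i % N ≡ j % N
    g^-injective i j e with ℕₚ.<-cmp (i % N) (j % N)
    ... | tri≈ _ eq _ = eq
    ... | tri< lt _ _ = ⊥-elim (g^-distinct lt (DM.m%n<n j N) (trans (sym (g^-% i)) (trans e (g^-% j))))
    ... | tri> _ _ gt = ⊥-elim (g^-distinct gt (DM.m%n<n i N) (trans (sym (g^-% j)) (trans (sym e) (g^-% i))))

    x^q≡x : ∀ x → x ^ q ≡ x
    x^q≡x x with x ≟ 0#
    ... | yes refl = trans (cong (0# ^_) (sym 1+N≡q)) (zeroˡ _)
    ... | no  x≢0  = trans (cong (x ^_) (sym 1+N≡q)) (trans (cong (x *_) (begin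
      x ^ N             ≡⟨ cong (_^ N) (g^ind x≢0) ⟨
      (g ^ ind x) ^ N   ≡⟨ ^-assocʳ g (ind x) N ⟩
      g ^ (ind x ℕ.* N) ≡⟨ cong (g ^_) (ℕₚ.*-comm (ind x) N) ⟩
      g ^ (N ℕ.* ind x) ≡⟨ g^N*≡1 (ind x) ⟩
      1#                ∎)) (*-identityʳ x))

    -- The difference has degree below q and vanishes on the whole field.
    frobenius : ∀ a z → (ι a 𝔸.+ z) ^ₐ q ≗ ι a 𝔸.+ z ^ₐ q
    frobenius a z n with PA.[ιa+y]^n a q
    ... | cs , p , eq = trans (eq z n) (cong (_+ (z ^ₐ q) n) (x-y≡0⇒x≡y _ _
      (roots-bound (λ _ → 1#) poly elements elements-unique 1 van
        (ℕₚ.≤-reflexive (trans (sym length-elements) (sym (ℕₚ.*-identityʳ (length elements))))) z n)))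
      where
      f : Ser → Ser
      f y = PA.eval cs y 𝔸.+ 𝔸.- ι a
      poly : PA.Poly q f
      poly = PA.poly-+ (cs , p , λ y _ → refl) (PA.poly-mono (ℕₚ.<⇒≤ 1<q) (PA.poly-neg (PA.poly-const a)))
      van : ∀ {b} → b ∈ elements → 1# ≢ 0# × VanishesTo 1 (f (line (λ _ → 1#) b))
      van {b} _ = 0≢1 ∘ sym , λ { zero _ → trans (cong (_- a) (+-cancelʳ (L 0) _ _ (begin
          PA.eval cs L 0 + L 0          ≡⟨ cong (PA.eval cs L 0 +_) (trans (^ₐ-0 L q) (x^q≡x (L 0))) ⟨
          PA.eval cs L 0 + (L ^ₐ q) 0   ≡⟨ eq L 0 ⟨
          ((ι a 𝔸.+ L) ^ₐ q) 0          ≡⟨ ^ₐ-0 (ι a 𝔸.+ L) q ⟩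
          (a + L 0) ^ q                 ≡⟨ x^q≡x (a + L 0) ⟩
          a + L 0                       ∎))) (-‿inverseʳ a) ; (suc _) (s≤s ()) }
        where
        L = line (λ _ → 1#) b
        open import Algebra.Properties.Group (CommutativeRing.+-group fieldRing) using () renaming (∙-cancelʳ to +-cancelʳ)

-- Stepanov's method

%-decode : ∀ i j n .{{_ : NonZero n}} → j ℕ.< n → (i ℕ.* n ℕ.+ j) % n ≡ j
%-decode i j n j<n = trans (cong (_% n) (ℕₚ.+-comm (i ℕ.* n) j)) (trans (DM.[m+kn]%n≡m%n j i n) (DM.m<n⇒m%n≡m j<n))

/-decode : ∀ i j n .{{_ : NonZero n}} → j ℕ.< n → (i ℕ.* n ℕ.+ j) / n ≡ i
/-decode i j n j<n = trans (DM.+-distrib-/-∣ˡ {i ℕ.* n} j (divides i refl))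
  (trans (cong₂ ℕ._+_ (DM.m*n/n≡m i n) (DM.m<n⇒m/n≡0 j<n)) (ℕₚ.+-identityʳ i))

module Stepanov {q : ℕ} (F : FiniteField q) where
  open FiniteField F using (Carrier; 0≢1)
  open FieldFacts F
  open ≡-Reasoning

  -- Each derivative costs r degrees in the base point, because denominators have to be cleared.
  record Wt (r β : ℕ) (φ : Carrier → Ser) : Set where
    constructor weighted
    field
      degree : ∀ l → PF.Poly (suc (β ℕ.+ r ℕ.* l)) (λ a → φ a l)
  open Wt

  poly-cast : ∀ {m n f} → m ≡ n → PF.Poly (suc m) f → PF.Poly (suc n) f
  poly-cast refl p = p

  wt-mono : ∀ {r β γ φ} → β ℕ.≤ γ → Wt r β φ → Wt r γ φ
  wt-mono β≤γ w = weighted λ l → PF.poly-mono (s≤s (ℕₚ.+-monoˡ-≤ _ β≤γ)) (degree w l)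

  wt-tail : ∀ {r β φ} → Wt r β φ → Wt r (β ℕ.+ r) (λ a → tail (φ a))
  wt-tail {r} {β} w = weighted λ l → poly-cast (arith β r l) (degree w (suc l))
    where
    arith : ∀ β r l → β ℕ.+ r ℕ.* suc l ≡ β ℕ.+ r ℕ.+ r ℕ.* l
    arith = solve-∀

  wt-⊛ : ∀ {r β γ φ ψ} → Wt r β φ → Wt r γ ψ → Wt r (β ℕ.+ γ) (λ a → φ a ⊛ ψ a)
  wt-⊛ {r} {β} {γ} w v = weighted (deg w v)
    where
    arith₁ : ∀ β γ r l → (β ℕ.+ r ℕ.* 0) ℕ.+ (γ ℕ.+ r ℕ.* l) ≡ β ℕ.+ γ ℕ.+ r ℕ.* l
    arith₁ = solve-∀
    arith₂ : ∀ β γ r l → β ℕ.+ r ℕ.+ γ ℕ.+ r ℕ.* l ≡ β ℕ.+ γ ℕ.+ r ℕ.* suc l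
    arith₂ = solve-∀
    deg : ∀ {β φ ψ} → Wt r β φ → Wt r γ ψ → ∀ l → PF.Poly (suc (β ℕ.+ γ ℕ.+ r ℕ.* l)) (λ a → (φ a ⊛ ψ a) l)
    deg {β} w v zero    = poly-cast (arith₁ β γ r 0) (PF.poly-* (degree w 0) (degree v 0))
    deg {β} w v (suc l) = PF.poly-+ (poly-cast (arith₁ β γ r (suc l)) (PF.poly-* (degree w 0) (degree v (suc l))))
                                    (poly-cast (arith₂ β γ r l) (deg (wt-tail w) v l))

  wt-ι : ∀ {r β c} → PF.Poly (suc β) c → Wt r β (λ a → ι (c a))
  wt-ι p = weighted λ { zero → PF.poly-mono (s≤s (ℕₚ.m≤m+n _ _)) p ; (suc l) → PF.poly-0 }

  wt-+ : ∀ {r β φ ψ} → Wt r β φ → Wt r β ψ → Wt r β (λ a → φ a 𝔸.+ ψ a)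
  wt-+ w v = weighted λ l → PF.poly-+ (degree w l) (degree v l)

  wt-neg : ∀ {r β φ} → Wt r β φ → Wt r β (λ a → 𝔸.- φ a)
  wt-neg w = weighted λ l → PF.poly-neg (degree w l)

  wt-^ : ∀ {r β φ} n → Wt r β φ → Wt r (n ℕ.* β) (λ a → φ a ^ₐ n)
  wt-^ zero    w = wt-ι (PF.poly-const 1#)
  wt-^ (suc n) w = wt-⊛ w (wt-^ n w)

  wt-ιh : ∀ {r β c} → PF.Poly (suc (β ℕ.+ r)) c → Wt r β (λ a → ι (c a) ⊛ h)
  wt-ιh {r} {β} {c} p = weighted λ
    { zero          → PF.poly-cong (λ a → zeroʳ (c a)) PF.poly-0
    ; (suc zero)    → PF.poly-cong (λ a → trans (ι-⊛ (c a) h 1) (*-identityʳ (c a)))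
                        (PF.poly-mono (s≤s (ℕₚ.≤-reflexive (cong (β ℕ.+_) (sym (ℕₚ.*-identityʳ r))))) p)
    ; (suc (suc l)) → PF.poly-cong (λ a → trans (ι-⊛ (c a) h (suc (suc l))) (zeroʳ (c a))) PF.poly-0 }

  difference-poly : ∀ s → PF.Poly 2 (λ a → a - s)
  difference-poly s = PF.poly-+ PF.poly-id (PF.poly-mono (s≤s z≤n) (PF.poly-const (- s)))

  -- The common denominator of the Taylor coefficients at `a`; it depends on the points only, not on
  -- their exponents.
  W : List (Carrier × ℕ) → Carrier → Carrier
  W []            a = 1#
  W ((s , _) ∷ L) a = (a - s) * W L a

  W-poly : ∀ L → PF.Poly (suc (length L)) (W L)
  W-poly []            = PF.poly-const 1#
  W-poly ((s , _) ∷ L) = PF.poly-* (difference-poly s) (W-poly L)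

  W-≢0 : ∀ {a} L → All (λ (s , _) → a ≢ s) L → W L a ≢ 0#
  W-≢0 []      []           = 0≢1 ∘ sym
  W-≢0 (_ ∷ L) (a≢s ∷ a≢L) = *-≢0 (-≢0 a≢s) (W-≢0 L a≢L)

  prodF : List (Carrier × ℕ) → Carrier → Carrier
  prodF []            a = 1#
  prodF ((s , u) ∷ L) a = (a - s) ^ u * prodF L a

  prodA : List (Carrier × ℕ) → Ser → Ser
  prodA []            y = 𝔸.1#
  prodA ((s , u) ∷ L) y = (y 𝔸.+ 𝔸.- ι s) ^ₐ u ⊛ prodA L y

  totalExponent : List (Carrier × ℕ) → ℕ
  totalExponent []            = 0
  totalExponent ((_ , u) ∷ L) = u ℕ.+ totalExponent L

  y-s-poly : ∀ s → PA.Poly 2 (λ y → y 𝔸.+ 𝔸.- ι s)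
  y-s-poly s = PA.poly-+ PA.poly-id (PA.poly-mono (s≤s z≤n) (PA.poly-neg (PA.poly-const s)))

  prodA-poly : ∀ L → PA.Poly (suc (totalExponent L)) (prodA L)
  prodA-poly []            = PA.poly-const 1#
  prodA-poly ((s , u) ∷ L) = PA.poly-* (subst (λ m → PA.Poly (suc m) (λ y → (y 𝔸.+ 𝔸.- ι s) ^ₐ u)) (ℕₚ.*-identityʳ u) (PA.poly-^ u (y-s-poly s))) (prodA-poly L)

  ^ₐ-cong : ∀ {f f′} n → f ≗ f′ → f ^ₐ n ≗ f′ ^ₐ n
  ^ₐ-cong zero    e = λ _ → refl
  ^ₐ-cong (suc n) e = ⊛-cong e (^ₐ-cong n e)

  prodA-cong : ∀ L {y z} → y ≗ z → prodA L y ≗ prodA L z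
  prodA-cong []            e = λ _ → refl
  prodA-cong ((s , u) ∷ L) e = ⊛-cong (^ₐ-cong u (λ n → cong (_+ (𝔸.- ι s) n) (e n))) (prodA-cong L e)

  ι-^ : ∀ c n → ι (c ^ n) ≗ ι c ^ₐ n
  ι-^ c zero    = λ _ → refl
  ι-^ c (suc n) = 𝔸.trans (PA.ι-* c (c ^ n)) (⊛-cong {ι c} (λ _ → refl) (ι-^ c n))

  -- Moving by a multiple of W clears the denominators that the Taylor coefficients of (y - s)^u have.
  prodA-line : ∀ {r} γ L (C : Carrier → Carrier) → PF.Poly (suc γ) C → γ ℕ.+ length L ℕ.≤ suc r →
    ∃[ φ ] (Wt r 0 φ × ∀ a → prodA L (line (λ a → C a * W L a) a) ≗ ι (prodF L a) ⊛ φ a)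
  prodA-line γ [] C p le = (λ a → ι 1#) , wt-ι (PF.poly-const 1#) , λ a → 𝔸.sym (𝔸.*-identityˡ 𝔸.1#)
  prodA-line {r} γ ((s , u) ∷ L) C p le = φ , wt , eq
    where
    -- The factor that leaves the list moves into the cofactor, so the increment remains the product
    -- over all points while the recursion shortens the list.
    C′ : Carrier → Carrier
    C′ a = C a * (a - s)
    rec = prodA-line (γ ℕ.+ 1) L C′ (PF.poly-* p (difference-poly s))
      (ℕₚ.≤-trans (ℕₚ.≤-reflexive (ℕₚ.+-assoc γ 1 (length L))) le)
    unit : Carrier → Ser
    unit a = ι 1# 𝔸.+ ι (C a * W L a) ⊛ h
    φ : Carrier → Ser
    φ a = unit a ^ₐ u ⊛ proj₁ rec a
    wt : Wt r 0 φ
    wt = wt-⊛ (subst (λ m → Wt r m (λ a → unit a ^ₐ u)) (ℕₚ.*-zeroʳ u) (wt-^ u (wt-+ (wt-ι (PF.poly-const 1#))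
      (wt-ιh (PF.poly-mono (ℕₚ.≤-trans (ℕₚ.≤-reflexive (sym (ℕₚ.+-suc γ (length L)))) le) (PF.poly-* p (W-poly L))))))) (proj₁ (proj₂ rec))
    base : ∀ a → line (λ a → C a * ((a - s) * W L a)) a 𝔸.+ 𝔸.- ι s ≗ ι (a - s) ⊛ unit a
    base a n = sym (begin
      (ι (a - s) ⊛ unit a) n ≡⟨ ι-⊛ (a - s) (unit a) n ⟩
      (a - s) * (ι 1# n + (ι (C a * W L a) ⊛ h) n) ≡⟨ distribˡ (a - s) _ _ ⟩
      (a - s) * ι 1# n + (a - s) * (ι (C a * W L a) ⊛ h) n ≡⟨ cong₂ _+_ (constant n) (linear n) ⟩
      (ι a n + - ι s n) + (ι (C a * ((a - s) * W L a)) ⊛ h) n ≡⟨ +-assoc _ _ _ ⟩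
      ι a n + (- ι s n + (ι (C a * ((a - s) * W L a)) ⊛ h) n) ≡⟨ cong (ι a n +_) (+-comm _ _) ⟩
      ι a n + ((ι (C a * ((a - s) * W L a)) ⊛ h) n + - ι s n) ≡⟨ +-assoc _ _ _ ⟨
      ι a n + (ι (C a * ((a - s) * W L a)) ⊛ h) n + - ι s n   ∎)
      where
      constant : ∀ n → (a - s) * ι 1# n ≡ ι a n + - ι s n
      constant zero    = *-identityʳ (a - s)
      constant (suc n) = trans (zeroʳ (a - s)) (sym (-‿inverseʳ 0#))
      linear : ∀ n → (a - s) * (ι (C a * W L a) ⊛ h) n ≡ (ι (C a * ((a - s) * W L a)) ⊛ h) n
      linear n = begin
        (a - s) * (ι (C a * W L a) ⊛ h) n ≡⟨ cong ((a - s) *_) (ι-⊛ _ h n) ⟩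
        (a - s) * (C a * W L a * h n)     ≡⟨ *-assoc _ _ _ ⟨
        (a - s) * (C a * W L a) * h n     ≡⟨ cong (_* h n) (trans (sym (*-assoc _ _ _)) (trans (cong (_* W L a) (*-comm _ _)) (*-assoc _ _ _))) ⟩
        C a * ((a - s) * W L a) * h n     ≡⟨ ι-⊛ _ h n ⟨
        (ι (C a * ((a - s) * W L a)) ⊛ h) n ∎
    rest : ∀ a → line (λ a → C a * ((a - s) * W L a)) a ≗ line (λ a → C′ a * W L a) a
    rest a n = cong (λ c → ι a n + (ι c ⊛ h) n) (sym (*-assoc _ _ _))
    eq : ∀ a → prodA ((s , u) ∷ L) (line (λ a → C a * ((a - s) * W L a)) a) ≗ ι (prodF ((s , u) ∷ L) a) ⊛ φ a
    eq a = 𝔸≈.begin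
      (y 𝔸.+ 𝔸.- ι s) ^ₐ u ⊛ prodA L y
        𝔸≈.≈⟨ ⊛-cong {(y 𝔸.+ 𝔸.- ι s) ^ₐ u} {(ι (a - s) ⊛ unit a) ^ₐ u} {prodA L y} {ι (prodF L a) ⊛ φ′ a} (^ₐ-cong u (base a)) (𝔸.trans {prodA L y} (prodA-cong L (rest a)) (proj₂ (proj₂ rec) a)) ⟩
      (ι (a - s) ⊛ unit a) ^ₐ u ⊛ (ι (prodF L a) ⊛ φ′ a)
        𝔸≈.≈⟨ ⊛-cong {(ι (a - s) ⊛ unit a) ^ₐ u} {ι (a - s) ^ₐ u ⊛ unit a ^ₐ u} (^-distrib-*ₐ (ι (a - s)) (unit a) u) (λ _ → refl) ⟩
      (ι (a - s) ^ₐ u ⊛ unit a ^ₐ u) ⊛ (ι (prodF L a) ⊛ φ′ a)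
        𝔸≈.≈⟨ interchange (ι (a - s) ^ₐ u) (unit a ^ₐ u) (ι (prodF L a)) (φ′ a) ⟩
      (ι (a - s) ^ₐ u ⊛ ι (prodF L a)) ⊛ φ a
        𝔸≈.≈⟨ ⊛-cong {_} {ι ((a - s) ^ u) ⊛ ι (prodF L a)} {φ a} (⊛-cong {ι (a - s) ^ₐ u} {ι ((a - s) ^ u)} {ι (prodF L a)} (𝔸.sym {ι ((a - s) ^ u)} (ι-^ (a - s) u)) (λ _ → refl)) (λ _ → refl) ⟩
      (ι ((a - s) ^ u) ⊛ ι (prodF L a)) ⊛ φ a
        𝔸≈.≈⟨ ⊛-cong {_} {ι (prodF ((s , u) ∷ L) a)} {φ a} (𝔸.sym {ι (prodF ((s , u) ∷ L) a)} (PA.ι-* ((a - s) ^ u) (prodF L a))) (λ _ → refl) ⟩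
      ι (prodF ((s , u) ∷ L) a) ⊛ φ a 𝔸≈.∎
      where
      y = line (λ a → C a * ((a - s) * W L a)) a
      φ′ = proj₁ rec
      module 𝔸≈ = SetoidReasoning 𝔸.setoid
      open import Algebra.Properties.CommutativeSemiring.Exp 𝔸.commutativeSemiring using () renaming (^-distrib-* to ^-distrib-*ₐ)
      open import Algebra.Properties.CommutativeSemigroup 𝔸.*-commutativeSemigroup using (interchange)

  comb : ℕ → (ℕ → Carrier) → (ℕ → Ser) → Ser
  comb n ρ f l = ∑< n (λ ν → ρ ν * f ν l)

  private
    module ∑A = ListSum 𝔸.commutativeSemiring

  comb-poly : ∀ {D} n ρ {b : ℕ → Ser → Ser} → (∀ ν → PA.Poly D (b ν)) → PA.Poly D (λ y → comb n ρ (λ ν → b ν y))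
  comb-poly {D} n ρ {b} p = PA.poly-cong (λ y l → same (upTo n) y l)
    (PA.poly-∑ (upTo n) {λ ν y → ι (ρ ν) ⊛ b ν y} (λ ν → PA.poly-scale (ρ ν) (p ν)))
    where
    same : ∀ (xs : List ℕ) y l → ∑ xs (λ ν → ρ ν * b ν y l) ≡ ∑A.∑ xs (λ ν → ι (ρ ν) ⊛ b ν y) l
    same []       y l = refl
    same (ν ∷ xs) y l = cong₂ _+_ (sym (ι-⊛ (ρ ν) (b ν y) l)) (same xs y l)

  -- The vanishing conditions are imposed at all points of `X` simultaneously. The l-th Taylor
  -- coefficient of a basis element at a is `w ν` times a polynomial in a, and the coefficients of
  -- the combined polynomial are made zero. This costs at most M · C equations, however large `X`
  -- is. It works because `w ν` does not depend on a, that is, because `X` lies in a single class.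
  auxiliary : ∀ r V {n D M B} (b : ℕ → Ser → Ser) (φ : ℕ → Carrier → Ser) (w : ℕ → Carrier) (X : List Carrier) →
    Unique X → (∀ {a} → a ∈ X → V a ≢ 0#) →
    (∀ ν → PA.Poly D (b ν)) → (∀ ν → Wt r B (φ ν)) →
    (∀ ν {a} → a ∈ X → ∀ l → l ℕ.< M → b ν (line V a) l ≡ w ν * φ ν a l) →
    M ℕ.* suc (B ℕ.+ r ℕ.* M) ℕ.< n → D ℕ.≤ length X ℕ.* M →
    ∃[ ρ ] ((∃[ ν ] (ν ℕ.< n × ρ ν ≢ 0#)) × ∀ y → comb n ρ (λ ν → b ν y) ≗ 𝔸.0#)
  auxiliary r V {n} {D} {M} {B} b φ w X un V≢0 b-poly φ-wt b-φ few D≤ =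
    let ρ , ρ≢0 , sol = kernel few (λ ν row → w ν * cf ν (row / C) (row % C))
    in ρ , ρ≢0 , roots-bound V (comb-poly n ρ b-poly) X un M (λ a∈ → V≢0 a∈ , vanishes ρ sol a∈) D≤
    where
    C = suc (B ℕ.+ r ℕ.* M)
    cf : ℕ → ℕ → ℕ → Carrier
    cf ν l = PF.coeff (proj₁ (degree (φ-wt ν) l))
    φ-eval : ∀ ν a l → l ℕ.< M → φ ν a l ≡ ∑< C (λ t → cf ν l t * a ^ t)
    φ-eval ν a l l<M = trans (proj₂ (proj₂ (degree (φ-wt ν) l)) a) (PF.eval-coeff (proj₁ (degree (φ-wt ν) l)) a
      (ℕₚ.≤-trans (proj₁ (proj₂ (degree (φ-wt ν) l))) (s≤s (ℕₚ.+-monoʳ-≤ B (ℕₚ.*-monoʳ-≤ r (ℕₚ.<⇒≤ l<M))))))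
    module _ (ρ : ℕ → Carrier)
             (sol : ∀ row → row ℕ.< M ℕ.* C → ∑< n (λ ν → ρ ν * (w ν * cf ν (row / C) (row % C))) ≡ 0#) where
      sol′ : ∀ l t → l ℕ.< M → t ℕ.< C → ∑< n (λ ν → ρ ν * (w ν * cf ν l t)) ≡ 0#
      sol′ l t l<M t<C = subst₂ (λ l t → ∑< n (λ ν → ρ ν * (w ν * cf ν l t)) ≡ 0#) (/-decode l t C t<C) (%-decode l t C t<C)
        (sol (l ℕ.* C ℕ.+ t) (ℕₚ.<-≤-trans (ℕₚ.+-monoʳ-< (l ℕ.* C) t<C)
          (ℕₚ.≤-trans (ℕₚ.≤-reflexive (ℕₚ.+-comm (l ℕ.* C) C)) (ℕₚ.*-monoˡ-≤ C l<M))))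
      vanishes : ∀ {a} → a ∈ X → VanishesTo M (comb n ρ (λ ν → b ν (line V a)))
      vanishes {a} a∈ l l<M = begin
        ∑< n (λ ν → ρ ν * b ν (line V a) l)
          ≡⟨ ∑<-cong n (λ ν _ → trans (cong (ρ ν *_) (trans (b-φ ν a∈ l l<M) (cong (w ν *_) (φ-eval ν a l l<M)))) (sym (expand ν))) ⟩
        ∑< n (λ ν → ∑< C (λ t → ρ ν * (w ν * cf ν l t) * a ^ t))
          ≡⟨ ∑-swap (upTo n) (upTo C) _ ⟩
        ∑< C (λ t → ∑< n (λ ν → ρ ν * (w ν * cf ν l t) * a ^ t))
          ≡⟨ ∑<-cong C (λ t t<C → trans (∑-*ʳ (upTo n) (a ^ t) (λ ν → ρ ν * (w ν * cf ν l t))) (trans (cong (_* a ^ t) (sol′ l t l<M t<C)) (zeroˡ (a ^ t)))) ⟩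
        ∑< C (λ _ → 0#) ≡⟨ ∑-0 (upTo C) ⟩
        0# ∎
        where
        expand : ∀ ν → ∑< C (λ t → ρ ν * (w ν * cf ν l t) * a ^ t) ≡ ρ ν * (w ν * ∑< C (λ t → cf ν l t * a ^ t))
        expand ν = begin
          ∑< C (λ t → ρ ν * (w ν * cf ν l t) * a ^ t)
            ≡⟨ ∑<-cong C (λ t _ → trans (*-assoc (ρ ν) (w ν * cf ν l t) (a ^ t)) (trans (cong (ρ ν *_) (*-assoc (w ν) (cf ν l t) (a ^ t))) (sym (*-assoc (ρ ν) (w ν) (cf ν l t * a ^ t))))) ⟩
          ∑< C (λ t → ρ ν * w ν * (cf ν l t * a ^ t)) ≡⟨ ∑-*ˡ (upTo C) (ρ ν * w ν) (λ t → cf ν l t * a ^ t) ⟩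
          ρ ν * w ν * ∑< C (λ t → cf ν l t * a ^ t)   ≡⟨ *-assoc (ρ ν) (w ν) _ ⟩
          ρ ν * (w ν * ∑< C (λ t → cf ν l t * a ^ t)) ∎

div-unique : ∀ n .{{_ : NonZero n}} {i i′ j j′} → j ℕ.< n → j′ ℕ.< n → i ℕ.* n ℕ.+ j ≡ i′ ℕ.* n ℕ.+ j′ → i ≡ i′ × j ≡ j′
div-unique n {i} {i′} {j} {j′} j<n j′<n e =
  trans (sym (/-decode i j n j<n)) (trans (cong (_/ n) e) (/-decode i′ j′ n j′<n)) ,
  trans (sym (%-decode i j n j<n)) (trans (cong (_% n) e) (%-decode i′ j′ n j′<n))

%-≡⇒∣∸ : ∀ {o} m n .{{_ : NonZero o}} → m % o ≡ n % o → o ∣ m ∸ n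
%-≡⇒∣∸ {o} m n e = divides (m / o ∸ n / o) (begin
  m ∸ n                                             ≡⟨ cong₂ _∸_ (DM.m≡m%n+[m/n]*n m o) (DM.m≡m%n+[m/n]*n n o) ⟩
  (m % o ℕ.+ m / o ℕ.* o) ∸ (n % o ℕ.+ n / o ℕ.* o) ≡⟨ cong (λ z → (z ℕ.+ m / o ℕ.* o) ∸ (n % o ℕ.+ n / o ℕ.* o)) e ⟩
  (n % o ℕ.+ m / o ℕ.* o) ∸ (n % o ℕ.+ n / o ℕ.* o) ≡⟨ ℕₚ.[m+n]∸[m+o]≡n∸o (n % o) _ _ ⟩
  m / o ℕ.* o ∸ n / o ℕ.* o                         ≡⟨ ℕₚ.*-distribʳ-∸ o (m / o) (n / o) ⟨
  (m / o ∸ n / o) ℕ.* o                             ∎)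
  where open ≡-Reasoning

*-%-injective : ∀ {o e} .{{_ : NonZero o}} → Coprime e o → ∀ {i j} → i ℕ.< o → j ℕ.< o →
                (i ℕ.* e) % o ≡ (j ℕ.* e) % o → i ≡ j
*-%-injective {o} {e} cop {i} {j} i<o j<o eq =
  ℕₚ.≤-antisym (ℕₚ.m∸n≡0⇒m≤n (small i j i<o eq)) (ℕₚ.m∸n≡0⇒m≤n (small j i j<o (sym eq)))
  where
  small : ∀ i j → i ℕ.< o → (i ℕ.* e) % o ≡ (j ℕ.* e) % o → i ∸ j ≡ 0
  small i j i<o eq with i ∸ j in d
  ... | zero  = refl
  ... | suc n = ⊥-elim (ℕₚ.<⇒≱ (ℕₚ.≤-<-trans (ℕₚ.≤-trans (ℕₚ.≤-reflexive (sym d)) (ℕₚ.m∸n≤m i j)) i<o)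
    (Div.∣⇒≤ (Cop.coprime-divisor (Cop.sym cop) (subst (o ∣_)
      (trans (sym (ℕₚ.*-distribʳ-∸ e i j)) (trans (cong (ℕ._* e) d) (ℕₚ.*-comm (suc n) e))) (%-≡⇒∣∸ (i ℕ.* e) (j ℕ.* e) eq)))))

-- Characters and the auxiliary polynomial

module Characters {q : ℕ} (F : FiniteField q) (g : FiniteField.Carrier F) (isGen : IsGenerator F g) where
  open FiniteField F using (Carrier; 0≢1)
  open FieldFacts F
  open Stepanov F
  open Generator g isGen
  open ≡-Reasoning

  Points : Set
  Points = List (Carrier × ℕ)

  Outside : Points → Carrier → Set
  Outside L x = All (λ (s , _) → x ≢ s) L

  -- For x outside the points, a discrete logarithm of ∏ (x - s)^e; it is reduced modulo the order
  -- only where a class is formed.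
  χ : Points → Carrier → ℕ
  χ []            x = 0
  χ ((s , e) ∷ L) x = e ℕ.* ind (x - s) ℕ.+ χ L x

  shift-vanish : ∀ s → ι s 𝔸.+ h 𝔸.+ 𝔸.- ι s ≗ h
  shift-vanish s n = trans (cong (_- ι s n) (+-comm (ι s n) (h n)))
    (trans (+-assoc (h n) (ι s n) (- ι s n)) (trans (cong (h n +_) (-‿inverseʳ (ι s n))) (+-identityʳ (h n))))

  ^ₐ-* : ∀ f m n → f ^ₐ (m ℕ.* n) ≗ (f ^ₐ n) ^ₐ m
  ^ₐ-* f m n l = trans (cong (λ z → (f ^ₐ z) l) (ℕₚ.*-comm m n)) (sym (Exp𝔸.^-assocʳ f n m l))

  prodA-0 : ∀ L y → prodA L y 0 ≡ prodF L (y 0)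
  prodA-0 []            y = refl
  prodA-0 ((s , u) ∷ L) y = cong₂ _*_ (^ₐ-0 (y 𝔸.+ 𝔸.- ι s) u) (prodA-0 L y)

  prodF-≢0 : ∀ {x} L → Outside L x → prodF L x ≢ 0#
  prodF-≢0 []            []           = 0≢1 ∘ sym
  prodF-≢0 ((s , u) ∷ L) (x≢s ∷ x∉) = *-≢0 (^-≢0 u (-≢0 x≢s)) (prodF-≢0 L x∉)

  -- Leading terms of pairwise distinct order cannot cancel.
  distinct-orders : ∀ n ρ (ord : ℕ → ℕ) (U : ℕ → Ser) → (∀ ν → ν ℕ.< n → U ν 0 ≢ 0#) →
    (∀ ν μ → ν ℕ.< n → μ ℕ.< n → ord ν ≡ ord μ → ν ≡ μ) →
    comb n ρ (λ ν → h ^ₐ ord ν ⊛ U ν) ≗ 𝔸.0# → ∀ ν → ν ℕ.< n → ρ ν ≡ 0#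
  distinct-orders n ρ ord U U≢0 inj vanishes ν ν<n = below (suc (ord ν)) ν ν<n ℕₚ.≤-refl
    where
    below : ∀ b ν → ν ℕ.< n → ord ν ℕ.< b → ρ ν ≡ 0#
    below (suc b) ν ν<n (s≤s le) = x*y≡0⇒y≡0 (U≢0 ν ν<n) (begin
      U ν 0 * ρ ν                        ≡⟨ *-comm _ _ ⟩
      ρ ν * U ν 0                        ≡⟨ cong (ρ ν *_) (trans (cong (h ^ₐ ord ν ⊛ U ν) (sym (ℕₚ.+-identityʳ (ord ν)))) (h^-⊛ (ord ν) (U ν) 0)) ⟨
      ρ ν * (h ^ₐ ord ν ⊛ U ν) (ord ν)   ≡⟨ ∑<-single n (λ μ → ρ μ * (h ^ₐ ord μ ⊛ U μ) (ord ν)) ν ν<n other ⟨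
      comb n ρ (λ ν → h ^ₐ ord ν ⊛ U ν) (ord ν) ≡⟨ vanishes (ord ν) ⟩
      0# ∎)
      where
      other : ∀ μ → μ ℕ.< n → μ ≢ ν → ρ μ * (h ^ₐ ord μ ⊛ U μ) (ord ν) ≡ 0#
      other μ μ<n μ≢ν with ℕₚ.<-cmp (ord μ) (ord ν)
      ... | tri< lt _ _ = trans (cong (_* (h ^ₐ ord μ ⊛ U μ) (ord ν)) (below b μ μ<n (ℕₚ.<-≤-trans lt le))) (zeroˡ _)
      ... | tri≈ _ eq _ = ⊥-elim (μ≢ν (inj μ ν μ<n ν<n eq))
      ... | tri> _ _ gt = trans (cong (ρ μ *_) (h^-⊛-vanishes (ord μ) (U μ) (ord ν) gt)) (zeroʳ (ρ μ))

  module Order (o Qo : ℕ) .{{_ : NonZero o}} (o*Qo≡N : o ℕ.* Qo ≡ N) where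

    instance
      Qo-nonZero : NonZero Qo
      Qo-nonZero = ℕ.≢-nonZero λ { refl → ℕₚ.<⇒≢ (ℕ.>-nonZero⁻¹ N) (trans (sym (ℕₚ.*-zeroʳ o)) o*Qo≡N) }

    -- Reducing j e modulo `o` before multiplying by `Qo` = N / o does not change the values away
    -- from the points, since (x - s)^N = 1 there, and it keeps each exponent at most (o - 1) Qo.
    exps : Points → ℕ → Points
    exps L j = map (λ (s , e) → s , ((j ℕ.* e) % o) ℕ.* Qo) L

    ω : Carrier
    ω = g ^ Qo

    ω^o≡1 : ω ^ o ≡ 1#
    ω^o≡1 = trans (^-assocʳ g Qo o) (trans (cong (g ^_) (trans (ℕₚ.*-comm Qo o) o*Qo≡N)) g^N≡1)

    ω^-% : ∀ m i → ω ^ ((m % o) ℕ.* i) ≡ ω ^ (m ℕ.* i)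
    ω^-% m i = begin
      ω ^ ((m % o) ℕ.* i)                              ≡⟨ *-identityʳ _ ⟨
      ω ^ ((m % o) ℕ.* i) * 1#                         ≡⟨ cong (ω ^ ((m % o) ℕ.* i) *_) (trans (cong (_^ (m / o ℕ.* i)) ω^o≡1) (1^ (m / o ℕ.* i))) ⟨
      ω ^ ((m % o) ℕ.* i) * (ω ^ o) ^ (m / o ℕ.* i)    ≡⟨ cong (ω ^ ((m % o) ℕ.* i) *_) (^-assocʳ ω o (m / o ℕ.* i)) ⟩
      ω ^ ((m % o) ℕ.* i) * ω ^ (o ℕ.* (m / o ℕ.* i))  ≡⟨ ^-homo-* ω ((m % o) ℕ.* i) (o ℕ.* (m / o ℕ.* i)) ⟨
      ω ^ ((m % o) ℕ.* i ℕ.+ o ℕ.* (m / o ℕ.* i))      ≡⟨ cong (ω ^_) (arith (m % o) i o (m / o)) ⟩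
      ω ^ ((m % o ℕ.+ m / o ℕ.* o) ℕ.* i)              ≡⟨ cong (λ z → ω ^ (z ℕ.* i)) (DM.m≡m%n+[m/n]*n m o) ⟨
      ω ^ (m ℕ.* i)                                    ∎
      where
      arith : ∀ a i o b → a ℕ.* i ℕ.+ o ℕ.* (b ℕ.* i) ≡ (a ℕ.+ b ℕ.* o) ℕ.* i
      arith = solve-∀

    ω^-distinct : ∀ {v v′} → v ℕ.< o → v′ ℕ.< o → ω ^ v ≡ ω ^ v′ → v ≡ v′
    ω^-distinct {v} {v′} v<o v′<o e with ℕₚ.<-cmp v v′
    ... | tri≈ _ eq _ = eq
    ... | tri< lt _ _ = ⊥-elim (g^-distinct (ℕₚ.*-monoʳ-< Qo lt) (bound v′<o) (trans (sym (^-assocʳ g Qo v)) (trans e (^-assocʳ g Qo v′))))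
      where
      bound : ∀ {v} → v ℕ.< o → Qo ℕ.* v ℕ.< N
      bound v<o = ℕₚ.<-≤-trans (ℕₚ.*-monoʳ-< Qo v<o) (ℕₚ.≤-reflexive (trans (ℕₚ.*-comm Qo o) o*Qo≡N))
    ... | tri> _ _ gt = ⊥-elim (g^-distinct (ℕₚ.*-monoʳ-< Qo gt) (bound v<o) (trans (sym (^-assocʳ g Qo v′)) (trans (sym e) (^-assocʳ g Qo v))))
      where
      bound : ∀ {v} → v ℕ.< o → Qo ℕ.* v ℕ.< N
      bound v<o = ℕₚ.<-≤-trans (ℕₚ.*-monoʳ-< Qo v<o) (ℕₚ.≤-reflexive (trans (ℕₚ.*-comm Qo o) o*Qo≡N))

    prodF-exps : ∀ L j {x} → Outside L x → prodF (exps L j) x ≡ ω ^ (j ℕ.* χ L x)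
    prodF-exps []            j []          = cong (ω ^_) (sym (ℕₚ.*-zeroʳ j))
    prodF-exps ((s , e) ∷ L) j {x} (x≢s ∷ x∉) = begin
      (x - s) ^ ((j ℕ.* e) % o ℕ.* Qo) * prodF (exps L j) x
        ≡⟨ cong₂ _*_ head (prodF-exps L j x∉) ⟩
      ω ^ (j ℕ.* e ℕ.* i) * ω ^ (j ℕ.* χ L x) ≡⟨ ^-homo-* ω (j ℕ.* e ℕ.* i) (j ℕ.* χ L x) ⟨
      ω ^ (j ℕ.* e ℕ.* i ℕ.+ j ℕ.* χ L x)     ≡⟨ cong (ω ^_) (arith j e i (χ L x)) ⟩
      ω ^ (j ℕ.* (e ℕ.* i ℕ.+ χ L x))         ∎
      where
      i = ind (x - s)
      arith : ∀ j e i c → j ℕ.* e ℕ.* i ℕ.+ j ℕ.* c ≡ j ℕ.* (e ℕ.* i ℕ.+ c)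
      arith = solve-∀
      arith₂ : ∀ i m Q → i ℕ.* (m ℕ.* Q) ≡ Q ℕ.* (m ℕ.* i)
      arith₂ = solve-∀
      head : (x - s) ^ ((j ℕ.* e) % o ℕ.* Qo) ≡ ω ^ (j ℕ.* e ℕ.* i)
      head = begin
        (x - s) ^ ((j ℕ.* e) % o ℕ.* Qo)   ≡⟨ cong (_^ ((j ℕ.* e) % o ℕ.* Qo)) (g^ind (-≢0 x≢s)) ⟨
        (g ^ i) ^ ((j ℕ.* e) % o ℕ.* Qo)   ≡⟨ ^-assocʳ g i ((j ℕ.* e) % o ℕ.* Qo) ⟩
        g ^ (i ℕ.* ((j ℕ.* e) % o ℕ.* Qo)) ≡⟨ cong (g ^_) (arith₂ i ((j ℕ.* e) % o) Qo) ⟩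
        g ^ (Qo ℕ.* ((j ℕ.* e) % o ℕ.* i)) ≡⟨ ^-assocʳ g Qo ((j ℕ.* e) % o ℕ.* i) ⟨
        ω ^ ((j ℕ.* e) % o ℕ.* i)          ≡⟨ ω^-% (j ℕ.* e) i ⟩
        ω ^ (j ℕ.* e ℕ.* i)                ∎

    prodF-exps-% : ∀ L j {x} → Outside L x → prodF (exps L j) x ≡ (ω ^ (χ L x % o)) ^ j
    prodF-exps-% L j {x} x∉ = begin
      prodF (exps L j) x          ≡⟨ prodF-exps L j x∉ ⟩
      ω ^ (j ℕ.* χ L x)           ≡⟨ cong (ω ^_) (ℕₚ.*-comm j (χ L x)) ⟩
      ω ^ (χ L x ℕ.* j)           ≡⟨ ω^-% (χ L x) j ⟨
      ω ^ (χ L x % o ℕ.* j)       ≡⟨ ^-assocʳ ω (χ L x % o) j ⟨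
      (ω ^ (χ L x % o)) ^ j       ∎

    W-exps : ∀ L j a → W (exps L j) a ≡ W L a
    W-exps []      j a = refl
    W-exps (_ ∷ L) j a = cong (_ *_) (W-exps L j a)

    totalExponent-exps : ∀ L j → totalExponent (exps L j) ℕ.≤ length L ℕ.* ((o ∸ 1) ℕ.* Qo)
    totalExponent-exps []            j = z≤n
    totalExponent-exps ((s , e) ∷ L) j = ℕₚ.+-mono-≤ (ℕₚ.*-monoˡ-≤ Qo (ℕₚ.≤-pred (subst ((j ℕ.* e) % o ℕ.<_)
      (sym (ℕₚ.suc-pred o)) (DM.m%n<n (j ℕ.* e) o)))) (totalExponent-exps L j)

    -- The two variants of the method share everything but `ψ`, a form of y^q adapted to the
    -- independence proof, and the centre `a*`. A basis element is numbered in mixed radix by its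
    -- digits j, i, m.
    module Basis (L : Points) (a* : Carrier) (I R : ℕ) .{{_ : NonZero I}} .{{_ : NonZero R}} (ψ : Ser → Ser) where
      idx-m idx-i idx-j : ℕ → ℕ
      idx-m ν = ν % R
      idx-i ν = ν / R % I
      idx-j ν = ν / R / I

      index : ℕ → ℕ → ℕ → ℕ
      index j i m = (j ℕ.* I ℕ.+ i) ℕ.* R ℕ.+ m

      index-idx : ∀ ν → index (idx-j ν) (idx-i ν) (idx-m ν) ≡ ν
      index-idx ν = trans (cong (λ z → z ℕ.* R ℕ.+ ν % R) (trans (ℕₚ.+-comm _ (ν / R % I)) (sym (DM.m≡m%n+[m/n]*n (ν / R) I))))
        (trans (ℕₚ.+-comm _ (ν % R)) (sym (DM.m≡m%n+[m/n]*n ν R)))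

      idx-j< : ∀ {λ′ ν} → ν ℕ.< λ′ ℕ.* I ℕ.* R → idx-j ν ℕ.< λ′
      idx-j< ν<n = DM.m<n*o⇒m/o<n (DM.m<n*o⇒m/o<n ν<n)

      basis : ℕ → Ser → Ser
      basis ν y = ((y 𝔸.+ 𝔸.- ι a*) ^ₐ idx-m ν ⊛ ψ y ^ₐ idx-i ν) ⊛ prodA (exps L (idx-j ν)) y

      degree-bound : ℕ
      degree-bound = ((R ∸ 1) ℕ.+ (I ∸ 1) ℕ.* q) ℕ.+ length L ℕ.* ((o ∸ 1) ℕ.* Qo)

      m≤ : ∀ ν → idx-m ν ℕ.≤ R ∸ 1
      m≤ ν = ℕₚ.≤-pred (subst (idx-m ν ℕ.<_) (sym (ℕₚ.suc-pred R)) (DM.m%n<n ν R))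

      i≤ : ∀ ν → idx-i ν ℕ.≤ I ∸ 1
      i≤ ν = ℕₚ.≤-pred (subst (idx-i ν ℕ.<_) (sym (ℕₚ.suc-pred I)) (DM.m%n<n (ν / R) I))

      basis-poly : PA.Poly (suc q) ψ → ∀ ν → PA.Poly (suc degree-bound) (basis ν)
      basis-poly ψ-poly ν = PA.poly-mono (s≤s (ℕₚ.+-mono-≤ (ℕₚ.+-mono-≤ (ℕₚ.≤-trans (ℕₚ.≤-reflexive (ℕₚ.*-identityʳ _)) (m≤ ν))
                                                 (ℕₚ.*-monoˡ-≤ q (i≤ ν))) (totalExponent-exps L (idx-j ν))))
        (PA.poly-* (PA.poly-* (PA.poly-^ (idx-m ν) (y-s-poly a*)) (PA.poly-^ (idx-i ν) ψ-poly)) (prodA-poly (exps L (idx-j ν))))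

      module _ {r} (length≡ : length L ≡ suc r) (Ψ : Carrier → Ser) (Ψ-wt : Wt r 1 Ψ)
               (ψ≡Ψ : ∀ a l → l ℕ.< q → ψ (line (W L) a) l ≡ Ψ a l) (ψ-poly : PA.Poly (suc q) ψ) where

        private
          linear : Carrier → Ser
          linear a = ι (a - a*) 𝔸.+ ι (W L a) ⊛ h

          linear-wt : Wt r 1 linear
          linear-wt = wt-+ (wt-ι (difference-poly a*)) (wt-ιh (PF.poly-mono (s≤s (ℕₚ.≤-reflexive length≡)) (W-poly L)))

          line-linear : ∀ a → line (W L) a 𝔸.+ 𝔸.- ι a* ≗ linear a
          line-linear a n = trans (+-assoc (ι a n) _ _) (trans (cong (ι a n +_) (+-comm _ _)) (trans (sym (+-assoc (ι a n) _ _))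
            (cong (_+ (ι (W L a) ⊛ h) n) (constant n))))
            where
            constant : ∀ n → ι a n + - ι a* n ≡ ι (a - a*) n
            constant zero    = refl
            constant (suc n) = -‿inverseʳ 0#

          prod : ∀ j → ∃[ φ ] (Wt r 0 φ × ∀ a → prodA (exps L j) (line (W L) a) ≗ ι (prodF (exps L j) a) ⊛ φ a)
          prod j with prodA-line {r} 0 (exps L j) (λ _ → 1#) (PF.poly-const 1#) (ℕₚ.≤-reflexive (trans (Listₚ.length-map _ L) length≡))
          ... | φ , wt , eq = φ , wt , λ a → 𝔸.trans
            (prodA-cong (exps L j) (λ n → cong (λ c → ι a n + (ι c ⊛ h) n) (trans (sym (W-exps L j a)) (sym (*-identityˡ _))))) (eq a)

          φ : ℕ → Carrier → Ser
          φ ν a = (linear a ^ₐ idx-m ν ⊛ Ψ a ^ₐ idx-i ν) ⊛ proj₁ (prod (idx-j ν)) a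

          φ-wt : ∀ ν → Wt r ((R ∸ 1) ℕ.+ (I ∸ 1)) (φ ν)
          φ-wt ν = wt-mono (ℕₚ.≤-trans (ℕₚ.≤-reflexive (trans (ℕₚ.+-identityʳ _) (cong₂ ℕ._+_ (ℕₚ.*-identityʳ (idx-m ν)) (ℕₚ.*-identityʳ (idx-i ν)))))
                              (ℕₚ.+-mono-≤ (m≤ ν) (i≤ ν)))
            (wt-⊛ (wt-⊛ (wt-^ (idx-m ν) linear-wt) (wt-^ (idx-i ν) Ψ-wt)) (proj₁ (proj₂ (prod (idx-j ν)))))

          ^ₐ-cong< : ∀ {f f′} n → (∀ l → l ℕ.< q → f l ≡ f′ l) → ∀ l → l ℕ.< q → (f ^ₐ n) l ≡ (f′ ^ₐ n) l
          ^ₐ-cong< zero    e l l<q = refl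
          ^ₐ-cong< (suc n) e l l<q = ⊛-cong≤ l (λ l′ l′≤l → e l′ (ℕₚ.≤-<-trans l′≤l l<q)) (λ l′ l′≤l → ^ₐ-cong< n e l′ (ℕₚ.≤-<-trans l′≤l l<q))

          basis≡ : ∀ ν a l → l ℕ.< q → basis ν (line (W L) a) l ≡ prodF (exps L (idx-j ν)) a * φ ν a l
          basis≡ ν a l l<q = begin
            basis ν (line (W L) a) l
              ≡⟨ ⊛-cong≤ l (λ l′ l′≤l → ⊛-cong≤ l′ (λ l″ _ → ^ₐ-cong (idx-m ν) (line-linear a) l″)
                              (λ l″ l″≤l′ → ^ₐ-cong< (idx-i ν) (ψ≡Ψ a) l″ (ℕₚ.≤-<-trans (ℕₚ.≤-trans l″≤l′ l′≤l) l<q)))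
                           (λ l′ _ → proj₂ (proj₂ (prod (idx-j ν))) a l′) ⟩
            ((linear a ^ₐ idx-m ν ⊛ Ψ a ^ₐ idx-i ν) ⊛ (ι c ⊛ φG)) l
              ≡⟨ x∙yz≈y∙xz (linear a ^ₐ idx-m ν ⊛ Ψ a ^ₐ idx-i ν) (ι c) φG l ⟩
            (ι c ⊛ φ ν a) l ≡⟨ ι-⊛ c (φ ν a) l ⟩
            c * φ ν a l     ∎
            where
            c = prodF (exps L (idx-j ν)) a
            φG = proj₁ (prod (idx-j ν)) a
            open import Algebra.Properties.CommutativeSemigroup 𝔸.*-commutativeSemigroup using (x∙yz≈y∙xz)

        -- If the bound failed, the auxiliary combination would have more zeros, counted with
        -- multiplicity, than its degree allows; it would be identically zero, against independence.
        -- `M ≤ q` enters because `ψ` along a line is known only modulo h^q.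
        stepanov : ∀ {λ′ M v} (X : List Carrier) → Unique X → (∀ {a} → a ∈ X → Outside L a × χ L a % o ≡ v) → M ℕ.≤ q →
          M ℕ.* suc ((R ∸ 1) ℕ.+ (I ∸ 1) ℕ.+ r ℕ.* M) ℕ.< λ′ ℕ.* I ℕ.* R →
          (∀ ρ → (∀ y → comb (λ′ ℕ.* I ℕ.* R) ρ (λ ν → basis ν y) ≗ 𝔸.0#) → ∀ ν → ν ℕ.< λ′ ℕ.* I ℕ.* R → ρ ν ≡ 0#) →
          length X ℕ.* M ℕ.≤ degree-bound
        stepanov {λ′} {M} {v} X un X-spec M≤q few indep with suc degree-bound ℕ.≤? length X ℕ.* M
        ... | no ≰ = ℕₚ.≤-pred (ℕₚ.≰⇒> ≰)
        ... | yes D≤ = let ρ , (ν , ν<n , ρ≢0) , vanishes = found in ⊥-elim (ρ≢0 (indep ρ vanishes ν ν<n))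
          where
          value : ∀ ν {a} → a ∈ X → ∀ l → l ℕ.< M → basis ν (line (W L) a) l ≡ (ω ^ v) ^ idx-j ν * φ ν a l
          value ν {a} a∈ l l<M = trans (basis≡ ν a l (ℕₚ.<-≤-trans l<M M≤q))
            (cong (_* φ ν a l) (trans (prodF-exps-% L (idx-j ν) (proj₁ (X-spec a∈))) (cong (λ z → (ω ^ z) ^ idx-j ν) (proj₂ (X-spec a∈)))))
          found = auxiliary r (W L) basis φ (λ ν → (ω ^ v) ^ idx-j ν) X un (λ a∈ → W-≢0 L (proj₁ (X-spec a∈)))
                    (basis-poly ψ-poly) φ-wt value few D≤

-- Independence of the terms of the auxiliary polynomial

module NonVanishing {q : ℕ} (F : FiniteField q) (g : FiniteField.Carrier F) (isGen : IsGenerator F g) where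
  open FiniteField F using (Carrier; 0≢1)
  open FieldFacts F
  open Stepanov F
  open Generator g isGen
  open Characters F g isGen
  open ≡-Reasoning

  Distinct : Points → Set
  Distinct L = Unique (map proj₁ L)

  q≡1+N : q ≡ suc N
  q≡1+N = sym 1+N≡q

  module _ (o Qo : ℕ) .{{_ : NonZero o}} (o*Qo≡N : o ℕ.* Qo ≡ N) where
    open Order o Qo o*Qo≡N

    outside-exps : ∀ {s x} L j → x ≡ s → All (s ≢_) (map proj₁ L) → Outside (exps L j) x
    outside-exps []      j refl []         = []
    outside-exps (_ ∷ L) j refl (p ∷ ps) = p ∷ outside-exps L j refl ps

    -- The points are distinct, so at s + h only the factor belonging to s has zero constant term;
    -- the others form the unit `U`.
    prodA-at-point : ∀ L j {s e} → Distinct L → (s , e) ∈ L →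
      ∃[ U ] (U 0 ≢ 0# × prodA (exps L j) (ι s 𝔸.+ h) ≗ h ^ₐ (((j ℕ.* e) % o) ℕ.* Qo) ⊛ U)
    prodA-at-point ((s , e) ∷ L) j (s∉ ∷ un) (here refl) =
      prodA (exps L j) y ,
      (λ U₀≡0 → prodF-≢0 (exps L j) (outside-exps L j (+-identityʳ s) s∉) (trans (sym (prodA-0 (exps L j) y)) U₀≡0)) ,
      ⊛-cong {_} {_} {prodA (exps L j) y} (^ₐ-cong (((j ℕ.* e) % o) ℕ.* Qo) (shift-vanish s)) (λ _ → refl)
      where y = ι s 𝔸.+ h
    prodA-at-point ((s′ , e′) ∷ L) j {s} {e} (s′∉ ∷ un) (there s∈) with prodA-at-point L j un s∈
    ... | U , U₀≢0 , eq = A ⊛ U , *-≢0 A₀≢0 U₀≢0 ,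
        λ n → trans (⊛-cong {A} (λ _ → refl) eq n) (x∙yz≈y∙xz A (h ^ₐ (((j ℕ.* e) % o) ℕ.* Qo)) U n)
      where
      open import Algebra.Properties.CommutativeSemigroup 𝔸.*-commutativeSemigroup using (x∙yz≈y∙xz)
      u = ((j ℕ.* e′) % o) ℕ.* Qo
      A = (ι s 𝔸.+ h 𝔸.+ 𝔸.- ι s′) ^ₐ u
      s′≢s : s′ ≢ s
      s′≢s = All.lookup s′∉ (∈-map⁺ proj₁ s∈)
      A₀≢0 : A 0 ≢ 0#
      A₀≢0 e = ^-≢0 u (-≢0 (s′≢s ∘ sym)) (trans (cong (λ z → (z - s′) ^ u) (sym (+-identityʳ s))) (trans (sym (^ₐ-0 (ι s 𝔸.+ h 𝔸.+ 𝔸.- ι s′) u)) e))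

    -- Independence is read off at the single point s. By Frobenius y^q - s becomes h^q at y = s +
    -- h, so every basis element there is a power of h times a unit, and only the exponents have to
    -- be compared.
    module Ramified (L : Points) {s e} (s∈ : (s , e) ∈ L) (distinct : Distinct L) (cop : Coprime e o)
                    (I R : ℕ) .{{_ : NonZero I}} .{{_ : NonZero R}} (R≤Qo : R ℕ.≤ Qo) where
      ψ : Ser → Ser
      ψ y = y ^ₐ q 𝔸.+ 𝔸.- ι s

      open Basis L s I R ψ

      ψ-poly : PA.Poly (suc q) ψ
      ψ-poly = PA.poly-+ (subst (λ m → PA.Poly (suc m) (_^ₐ q)) (ℕₚ.*-identityʳ q) (PA.poly-^ q PA.poly-id))
                         (PA.poly-mono (s≤s z≤n) (PA.poly-neg (PA.poly-const s)))

      ψ≡ : ∀ a l → l ℕ.< q → ψ (line (W L) a) l ≡ ι (a - s) l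
      ψ≡ a l l<q = trans (cong (_- ι s l) (trans (frobenius a (ι (W L a) ⊛ h) l)
          (trans (cong (ι a l +_) (^ₐ-vanishes (ι (W L a) ⊛ h) q (zeroʳ (W L a)) l l<q)) (+-identityʳ (ι a l))))) (constant l)
        where
        constant : ∀ n → ι a n + - ι s n ≡ ι (a - s) n
        constant zero    = refl
        constant (suc n) = -‿inverseʳ 0#

      u : ℕ → ℕ
      u j = (j ℕ.* e) % o ℕ.* Qo

      ord : ℕ → ℕ
      ord ν = idx-m ν ℕ.+ idx-i ν ℕ.* q ℕ.+ u (idx-j ν)

      y₀ : Ser
      y₀ = ι s 𝔸.+ h

      ψ-y₀ : ψ y₀ ≗ h ^ₐ q
      ψ-y₀ n = trans (cong (_- ι s n) (trans (frobenius s h n) (+-comm (ι s n) ((h ^ₐ q) n))))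
        (trans (+-assoc ((h ^ₐ q) n) (ι s n) (- ι s n)) (trans (cong ((h ^ₐ q) n +_) (-‿inverseʳ (ι s n))) (+-identityʳ ((h ^ₐ q) n))))

      at : ∀ j → ∃[ U ] (U 0 ≢ 0# × prodA (exps L j) y₀ ≗ h ^ₐ u j ⊛ U)
      at j = prodA-at-point L j distinct s∈

      basis-y₀ : ∀ ν → basis ν y₀ ≗ h ^ₐ ord ν ⊛ proj₁ (at (idx-j ν))
      basis-y₀ ν = 𝔸≈.begin
        ((y₀ 𝔸.+ 𝔸.- ι s) ^ₐ idx-m ν ⊛ ψ y₀ ^ₐ idx-i ν) ⊛ prodA (exps L (idx-j ν)) y₀
          𝔸≈.≈⟨ ⊛-cong (⊛-cong (^ₐ-cong (idx-m ν) (shift-vanish s)) (λ n → trans (^ₐ-cong (idx-i ν) ψ-y₀ n) (sym (^ₐ-* h (idx-i ν) q n)))) (proj₂ (proj₂ (at (idx-j ν)))) ⟩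
        (h ^ₐ idx-m ν ⊛ h ^ₐ (idx-i ν ℕ.* q)) ⊛ (h ^ₐ u (idx-j ν) ⊛ U)
          𝔸≈.≈⟨ 𝔸.sym (𝔸.*-assoc (h ^ₐ idx-m ν ⊛ h ^ₐ (idx-i ν ℕ.* q)) (h ^ₐ u (idx-j ν)) U) ⟩
        ((h ^ₐ idx-m ν ⊛ h ^ₐ (idx-i ν ℕ.* q)) ⊛ h ^ₐ u (idx-j ν)) ⊛ U
          𝔸≈.≈⟨ ⊛-cong {_} {_} {U} (λ n → trans (⊛-cong {_} {_} {h ^ₐ u (idx-j ν)} (𝔸.sym (Exp𝔸.^-homo-* h (idx-m ν) (idx-i ν ℕ.* q))) (λ _ → refl) n) (sym (Exp𝔸.^-homo-* h (idx-m ν ℕ.+ idx-i ν ℕ.* q) (u (idx-j ν)) n))) (λ _ → refl) ⟩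
        h ^ₐ ord ν ⊛ U 𝔸≈.∎
        where
        U = proj₁ (at (idx-j ν))
        module 𝔸≈ = SetoidReasoning 𝔸.setoid

      -- m + c Qo < o Qo = q - 1, so the order determines i, then c = j e mod o, then m.
      ord-injective : ∀ ν μ → ν ℕ.< o ℕ.* I ℕ.* R → μ ℕ.< o ℕ.* I ℕ.* R → ord ν ≡ ord μ → ν ≡ μ
      ord-injective ν μ ν<n μ<n eq = trans (sym (index-idx ν)) (trans (cong₂ (λ j im → index j (proj₁ im) (proj₂ im)) j≡ (cong₂ _,_ i≡ m≡)) (index-idx μ))
        where
        instance
          q-nonZero : NonZero q
          q-nonZero = ℕ.>-nonZero (ℕₚ.<-trans (s≤s z≤n) 1<q)
        low : ℕ → ℕ
        low ν = (idx-j ν ℕ.* e) % o ℕ.* Qo ℕ.+ idx-m ν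
        m<Qo : ∀ ν → idx-m ν ℕ.< Qo
        m<Qo ν = ℕₚ.<-≤-trans (DM.m%n<n ν R) R≤Qo
        low<q : ∀ ν → low ν ℕ.< q
        low<q ν = ℕₚ.<-≤-trans (ℕₚ.+-monoʳ-< (c ℕ.* Qo) (m<Qo ν)) (ℕₚ.≤-trans (ℕₚ.≤-reflexive (ℕₚ.+-comm (c ℕ.* Qo) Qo))
          (ℕₚ.≤-trans (ℕₚ.*-monoˡ-≤ Qo (DM.m%n<n (idx-j ν ℕ.* e) o)) (ℕₚ.≤-trans (ℕₚ.≤-reflexive o*Qo≡N) (ℕₚ.m∸n≤m q 1))))
          where c = (idx-j ν ℕ.* e) % o
        split : ∀ ν → ord ν ≡ idx-i ν ℕ.* q ℕ.+ low ν
        split ν = arith (idx-m ν) (idx-i ν ℕ.* q) (u (idx-j ν))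
          where
          arith : ∀ a b c → a ℕ.+ b ℕ.+ c ≡ b ℕ.+ (c ℕ.+ a)
          arith = solve-∀
        step₁ = div-unique q {idx-i ν} {idx-i μ} (low<q ν) (low<q μ) (trans (sym (split ν)) (trans eq (split μ)))
        i≡ = proj₁ step₁
        step₂ = div-unique Qo {(idx-j ν ℕ.* e) % o} {(idx-j μ ℕ.* e) % o} (m<Qo ν) (m<Qo μ) (proj₂ step₁)
        m≡ = proj₂ step₂
        j≡ = *-%-injective cop (idx-j< ν<n) (idx-j< μ<n) (proj₁ step₂)

      independent : ∀ ρ → (∀ y → comb (o ℕ.* I ℕ.* R) ρ (λ ν → basis ν y) ≗ 𝔸.0#) → ∀ ν → ν ℕ.< o ℕ.* I ℕ.* R → ρ ν ≡ 0#
      independent ρ vanishes = distinct-orders (o ℕ.* I ℕ.* R) ρ ord (λ ν → proj₁ (at (idx-j ν))) (λ ν _ → proj₁ (proj₂ (at (idx-j ν)))) ord-injective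
        (λ l → trans (∑<-cong (o ℕ.* I ℕ.* R) (λ ν _ → cong (ρ ν *_) (sym (basis-y₀ ν l)))) (vanishes y₀ l))

      ramified-bound : ∀ {r M v} → length L ≡ suc r → (X : List Carrier) → Unique X → (∀ {a} → a ∈ X → Outside L a × χ L a % o ≡ v) →
        M ℕ.≤ q → M ℕ.* suc ((R ∸ 1) ℕ.+ (I ∸ 1) ℕ.+ r ℕ.* M) ℕ.< o ℕ.* I ℕ.* R → length X ℕ.* M ℕ.≤ degree-bound
      ramified-bound len X un spec M≤q few =
        stepanov len (λ a → ι (a - s)) (wt-ι (difference-poly s)) ψ≡ ψ-poly {o} X un spec M≤q few independent

    -- With Λ = y^q - y, which vanishes simply at every point of the field, the coefficients are recovered one power of Λ at a time.
    module Populated (L : Points) (I R : ℕ) .{{_ : NonZero I}} .{{_ : NonZero R}} (vs : List ℕ) (vs-unique : Unique vs)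
      (class : ℕ → List Carrier) (class-unique : ∀ v → Unique (class v))
      (class-spec : ∀ {v} → v ∈ vs → v ℕ.< o × R ℕ.≤ length (class v) × ∀ {a} → a ∈ class v → Outside L a × χ L a % o ≡ v) where

      ψ : Ser → Ser
      ψ y = y ^ₐ q 𝔸.+ 𝔸.- y

      open Basis L 0# I R ψ

      n = length vs ℕ.* I ℕ.* R

      ψ-poly : PA.Poly (suc q) ψ
      ψ-poly = PA.poly-+ (subst (λ m → PA.Poly (suc m) (_^ₐ q)) (ℕₚ.*-identityʳ q) (PA.poly-^ q PA.poly-id))
                         (PA.poly-mono (ℕₚ.m≤n⇒m≤1+n 1<q) (PA.poly-neg PA.poly-id))

      neg-+ : ∀ a b → - (a + b) ≡ - a + - b
      neg-+ a b = sym (⁻¹-∙-comm a b)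
        where open import Algebra.Properties.AbelianGroup (CommutativeRing.+-abelianGroup fieldRing) using (⁻¹-∙-comm)

      cancel-a : ∀ a b c → a + b + - (a + c) ≡ b + - c
      cancel-a a b c = begin
        a + b + - (a + c)     ≡⟨ cong (a + b +_) (neg-+ a c) ⟩
        a + b + (- a + - c)   ≡⟨ cong (_+ (- a + - c)) (+-comm a b) ⟩
        b + a + (- a + - c)   ≡⟨ trans (+-assoc b a _) (cong (b +_) (sym (+-assoc a (- a) (- c)))) ⟩
        b + (a + - a + - c)   ≡⟨ cong (λ z → b + (z + - c)) (-‿inverseʳ a) ⟩
        b + (0# + - c)        ≡⟨ cong (b +_) (+-identityˡ (- c)) ⟩
        b + - c               ∎

      ψ≡ : ∀ a l → l ℕ.< q → ψ (line (W L) a) l ≡ (𝔸.- (ι (W L a) ⊛ h)) l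
      ψ≡ a l l<q = trans (cong (_- line (W L) a l) (frobenius a (ι (W L a) ⊛ h) l))
        (trans (cancel-a (ι a l) _ _) (trans (cong (_- (ι (W L a) ⊛ h) l) (^ₐ-vanishes (ι (W L a) ⊛ h) q (zeroʳ (W L a)) l l<q)) (+-identityˡ _)))

      -- At a + h the polynomial y^q - y is h (h^(q-1) - 1); the second factor has constant term -1.
      unit : Ser
      unit = h ^ₐ N 𝔸.+ 𝔸.- 𝔸.1#

      ψ-near : ∀ a → ψ (ι a 𝔸.+ h) ≗ h ⊛ unit
      ψ-near a l = trans (cong (_- (ι a l + h l)) (frobenius a h l)) (trans (cancel-a (ι a l) _ _)
        (trans (cong (λ m → (h ^ₐ m) l - h l) q≡1+N) (sym (trans (𝔸.distribˡ h (h ^ₐ N) (𝔸.- 𝔸.1#) l)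
          (cong ((h ⊛ h ^ₐ N) l +_) (trans (sym (-‿distribʳ-* h 𝔸.1# l)) (cong -_ (𝔸.*-identityʳ h l))))))))
        where open import Algebra.Properties.Ring 𝔸.ring using (-‿distribʳ-*)

      unit-0 : unit 0 ≢ 0#
      unit-0 e = 0≢1 (sym (trans (sym (neg-involutive 1#)) (trans (cong -_ (trans (sym (trans (cong (_- 1#) zero-N) (+-identityˡ _))) e)) -0≡0)))
        where
        zero-N : (h ^ₐ N) 0 ≡ 0#
        zero-N = ^ₐ-vanishes h N refl 0 (ℕ.>-nonZero⁻¹ N)

      module Step (ρ : ℕ → Carrier) (vanishes : ∀ y → comb n ρ (λ ν → basis ν y) ≗ 𝔸.0#) where

        λ′ = length vs

        ρ′ : ℕ → ℕ → ℕ → Carrier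
        ρ′ j i m = ρ (index j i m)

        -- The leading coefficient of ψ^i at a field element, that is (-1)^i; what matters is that
        -- it is nonzero and independent of the element.
        κ : ℕ → Carrier
        κ i = (h ^ₐ i ⊛ unit ^ₐ i) i

        κ≢0 : ∀ i → κ i ≢ 0#
        κ≢0 i e = ^-≢0 i unit-0 (trans (sym (trans (trans (cong (h ^ₐ i ⊛ unit ^ₐ i) (sym (ℕₚ.+-identityʳ i))) (h^-⊛ i (unit ^ₐ i) 0)) (^ₐ-0 unit i))) e)

        ψ^-near : ∀ a i → ψ (ι a 𝔸.+ h) ^ₐ i ≗ h ^ₐ i ⊛ unit ^ₐ i
        ψ^-near a i l = trans (^ₐ-cong i (ψ-near a) l) (^-distrib-*ₐ h unit i l)
          where open import Algebra.Properties.CommutativeSemiring.Exp 𝔸.commutativeSemiring using () renaming (^-distrib-* to ^-distrib-*ₐ)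

        -- Since ψ^(idx-i ν) has order `idx-i ν` at a, a coefficient up to that degree sees only the
        -- constant terms of the two other factors.
        coefficient : ∀ {v} → v ∈ vs → ∀ {a} → a ∈ class v → ∀ ν i → i ℕ.≤ idx-i ν →
          basis ν (ι a 𝔸.+ h) i ≡ (a ^ idx-m ν * (ω ^ v) ^ idx-j ν) * (h ^ₐ idx-i ν ⊛ unit ^ₐ idx-i ν) i
        coefficient {v} v∈ {a} a∈ ν i i≤ = begin
          ((A ⊛ P) ⊛ G) i                    ≡⟨ 𝔸.*-comm (A ⊛ P) G i ⟩
          (G ⊛ (A ⊛ P)) i                    ≡⟨ 𝔸.*-assoc G A P i ⟨
          ((G ⊛ A) ⊛ P) i                    ≡⟨ ⊛-lowest (G ⊛ A) P i (λ l l<i → trans (ψ^-near a (idx-i ν) l) (h^-⊛-vanishes (idx-i ν) _ l (ℕₚ.<-≤-trans l<i i≤))) ⟩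
          G 0 * A 0 * P i                    ≡⟨ cong₂ _*_ (trans (*-comm (G 0) (A 0)) (cong₂ _*_ A₀ G₀)) (ψ^-near a (idx-i ν) i) ⟩
          (a ^ idx-m ν * (ω ^ v) ^ idx-j ν) * (h ^ₐ idx-i ν ⊛ unit ^ₐ idx-i ν) i ∎
          where
          y = ι a 𝔸.+ h
          A = (y 𝔸.+ 𝔸.- ι 0#) ^ₐ idx-m ν
          P = ψ y ^ₐ idx-i ν
          G = prodA (exps L (idx-j ν)) y
          spec = proj₂ (proj₂ (class-spec v∈)) a∈
          A₀ : A 0 ≡ a ^ idx-m ν
          A₀ = trans (^ₐ-0 (y 𝔸.+ 𝔸.- ι 0#) (idx-m ν)) (cong (_^ idx-m ν) (trans (cong (a + 0# +_) -0≡0) (trans (+-identityʳ _) (+-identityʳ a))))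
          G₀ : G 0 ≡ (ω ^ v) ^ idx-j ν
          G₀ = trans (prodA-0 (exps L (idx-j ν)) y) (trans (cong (prodF (exps L (idx-j ν))) (+-identityʳ a))
            (trans (prodF-exps-% L (idx-j ν) (proj₁ spec)) (cong (λ z → (ω ^ z) ^ idx-j ν) (proj₂ spec))))

        -- In the coefficient of h^i at a point a of class v, higher powers of ψ do not appear and
        -- lower ones are gone by induction. What remains is a polynomial in a of degree below `R`
        -- that vanishes on the at least `R` points of the class, so each of its coefficients is
        -- zero. Such a coefficient is a polynomial in ζ = ω^v of degree below λ. It vanishes at the
        -- λ distinct values of ζ, hence identically.
        below : ∀ b i → i ℕ.< b → i ℕ.< I → ∀ j → j ℕ.< λ′ → ∀ m → m ℕ.< R → ρ′ j i m ≡ 0#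
        below (suc b) i (s≤s i≤b) i<I j j<λ m m<R =
          coefficients-zero (λ j → ρ′ j i m) λ′ (map (ω ^_) vs) ζ-unique (ℕₚ.≤-reflexive (sym (Listₚ.length-map (ω ^_) vs)))
            (λ ζ∈ → root ζ∈) j j<λ
          where
          ζ-unique : Unique (map (ω ^_) vs)
          ζ-unique = go vs vs-unique (λ v∈ → proj₁ (class-spec v∈))
            where
            go : ∀ ws → Unique ws → (∀ {v} → v ∈ ws → v ℕ.< o) → Unique (map (ω ^_) ws)
            go []       []         small = []
            go (w ∷ ws) (w∉ ∷ un) small = Allₚ.map⁺ (All.tabulate (λ {v} v∈ e → All.lookup w∉ v∈ (ω^-distinct (small (here refl)) (small (there v∈)) e))) ∷ go ws un (small ∘ there)
          idx-m≡ : ∀ j i m → m ℕ.< R → idx-m (index j i m) ≡ m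
          idx-m≡ j i m m<R = %-decode (j ℕ.* I ℕ.+ i) m R m<R
          quotient≡ : ∀ j i m → m ℕ.< R → index j i m / R ≡ j ℕ.* I ℕ.+ i
          quotient≡ j i m m<R = /-decode (j ℕ.* I ℕ.+ i) m R m<R
          idx-i≡ : ∀ j i m → i ℕ.< I → m ℕ.< R → idx-i (index j i m) ≡ i
          idx-i≡ j i m i<I m<R = trans (cong (_% I) (quotient≡ j i m m<R)) (%-decode j i I i<I)
          idx-j≡ : ∀ j i m → i ℕ.< I → m ℕ.< R → idx-j (index j i m) ≡ j
          idx-j≡ j i m i<I m<R = trans (cong (_/ I) (quotient≡ j i m m<R)) (/-decode j i I i<I)
          module _ {v} (v∈ : v ∈ vs) where
            ζ = ω ^ v
            in-a : ∀ {a} → a ∈ class v → ∑< R (λ m → ∑< λ′ (λ j → ρ′ j i m * ζ ^ j) * a ^ m) ≡ 0#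
            in-a {a} a∈ = x*y≡0⇒y≡0 (κ≢0 i) (begin
              κ i * ∑< R (λ m → ∑< λ′ (λ j → ρ′ j i m * ζ ^ j) * a ^ m)
                ≡⟨ cong (κ i *_) (∑<-cong R (λ m _ → sym (∑-*ʳ (upTo λ′) (a ^ m) (λ j → ρ′ j i m * ζ ^ j)))) ⟩
              κ i * ∑< R (λ m → ∑< λ′ (λ j → ρ′ j i m * ζ ^ j * a ^ m))
                ≡⟨ cong (κ i *_) (∑-swap (upTo R) (upTo λ′) _) ⟩
              κ i * ∑< λ′ (λ j → ∑< R (λ m → ρ′ j i m * ζ ^ j * a ^ m))
                ≡⟨ ∑-*ˡ (upTo λ′) (κ i) _ ⟨
              ∑< λ′ (λ j → κ i * ∑< R (λ m → ρ′ j i m * ζ ^ j * a ^ m))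
                ≡⟨ ∑<-cong λ′ (λ j j<λ → sym (trans (∑<-single I (T j) i i<I (other j j<λ)) (this j))) ⟩
              ∑< λ′ (λ j → ∑< I (T j))
                ≡⟨ ∑<-* λ′ I (λ ji → ∑< R (λ m → t (ji ℕ.* R ℕ.+ m))) ⟨
              ∑< (λ′ ℕ.* I) (λ ji → ∑< R (λ m → t (ji ℕ.* R ℕ.+ m)))
                ≡⟨ ∑<-* (λ′ ℕ.* I) R t ⟨
              ∑< n t ≡⟨ vanishes y i ⟩
              0# ∎)
              where
              y = ι a 𝔸.+ h
              t : ℕ → Carrier
              t ν = ρ ν * basis ν y i
              T : ℕ → ℕ → Carrier
              T j i′ = ∑< R (λ m → t (index j i′ m))
              this : ∀ j → T j i ≡ κ i * ∑< R (λ m → ρ′ j i m * ζ ^ j * a ^ m)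
              this j = trans (∑<-cong R (λ m m<R → begin
                ρ′ j i m * basis (index j i m) y i
                  ≡⟨ cong (ρ′ j i m *_) (coefficient v∈ a∈ (index j i m) i (ℕₚ.≤-reflexive (sym (idx-i≡ j i m i<I m<R)))) ⟩
                ρ′ j i m * ((a ^ idx-m (index j i m) * ζ ^ idx-j (index j i m)) * (h ^ₐ idx-i (index j i m) ⊛ unit ^ₐ idx-i (index j i m)) i)
                  ≡⟨ cong (ρ′ j i m *_) (cong₂ _*_ (cong₂ (λ m j → a ^ m * ζ ^ j) (idx-m≡ j i m m<R) (idx-j≡ j i m i<I m<R)) (cong (λ i′ → (h ^ₐ i′ ⊛ unit ^ₐ i′) i) (idx-i≡ j i m i<I m<R))) ⟩
                ρ′ j i m * ((a ^ m * ζ ^ j) * κ i)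
                  ≡⟨ rearrange (ρ′ j i m) (a ^ m) (ζ ^ j) (κ i) ⟩
                κ i * (ρ′ j i m * ζ ^ j * a ^ m) ∎)) (∑-*ˡ (upTo R) (κ i) _)
                where
                open import Algebra.Solver.Ring.NaturalCoefficients.Default (CommutativeRing.commutativeSemiring fieldRing) using (solve; _:*_; _:=_)
                rearrange : ∀ p x z k → p * ((x * z) * k) ≡ k * (p * z * x)
                rearrange = solve 4 (λ p x z k → p :* ((x :* z) :* k) := k :* (p :* z :* x)) refl
              other : ∀ j → j ℕ.< λ′ → ∀ i′ → i′ ℕ.< I → i′ ≢ i → T j i′ ≡ 0#
              other j j<λ i′ i′<I i′≢i = ∑-zero (upTo R) (λ {m} m∈ → term m (∈-upTo⁻ m∈))
                where
                open import Data.List.Membership.Propositional.Properties using (∈-upTo⁻)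
                term : ∀ m → m ℕ.< R → t (index j i′ m) ≡ 0#
                term m m<R with ℕₚ.<-cmp i′ i
                ... | tri< lt _ _ = trans (cong (_* basis (index j i′ m) y i) (below b i′ (ℕₚ.<-≤-trans lt i≤b) i′<I j j<λ m m<R)) (zeroˡ _)
                ... | tri≈ _ eq _ = ⊥-elim (i′≢i eq)
                ... | tri> _ _ gt = trans (cong (ρ′ j i′ m *_) (trans (coefficient v∈ a∈ (index j i′ m) i (ℕₚ.≤-trans (ℕₚ.<⇒≤ gt) (ℕₚ.≤-reflexive (sym (idx-i≡ j i′ m i′<I m<R)))))
                        (trans (cong (a ^ idx-m (index j i′ m) * ζ ^ idx-j (index j i′ m) *_) (h^-⊛-vanishes (idx-i (index j i′ m)) _ i (ℕₚ.<-≤-trans gt (ℕₚ.≤-reflexive (sym (idx-i≡ j i′ m i′<I m<R))))))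
                               (zeroʳ _)))) (zeroʳ _)
            sum≡0 : ∀ m → m ℕ.< R → ∑< λ′ (λ j → ρ′ j i m * ζ ^ j) ≡ 0#
            sum≡0 = coefficients-zero (λ m → ∑< λ′ (λ j → ρ′ j i m * ζ ^ j)) R (class v) (class-unique v) (proj₁ (proj₂ (class-spec v∈))) in-a
          root : ∀ {ζ} → ζ ∈ map (ω ^_) vs → ∑< λ′ (λ j → ρ′ j i m * ζ ^ j) ≡ 0#
          root ζ∈ with ∈-map⁻ (ω ^_) ζ∈
          ... | v , v∈ , refl = sum≡0 v∈ m m<R

        independent : ∀ ν → ν ℕ.< n → ρ ν ≡ 0#
        independent ν ν<n = trans (cong ρ (sym (index-idx ν)))
          (below I (idx-i ν) i<I i<I (idx-j ν) (idx-j< ν<n) (idx-m ν) (DM.m%n<n ν R))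
          where i<I = DM.m%n<n (ν / R) I

      populated-bound : ∀ {r M v} → length L ≡ suc r → (X : List Carrier) → Unique X → (∀ {a} → a ∈ X → Outside L a × χ L a % o ≡ v) →
        M ℕ.≤ q → M ℕ.* suc ((R ∸ 1) ℕ.+ (I ∸ 1) ℕ.+ r ℕ.* M) ℕ.< n → length X ℕ.* M ℕ.≤ degree-bound
      populated-bound len X un spec M≤q few =
        stepanov len (λ a → 𝔸.- (ι (W L a) ⊛ h)) (wt-neg (wt-ιh (PF.poly-mono (s≤s (ℕₚ.≤-reflexive len)) (W-poly L)))) ψ≡ ψ-poly {length vs} X un spec M≤q few Step.independent

open import Data.Nat using (_+_; _*_; _^_; _<_; _≟_; _≤?_)
open import Data.Nat.Properties

-- Divisibility

prime-divisor : ∀ n .{{_ : NonZero n}} → n ≢ 1 → ∃[ p ] (Prime p × p ∣ n)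
prime-divisor n n≢1 with factorise n
... | record { factors = [] ; isFactorisation = e } = ⊥-elim (n≢1 e)
... | record { factors = p ∷ ps ; isFactorisation = e ; factorsPrime = pp ∷ _ } =
  p , pp , divides (product ps) (trans e (*-comm p (product ps)))

no-common-prime⇒coprime : ∀ {m n} .{{_ : NonZero m}} → (∀ {p} → Prime p → p ∣ m → p ∤ n) → Coprime m n
no-common-prime⇒coprime {m} {n} none {d} (d∣m , d∣n) with d ≟ 1
... | yes d≡1 = d≡1
... | no  d≢1 = let p , pp , p∣d = prime-divisor d {{ℕ.≢-nonZero λ { refl → ℕ.≢-nonZero⁻¹ m (Div.0∣⇒≡0 d∣m) }}} d≢1
                in ⊥-elim (none pp (Div.∣-trans p∣d d∣m) (Div.∣-trans p∣d d∣n))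

prime∣prime⇒≡ : ∀ {p ℓ} → Prime p → Prime ℓ → p ∣ ℓ → p ≡ ℓ
prime∣prime⇒≡ pp pℓ p∣ℓ with prime⇒irreducible pℓ p∣ℓ
... | inj₁ refl = ⊥-elim (¬prime[1] pp)
... | inj₂ p≡ℓ  = p≡ℓ

prime∣^⇒≡ : ∀ {p ℓ} a → Prime p → Prime ℓ → p ∣ ℓ ^ a → p ≡ ℓ
prime∣^⇒≡ zero    pp pℓ p∣ = ⊥-elim (¬prime[1] (subst Prime (Div.∣1⇒≡1 p∣) pp))
prime∣^⇒≡ {p} {ℓ} (suc a) pp pℓ p∣ with euclidsLemma ℓ (ℓ ^ a) pp p∣
... | inj₁ p∣ℓ = prime∣prime⇒≡ pp pℓ p∣ℓ
... | inj₂ p∣^ = prime∣^⇒≡ a pp pℓ p∣^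

coprime-^ : ∀ {e ℓ} a → Prime ℓ → ℓ ∤ e → Coprime (ℓ ^ a) e
coprime-^ {e} {ℓ} a pℓ ℓ∤e = no-common-prime⇒coprime {{m^n≢0 ℓ a {{prime⇒nonZero pℓ}}}}
  (λ {p} pp p∣ p∣e → ℓ∤e (subst (_∣ e) (prime∣^⇒≡ a pp pℓ p∣) p∣e))

coprime-*-∣ : ∀ {m n c} → Coprime m n → m ∣ c → n ∣ c → m * n ∣ c
coprime-*-∣ {m} {n} cop (divides t refl) n∣ =
  subst (_∣ t * m) (*-comm n m) (Div.*-monoˡ-∣ m (Cop.coprime-divisor (Cop.sym cop) (subst (n ∣_) (*-comm t m) n∣)))

maximal-power : ∀ ℓ → Prime ℓ → ∀ n .{{_ : NonZero n}} → ∃[ a ] ∃[ m ] (n ≡ ℓ ^ a * m × ℓ ∤ m)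
maximal-power ℓ pℓ n = go n (<-wellFounded n)
  where
  go : ∀ n .{{_ : NonZero n}} → Acc _<_ n → ∃[ a ] ∃[ m ] (n ≡ ℓ ^ a * m × ℓ ∤ m)
  go n (acc rec) with ℓ ∣? n
  ... | no ℓ∤n = 0 , n , sym (+-identityʳ n) , ℓ∤n
  ... | yes (divides t e) = let a , m , t≡ , ℓ∤m = go t {{t≢0}} (rec t<n)
                            in suc a , m , trans e (trans (*-comm t ℓ) (trans (cong (ℓ *_) t≡) (sym (*-assoc ℓ (ℓ ^ a) m)))) , ℓ∤m
    where
    t≢0 : NonZero t
    t≢0 = ℕ.≢-nonZero λ { refl → ℕ.≢-nonZero⁻¹ n e }
    t<n : t < n
    t<n = subst (t <_) (sym e) (m<m*n t ℓ {{t≢0}} (ℕ.nonTrivial⇒n>1 ℓ {{prime⇒nonTrivial pℓ}}))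

prime-powers-∣ : ∀ n .{{_ : NonZero n}} {c} → (∀ {ℓ} a → Prime ℓ → ℓ ^ a ∣ n → ℓ ^ a ∣ c) → n ∣ c
prime-powers-∣ n {c} = go n (<-wellFounded n)
  where
  go : ∀ n .{{_ : NonZero n}} → Acc _<_ n → (∀ {ℓ} a → Prime ℓ → ℓ ^ a ∣ n → ℓ ^ a ∣ c) → n ∣ c
  go n (acc rec) hyp with n ≟ 1
  ... | yes refl = Div.1∣ c
  ... | no  n≢1 with prime-divisor n n≢1
  ... | ℓ , pℓ , ℓ∣n with maximal-power ℓ pℓ n
  ... | zero , m , e , ℓ∤m = ⊥-elim (ℓ∤m (subst (ℓ ∣_) (trans e (+-identityʳ m)) ℓ∣n))
  ... | suc a , m , e , ℓ∤m = subst (_∣ c) (sym e) (coprime-*-∣ (coprime-^ (suc a) pℓ ℓ∤m)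
          (hyp (suc a) pℓ (subst (ℓ ^ suc a ∣_) (sym e) (Div.m∣m*n m)))
          (go m {{m≢0}} (rec m<n) (λ b pp p∣m → hyp b pp (Div.∣-trans p∣m (subst (m ∣_) (sym e) (Div.n∣m*n (ℓ ^ suc a)))))))
    where
    m≢0 : NonZero m
    m≢0 = ℕ.≢-nonZero λ { refl → ℕ.≢-nonZero⁻¹ n (trans e (*-zeroʳ (ℓ ^ suc a))) }
    m<n : m < n
    m<n = subst (m <_) (trans (*-comm m (ℓ ^ suc a)) (sym e)) (m<m*n m (ℓ ^ suc a) {{m≢0}}
      (≤-trans (ℕ.nonTrivial⇒n>1 ℓ {{prime⇒nonTrivial pℓ}}) (m≤m*n ℓ (ℓ ^ a) {{m^n≢0 ℓ a {{prime⇒nonZero pℓ}}}})))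

-- Counting in lists

open ListSum +-*-commutativeSemiring public

private variable
  ℓ₁ ℓ₂ : Level
  Elem : Set ℓ₁

⟦_⟧ : ∀ {P : Set ℓ₁} → Dec P → ℕ
⟦ yes _ ⟧ = 1
⟦ no  _ ⟧ = 0

length-filter : ∀ {P : Pred Elem ℓ₂} (P? : Decidable P) xs → length (filter P? xs) ≡ ∑ xs (λ x → ⟦ P? x ⟧)
length-filter P? []       = refl
length-filter P? (x ∷ xs) with P? x
... | yes _ = cong suc (length-filter P? xs)
... | no  _ = length-filter P? xs

⟦⟧-cong : ∀ {P : Set ℓ₁} {Q : Set ℓ₂} {P? : Dec P} {Q? : Dec Q} → (P → Q) → (Q → P) → ⟦ P? ⟧ ≡ ⟦ Q? ⟧
⟦⟧-cong {P? = yes _} {yes _} f g = refl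
⟦⟧-cong {P? = no _}  {no _}  f g = refl
⟦⟧-cong {P? = yes x} {no ¬y} f g = ⊥-elim (¬y (f x))
⟦⟧-cong {P? = no ¬x} {yes y} f g = ⊥-elim (¬x (g y))

⟦⟧-yes : ∀ {P : Set ℓ₁} {P? : Dec P} → P → ⟦ P? ⟧ ≡ 1
⟦⟧-yes {P? = yes _} x = refl
⟦⟧-yes {P? = no ¬x} x = ⊥-elim (¬x x)

⟦⟧-no : ∀ {P : Set ℓ₁} {P? : Dec P} → ¬ P → ⟦ P? ⟧ ≡ 0
⟦⟧-no {P? = yes x} ¬x = ⊥-elim (¬x x)
⟦⟧-no {P? = no _}  ¬x = refl

∑-mono : ∀ (xs : List Elem) {f g} → (∀ {x} → x ∈ xs → f x ≤ g x) → ∑ xs f ≤ ∑ xs g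
∑-mono []       le = z≤n
∑-mono (x ∷ xs) le = +-mono-≤ (le (here refl)) (∑-mono xs (le ∘ there))

∑<-mono : ∀ n {f g} → (∀ i → i < n → f i ≤ g i) → ∑< n f ≤ ∑< n g
∑<-mono n le = ∑-mono (upTo n) (λ i∈ → le _ (∈-upTo⁻ i∈))

∑<-const : ∀ n c → ∑< n (λ _ → c) ≡ n * c
∑<-const n c = trans (∑ℕ-const (upTo n) c) (cong (_* c) (Listₚ.length-upTo n))

∑<-one : ∀ n {f : ℕ → ℕ} j → j < n → f j ≡ 1 → (∀ i → i < n → i ≢ j → f i ≡ 0) → ∑< n f ≡ 1
∑<-one n j j<n one none = trans (∑<-single n _ j j<n none) one

∑<-except : ∀ n (f : ℕ → ℕ) B c → c < n → (∀ i → i < n → f i ≤ B) → ∑< n f + B ≤ n * B + f c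
∑<-except (suc n) f B zero    c<n le = begin
  ∑< (suc n) f + B         ≡⟨ cong (_+ B) (∑<-suc n f) ⟩
  f 0 + ∑< n (f ∘ suc) + B ≤⟨ +-monoˡ-≤ B (+-monoʳ-≤ (f 0) (≤-trans (∑<-mono n (λ i i<n → le (suc i) (s≤s i<n))) (≤-reflexive (∑<-const n B)))) ⟩
  f 0 + n * B + B          ≡⟨ arith (f 0) (n * B) B ⟩
  suc n * B + f 0          ∎
  where
  open ≤-Reasoning
  arith : ∀ x y z → x + y + z ≡ z + y + x
  arith = solve-∀
∑<-except (suc n) f B (suc c) (s≤s c<n) le = begin
  ∑< (suc n) f + B           ≡⟨ cong (_+ B) (∑<-suc n f) ⟩
  f 0 + ∑< n (f ∘ suc) + B   ≡⟨ +-assoc (f 0) _ B ⟩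
  f 0 + (∑< n (f ∘ suc) + B) ≤⟨ +-mono-≤ (le 0 (s≤s z≤n)) (∑<-except n (f ∘ suc) B c c<n (λ i i<n → le (suc i) (s≤s i<n))) ⟩
  B + (n * B + f (suc c))    ≡⟨ +-assoc B (n * B) _ ⟨
  suc n * B + f (suc c)      ∎
  where open ≤-Reasoning

below-average : ∀ n .{{_ : NonZero n}} f S → ∑< n f ≡ S → ∃[ c ] (c < n × n * f c ≤ S)
below-average n f S e with search n
  where
  search : ∀ m → (∃[ c ] (c < m × n * f c ≤ S)) ⊎ (∀ c → c < m → S < n * f c)
  search zero = inj₂ λ c ()
  search (suc m) with search m
  ... | inj₁ (c , c<m , le) = inj₁ (c , m<n⇒m<1+n c<m , le)
  ... | inj₂ none with n * f m ≤? S
  ... | yes le = inj₁ (m , ≤-refl , le)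
  ... | no  ≰  = inj₂ λ c c<1+m → case-≤ c (≤-pred c<1+m)
    where
    case-≤ : ∀ c → c ≤ m → S < n * f c
    case-≤ c c≤m with m≤n⇒m<n∨m≡n c≤m
    ... | inj₁ c<m  = none c c<m
    ... | inj₂ refl = ≰⇒> ≰
... | inj₁ found = found
... | inj₂ none  = ⊥-elim (<⇒≱ (begin-strict
  n * S             <⟨ *-monoʳ-< n (n<1+n S) ⟩
  n * suc S         ≡⟨ ∑<-const n (suc S) ⟨
  ∑< n (λ _ → suc S) ≤⟨ ∑<-mono n none ⟩
  ∑< n (λ c → n * f c) ≡⟨ ∑-*ˡ (upTo n) n f ⟩
  n * ∑< n f        ≡⟨ cong (n *_) e ⟩
  n * S             ∎) ≤-refl)
  where open ≤-Reasoning

fibre : (Elem → ℕ) → List Elem → ℕ → List Elem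
fibre f xs v = filter (λ x → f x ≟ v) xs

length-fibre : ∀ (f : Elem → ℕ) xs v → length (fibre f xs v) ≡ ∑ xs (λ x → ⟦ f x ≟ v ⟧)
length-fibre f xs v = length-filter (λ x → f x ≟ v) xs

fibres-partition : ∀ n (f : Elem → ℕ) xs → (∀ x → f x < n) → ∑< n (λ v → length (fibre f xs v)) ≡ length xs
fibres-partition n f xs f<n = begin
  ∑< n (λ v → length (fibre f xs v))        ≡⟨ ∑<-cong n (λ v _ → length-fibre f xs v) ⟩
  ∑< n (λ v → ∑ xs (λ x → ⟦ f x ≟ v ⟧))     ≡⟨ ∑-swap (upTo n) xs _ ⟩
  ∑ xs (λ x → ∑< n (λ v → ⟦ f x ≟ v ⟧))     ≡⟨ ∑-cong xs (λ {x} _ → ∑<-one n (f x) (f<n x) (⟦⟧-yes refl) (λ i _ i≢ → ⟦⟧-no (i≢ ∘ sym))) ⟩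
  ∑ xs (λ _ → 1)                            ≡⟨ trans (∑ℕ-const xs 1) (*-identityʳ _) ⟩
  length xs                                 ∎
  where open ≡-Reasoning

fibre-refine : ∀ κ m .{{_ : NonZero κ}} .{{_ : NonZero (m * κ)}} (f : Elem → ℕ) xs c → c < κ →
  length (fibre (λ x → f x % κ) xs c) ≡ ∑< m (λ i → length (fibre (λ x → f x % (m * κ)) xs (i * κ + c)))
fibre-refine κ m f xs c c<κ = begin
  length (fibre (λ x → f x % κ) xs c)                                ≡⟨ length-fibre _ xs c ⟩
  ∑ xs (λ x → ⟦ f x % κ ≟ c ⟧)                                       ≡⟨ ∑-cong xs (λ {x} _ → pointwise (f x)) ⟩
  ∑ xs (λ x → ∑< m (λ i → ⟦ f x % (m * κ) ≟ i * κ + c ⟧))            ≡⟨ ∑-swap xs (upTo m) _ ⟩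
  ∑< m (λ i → ∑ xs (λ x → ⟦ f x % (m * κ) ≟ i * κ + c ⟧))            ≡⟨ ∑<-cong m (λ i _ → length-fibre _ xs (i * κ + c)) ⟨
  ∑< m (λ i → length (fibre (λ x → f x % (m * κ)) xs (i * κ + c)))   ∎
  where
  open ≡-Reasoning
  u%κ : ∀ y → y % (m * κ) % κ ≡ y % κ
  u%κ y = DM.m∣n⇒o%n%m≡o%m κ (m * κ) y (divides m refl)
  pointwise : ∀ y → ⟦ y % κ ≟ c ⟧ ≡ ∑< m (λ i → ⟦ y % (m * κ) ≟ i * κ + c ⟧)
  pointwise y with y % κ ≟ c
  ... | no ≢c = sym (∑-zero (upTo m) (λ {i} _ → ⟦⟧-no (λ e → ≢c (trans (sym (u%κ y)) (trans (cong (_% κ) e) (%-decode i c κ c<κ))))))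
  ... | yes refl = sym (∑<-one m (u / κ) (DM.m<n*o⇒m/o<n (DM.m%n<n y (m * κ)))
          (⟦⟧-yes (trans (DM.m≡m%n+[m/n]*n u κ) (trans (+-comm (u % κ) _) (cong (u / κ * κ +_) (u%κ y)))))
          (λ i _ i≢ → ⟦⟧-no (λ e → i≢ (sym (trans (cong (_/ κ) e) (/-decode i (y % κ) κ c<κ))))))
    where u = y % (m * κ)

count-≡ : ∀ (_≟′_ : DecidableEquality Elem) xs → Unique xs → ∀ s → ∑ xs (λ x → ⟦ x ≟′ s ⟧) ≤ 1
count-≡ _≟′_ []       []         s = z≤n
count-≡ _≟′_ (x ∷ xs) (x∉ ∷ un) s with x ≟′ s
... | yes refl = s≤s (≤-reflexive (∑-zero xs (λ y∈ → ⟦⟧-no (All.lookup x∉ y∈ ∘ sym))))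
... | no  _    = count-≡ _≟′_ xs un s

length-avoiding : ∀ (_≟′_ : DecidableEquality Elem) {P : Pred Elem ℓ₂} (P? : Decidable P) xs ss → Unique xs →
  (∀ x → ¬ P x → x ∈ ss) → length xs ≤ length (filter P? xs) + length ss
length-avoiding _≟′_ P? xs ss un avoid = begin
  length xs                                                    ≡⟨ trans (∑ℕ-const xs 1) (*-identityʳ _) ⟨
  ∑ xs (λ _ → 1)                                               ≤⟨ ∑-mono xs (λ {x} _ → pointwise x) ⟩
  ∑ xs (λ x → ⟦ P? x ⟧ + ∑ ss (λ s → ⟦ x ≟′ s ⟧))              ≡⟨ ∑-+ xs _ _ ⟩
  ∑ xs (λ x → ⟦ P? x ⟧) + ∑ xs (λ x → ∑ ss (λ s → ⟦ x ≟′ s ⟧)) ≡⟨ cong₂ _+_ (sym (length-filter P? xs)) (∑-swap xs ss _) ⟩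
  length (filter P? xs) + ∑ ss (λ s → ∑ xs (λ x → ⟦ x ≟′ s ⟧)) ≤⟨ +-monoʳ-≤ _ (∑-mono ss (λ {s} _ → count-≡ _≟′_ xs un s)) ⟩
  length (filter P? xs) + ∑ ss (λ _ → 1)                       ≡⟨ cong (length (filter P? xs) +_) (trans (∑ℕ-const ss 1) (*-identityʳ _)) ⟩
  length (filter P? xs) + length ss                            ∎
  where
  open ≤-Reasoning
  hit : ∀ x ss → x ∈ ss → 1 ≤ ∑ ss (λ s → ⟦ x ≟′ s ⟧)
  hit x (s ∷ ss) (here refl) = ≤-trans (≤-reflexive (sym (⟦⟧-yes {P? = x ≟′ x} refl))) (m≤m+n _ _)
  hit x (s ∷ ss) (there x∈)  = ≤-trans (hit x ss x∈) (m≤n+m _ _)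
  pointwise : ∀ x → 1 ≤ ⟦ P? x ⟧ + ∑ ss (λ s → ⟦ x ≟′ s ⟧)
  pointwise x with P? x
  ... | yes _ = s≤s z≤n
  ... | no ¬p = hit x ss (avoid x ¬p)

-- Equidistribution of characters

-- The auxiliary polynomial has I powers of y^q, coefficients of degree below R, and multiplicity λ z with z = I - d, d = r + 1 = |S|.
module Parameters (r k′ z : ℕ) where
  k I R a b : ℕ
  k = suc k′
  I = suc (r + z)
  R = k * I * I
  a = k * z
  b = k * I + r * k′

  -- For each j there are I R = z R + d R unknowns, because I = d + z. The part z R is used up by
  -- the degree R of the coefficients. The part d R has to exceed the cost z (I - 1 + r λ z) of the
  -- powers of ψ and of the derivatives, which is below (1 + r k) I²; this is the origin of R = k
  -- I².
  few-conditions : ∀ {λ′} → 1 ≤ λ′ → λ′ ≤ k → 1 ≤ k′ →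
    (λ′ * z) * suc ((R ∸ 1) + (I ∸ 1) + r * (λ′ * z)) < λ′ * I * R
  few-conditions {λ′} 1≤λ λ≤k 1≤k′ = begin-strict
    (λ′ * z) * (R + (r + z) + r * (λ′ * z))         ≡⟨ arith₁ λ′ z R (r + z) r ⟩
    λ′ * (z * R + z * ((r + z) + r * (λ′ * z)))     <⟨ *-monoʳ-< λ′ {{ℕ.>-nonZero 1≤λ}} (+-monoʳ-< (z * R) core) ⟩
    λ′ * (z * R + suc r * R)                        ≡⟨ arith₂ λ′ z r R ⟩
    λ′ * I * R                                      ∎
    where
    open ≤-Reasoning
    arith₁ : ∀ l z R s r → (l * z) * (R + s + r * (l * z)) ≡ l * (z * R + z * (s + r * (l * z)))
    arith₁ = solve-∀
    arith₂ : ∀ l z r R → l * (z * R + suc r * R) ≡ l * suc (r + z) * R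
    arith₂ = solve-∀
    arith₃ : ∀ I r k′ → I * (I + r * (suc k′ * I)) ≡ (1 + r * suc k′) * (I * I)
    arith₃ = solve-∀
    arith₄ : ∀ I r k′ → (suc k′ + r * suc k′) * (I * I) ≡ suc r * (suc k′ * I * I)
    arith₄ = solve-∀
    z≤I : z ≤ I
    z≤I = m≤n⇒m≤1+n (m≤n+m z r)
    core : z * ((r + z) + r * (λ′ * z)) < suc r * R
    core = begin-strict
      z * ((r + z) + r * (λ′ * z))  ≤⟨ *-mono-≤ z≤I (+-monoʳ-≤ (r + z) (*-monoʳ-≤ r (*-mono-≤ λ≤k z≤I))) ⟩
      I * ((r + z) + r * (k * I))   <⟨ *-monoʳ-< I (n<1+n _) ⟩
      I * (I + r * (k * I))         ≡⟨ arith₃ I r k′ ⟩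
      (1 + r * k) * (I * I)         ≤⟨ *-monoˡ-≤ (I * I) (+-monoˡ-≤ (r * k) (s≤s (z≤n {k′}))) ⟩
      (k + r * k) * (I * I)         ≡⟨ arith₄ I r k′ ⟩
      suc r * R                     ∎

  -- Since o R ≤ q and o Qo ≤ q, the degree is at most q (I + r (1 - 1/o)). Replacing 1 - 1/o by 1 -
  -- 1/k gives b / k, a bound independent of `o`; on the left M = λ z and a = k z.
  count-bound : ∀ {λ′ o Qo q X} .{{_ : NonZero o}} → o ≤ k → o * R ≤ q → o * Qo ≤ q →
    X * (λ′ * z) ≤ ((R ∸ 1) + (I ∸ 1) * q) + suc r * ((o ∸ 1) * Qo) → λ′ * X * a ≤ q * b
  count-bound {λ′} {o@(suc o′)} {Qo} {q} {X} (s≤s o′≤k′) oR≤q oQo≤q le = *-cancelˡ-≤ o (begin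
    o * (λ′ * X * a)                                   ≡⟨ arith₁ o λ′ X k z ⟩
    k * (o * (X * (λ′ * z)))                           ≤⟨ *-monoʳ-≤ k (*-monoʳ-≤ o le) ⟩
    k * (o * (((R ∸ 1) + (r + z) * q) + suc r * (o′ * Qo))) ≤⟨ *-monoʳ-≤ k (*-monoʳ-≤ o (+-monoˡ-≤ (suc r * (o′ * Qo)) (+-monoˡ-≤ ((r + z) * q) (m∸n≤m R 1)))) ⟩
    k * (o * ((R + (r + z) * q) + suc r * (o′ * Qo)))  ≡⟨ arith₂ k o R (r + z) q (suc r) o′ Qo ⟩
    k * (o * R + o * ((r + z) * q) + suc r * (o′ * (o * Qo))) ≤⟨ *-monoʳ-≤ k (+-mono-≤ (+-monoˡ-≤ _ oR≤q) (*-monoʳ-≤ (suc r) (*-monoʳ-≤ o′ oQo≤q))) ⟩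
    k * (q + o * ((r + z) * q) + suc r * (o′ * q))     ≡⟨ arith₃ k′ o′ r z q ⟩
    q * (o * (k * I) + r * (o′ + o′ * k′))             ≤⟨ *-monoʳ-≤ q (+-monoʳ-≤ (o * (k * I)) (*-monoʳ-≤ r (+-monoˡ-≤ (o′ * k′) o′≤k′))) ⟩
    q * (o * (k * I) + r * (k′ + o′ * k′))             ≡⟨ arith₄ q o′ (k * I) r k′ ⟩
    o * (q * b)                                        ∎)
    where
    open ≤-Reasoning
    arith₁ : ∀ o l X k z → o * (l * X * (k * z)) ≡ k * (o * (X * (l * z)))
    arith₁ = solve-∀
    arith₂ : ∀ k o R s q t o′ Q → k * (o * ((R + s * q) + t * (o′ * Q))) ≡ k * (o * R + o * (s * q) + t * (o′ * (o * Q)))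
    arith₂ = solve-∀
    arith₃ : ∀ k′ o′ r z q → suc k′ * (q + suc o′ * ((r + z) * q) + suc r * (o′ * q)) ≡ q * (suc o′ * (suc k′ * suc (r + z)) + r * (o′ + o′ * k′))
    arith₃ = solve-∀
    arith₄ : ∀ q o′ kI r k′ → q * (suc o′ * kI + r * (k′ + o′ * k′)) ≡ suc o′ * (q * (kI + r * k′))
    arith₄ = solve-∀

  -- Refutes an uneven distribution of the λ large classes over the classes modulo κ.
  uneven-contradiction : ∀ {q κ λ′ o t} → 1 ≤ r → suc r * k ^ suc r ≡ I → 3 ≤ k′ → (k * k′ * I) * (k * k′ * I) < q →
    2 * κ ≤ o → suc λ′ ≤ o → o ≤ k → t ≤ suc r →
    λ′ * (κ * a) * q + q * b ≤ λ′ * (κ * a) * t + λ′ * κ * (q * b) + o * (a * (λ′ * R)) → ⊥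
  uneven-contradiction {q} {κ} {λ′} {o} {t} 1≤r I≡ 3≤k′ big 2κ≤o λ<o o≤k t≤d le = <⇒≱ room (*-cancelˡ-≤ a (begin
    -- By `main` the excess `c` takes at most the share 3 k / (4 (k + 1)) of q a, and by `small-R`
    -- the classes with few points take at most the share 1 / k′. For k′ = 2 the two shares would
    -- add up to more than 1; for k′ ≥ 3 they leave room for the points of S.
    a * (4 * suc k * k′ * q)  ≤⟨ m≤m+n _ (4 * suc k * k′ * (q * c)) ⟩
    a * (4 * suc k * k′ * q) + 4 * suc k * k′ * (q * c)
      ≡⟨ arith₁ a (4 * suc k * k′) q c ⟩
    4 * suc k * k′ * (q * (a + c))
      ≤⟨ *-monoʳ-≤ (4 * suc k * k′) reduced ⟩
    4 * suc k * k′ * (λ′ * (κ * a) * d + λ′ * κ * (q * c) + o * (a * (λ′ * R)))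
      ≡⟨ arith₂ k′ a λ′ κ d q c o R ⟩
    a * (4 * suc k * k′ * (λ′ * κ) * d) + k′ * q * (4 * (suc k * (λ′ * κ * c))) + a * (4 * suc k * (k′ * (λ′ * o * R)))
      ≤⟨ +-mono-≤ (+-monoʳ-≤ (a * (4 * suc k * k′ * (λ′ * κ) * d)) (*-monoʳ-≤ (k′ * q) main)) (*-monoʳ-≤ a (*-monoʳ-≤ (4 * suc k) small-R)) ⟩
    a * (4 * suc k * k′ * (λ′ * κ) * d) + k′ * q * (3 * k * a) + a * (4 * suc k * q)
      ≡⟨ arith₃ k′ a (4 * suc k * k′ * (λ′ * κ) * d) q ⟩
    a * (4 * suc k * k′ * (λ′ * κ) * d + (3 * k * k′ + 4 * suc k) * q) ∎))
    where
    open ≤-Reasoning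
    -- `c` is b - a, so that c / a is the relative error of the bound on a class.
    d c : ℕ
    d = suc r
    c = k * d + r * k′
    instance
      z-nonZero : NonZero z
      z-nonZero = ℕ.≢-nonZero λ { refl → <⇒≢ d<I (trans (cong suc (sym (+-identityʳ r))) refl) }
        where
        d<I : suc r < I
        d<I = begin-strict
          suc r              ≡⟨ *-identityʳ (suc r) ⟨
          suc r * 1          <⟨ *-monoʳ-< (suc r) (≤-trans (s≤s (≤-trans (s≤s z≤n) 3≤k′)) (≤-trans (≤-reflexive (sym (*-identityʳ k))) (*-monoʳ-≤ k (m^n>0 k r)))) ⟩
          suc r * k ^ suc r  ≡⟨ I≡ ⟩
          I                  ∎
    arith₁ : ∀ a m q c → a * (m * q) + m * (q * c) ≡ m * (q * (a + c))
    arith₁ = solve-∀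
    arith₂ : ∀ k′ a l κ d q c o R → 4 * suc (suc k′) * k′ * (l * (κ * a) * d + l * κ * (q * c) + o * (a * (l * R))) ≡
      a * (4 * suc (suc k′) * k′ * (l * κ) * d) + k′ * q * (4 * (suc (suc k′) * (l * κ * c))) + a * (4 * suc (suc k′) * (k′ * (l * o * R)))
    arith₂ = solve-∀
    arith₃ : ∀ k′ a x q → a * x + k′ * q * (3 * suc k′ * a) + a * (4 * suc (suc k′) * q) ≡ a * (x + (3 * suc k′ * k′ + 4 * suc (suc k′)) * q)
    arith₃ = solve-∀
    b≡ : b ≡ a + c
    b≡ = go k r z k′
      where
      go : ∀ k r z k′ → k * suc (r + z) + r * k′ ≡ k * z + (k * suc r + r * k′)
      go = solve-∀
    reduced : q * (a + c) ≤ λ′ * (κ * a) * d + λ′ * κ * (q * c) + o * (a * (λ′ * R))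
    reduced = +-cancelˡ-≤ (λ′ * (κ * a) * q) _ _ (begin
      λ′ * (κ * a) * q + q * (a + c)   ≡⟨ cong (λ x → λ′ * (κ * a) * q + q * x) b≡ ⟨
      λ′ * (κ * a) * q + q * b         ≤⟨ le ⟩
      λ′ * (κ * a) * t + λ′ * κ * (q * b) + o * (a * (λ′ * R)) ≤⟨ +-monoˡ-≤ (o * (a * (λ′ * R))) (+-monoˡ-≤ (λ′ * κ * (q * b)) (*-monoʳ-≤ (λ′ * (κ * a)) t≤d)) ⟩
      λ′ * (κ * a) * d + λ′ * κ * (q * b) + o * (a * (λ′ * R)) ≡⟨ cong (λ x → λ′ * (κ * a) * d + λ′ * κ * (q * x) + o * (a * (λ′ * R))) b≡ ⟩
      λ′ * (κ * a) * d + λ′ * κ * (q * (a + c)) + o * (a * (λ′ * R)) ≡⟨ go λ′ κ a d q c (o * (a * (λ′ * R))) ⟩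
      λ′ * (κ * a) * q + (λ′ * (κ * a) * d + λ′ * κ * (q * c) + o * (a * (λ′ * R))) ∎)
      where
      go : ∀ l κ a d q c x → l * (κ * a) * d + l * κ * (q * (a + c)) + x ≡ l * (κ * a) * q + (l * (κ * a) * d + l * κ * (q * c) + x)
      go = solve-∀
    λ≤k′ : λ′ ≤ k′
    λ≤k′ = ≤-pred (≤-trans λ<o o≤k)
    2λκ≤k′k : 2 * (λ′ * κ) ≤ k′ * k
    2λκ≤k′k = ≤-trans (≤-reflexive (go λ′ κ)) (*-mono-≤ λ≤k′ (≤-trans 2κ≤o o≤k))
      where
      go : ∀ l κ → 2 * (l * κ) ≡ l * (2 * κ)
      go = solve-∀
    kkII : k * k′ * (k * k′) * (I * I) < q
    kkII = ≤-<-trans (≤-reflexive (go (k * k′) I)) big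
      where
      go : ∀ x I → x * x * (I * I) ≡ (x * I) * (x * I)
      go = solve-∀
    small-R : k′ * (λ′ * o * R) ≤ q
    small-R = begin
      k′ * (λ′ * o * R)  ≤⟨ *-monoʳ-≤ k′ (*-monoˡ-≤ R (*-mono-≤ λ≤k′ o≤k)) ⟩
      k′ * (k′ * k * R)  ≡⟨ go k′ k I ⟩
      k * k′ * (k * k′) * (I * I) ≤⟨ <⇒≤ kkII ⟩
      q ∎
      where
      go : ∀ k′ k I → k′ * (k′ * k * (k * I * I)) ≡ k * k′ * (k * k′) * (I * I)
      go = solve-∀
    -- c ≤ k (2d - 1), while a is at least k d (k² - 1) k^(r-1)
    main : 4 * (suc k * (λ′ * κ * c)) ≤ 3 * k * a
    main = begin
      4 * (suc k * (λ′ * κ * c))           ≡⟨ go₁ (suc k) (λ′ * κ) c ⟩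
      2 * (suc k * (2 * (λ′ * κ) * c))     ≤⟨ *-monoʳ-≤ 2 (*-monoʳ-≤ (suc k) (*-mono-≤ 2λκ≤k′k c≤)) ⟩
      2 * (suc k * (k′ * k * (k * (d + r)))) ≡⟨ go₂ k k′ (d + r) ⟩
      k * k * (k′ * suc k) * (2 * (d + r))  ≤⟨ *-monoʳ-≤ (k * k * (k′ * suc k)) twice ⟩
      k * k * (k′ * suc k) * (3 * (d * k ^ (r ∸ 1))) ≡⟨ go₃ k k′ d (k ^ (r ∸ 1)) ⟩
      3 * k * (k * (d * (k′ * suc k * k ^ (r ∸ 1)))) ≤⟨ *-monoʳ-≤ (3 * k) (*-monoʳ-≤ k z≥) ⟩
      3 * k * a                            ∎
      where
      go₁ : ∀ s x c → 4 * (s * (x * c)) ≡ 2 * (s * (2 * x * c))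
      go₁ = solve-∀
      go₂ : ∀ k k′ x → 2 * (suc k * (k′ * k * (k * x))) ≡ k * k * (k′ * suc k) * (2 * x)
      go₂ = solve-∀
      go₃ : ∀ k k′ d x → k * k * (k′ * suc k) * (3 * (d * x)) ≡ 3 * k * (k * (d * (k′ * suc k * x)))
      go₃ = solve-∀
      c≤ : c ≤ k * (d + r)
      c≤ = ≤-trans (+-monoʳ-≤ (k * d) (≤-trans (*-monoʳ-≤ r (n≤1+n k′)) (≤-reflexive (*-comm r k)))) (≤-reflexive (sym (*-distribˡ-+ k d r)))
      -- For r = 1 this is an equality, which dictates the constant 3.
      twice : 2 * (d + r) ≤ 3 * (d * k ^ (r ∸ 1))
      twice = helper r 1≤r
        where
        helper : ∀ r → 1 ≤ r → 2 * (suc r + r) ≤ 3 * (suc r * k ^ (r ∸ 1))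
        helper (suc zero)    _ = ≤-refl
        helper (suc (suc n)) _ = begin
          2 * (suc (2 + n) + (2 + n))       ≤⟨ m≤m+n _ (2 * n + 8) ⟩
          2 * (suc (2 + n) + (2 + n)) + (2 * n + 8) ≡⟨ go n ⟩
          3 * (suc (2 + n) * 2)             ≤⟨ *-monoʳ-≤ 3 (*-monoʳ-≤ (suc (2 + n)) (≤-trans (≤-trans (n≤1+n 2) (m≤n⇒m≤1+n 3≤k′)) (≤-trans (≤-reflexive (sym (*-identityʳ k))) (*-monoʳ-≤ k (m^n>0 k n))))) ⟩
          3 * (suc (2 + n) * k ^ suc n)     ∎
          where
          go : ∀ n → 2 * (suc (2 + n) + (2 + n)) + (2 * n + 8) ≡ 3 * (suc (2 + n) * 2)
          go = solve-∀
      z≥ : d * (k′ * suc k * k ^ (r ∸ 1)) ≤ z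
      z≥ = +-cancelˡ-≤ d _ _ (begin
        d + d * (k′ * suc k * x)          ≤⟨ +-monoˡ-≤ _ (≤-trans (≤-reflexive (sym (*-identityʳ d))) (*-monoʳ-≤ d (m^n>0 k (r ∸ 1)))) ⟩
        d * x + d * (k′ * suc k * x)      ≡⟨ go d k′ x ⟩
        d * (k * (k * x))                 ≡⟨ cong (λ m → d * (k * k ^ m)) (m+[n∸m]≡n 1≤r) ⟩
        d * k ^ d                         ≡⟨ I≡ ⟩
        d + z                             ∎)
        where
        x = k ^ (r ∸ 1)
        go : ∀ d k′ x → d * x + d * (k′ * suc (suc k′) * x) ≡ d * (suc k′ * (suc k′ * x))
        go = solve-∀
    instance
      a-nonZero : NonZero a
      a-nonZero = m*n≢0 k z
    -- 4 (k+1) k' - 3 k k' - 4 (k+1) = k'² + k' - 8 ≥ 4 when k' ≥ 3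
    room : 4 * suc k * k′ * (λ′ * κ) * d + (3 * k * k′ + 4 * suc k) * q < 4 * suc k * k′ * q
    room = +-cancelʳ-< _ _ _ (begin-strict
      4 * suc k * k′ * (λ′ * κ) * d + (3 * k * k′ + 4 * suc k) * q + 8 * q
        ≡⟨ go₁ (suc k) k′ (λ′ * κ) d _ ⟩
      2 * (suc k * (k′ * (2 * (λ′ * κ) * d))) + ((3 * k * k′ + 4 * suc k) * q + 8 * q)
        ≤⟨ +-monoˡ-≤ _ (*-monoʳ-≤ 2 (*-monoʳ-≤ (suc k) (*-monoʳ-≤ k′ (*-monoˡ-≤ d 2λκ≤k′k)))) ⟩
      2 * (suc k * (k′ * (k′ * k * d))) + ((3 * k * k′ + 4 * suc k) * q + 8 * q)
        <⟨ +-monoˡ-< _ (*-monoʳ-< 2 lt) ⟩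
      2 * (2 * q) + ((3 * k * k′ + 4 * suc k) * q + 8 * q)
        ≡⟨ go₂ k′ q ⟩
      (3 * (k′ * k′) + 7 * k′ + 20) * q
        ≤⟨ *-monoˡ-≤ q ineq ⟩
      (4 * (k′ * k′) + 8 * k′ + 8) * q
        ≡⟨ go₃ k′ q ⟩
      4 * suc k * k′ * q + 8 * q ∎)
      where
      go₁ : ∀ s k′ x d y → 4 * s * k′ * x * d + y + 8 * q ≡ 2 * (s * (k′ * (2 * x * d))) + (y + 8 * q)
      go₁ s k′ x d y = go s k′ x d y (8 * q)
        where
        go : ∀ s k′ x d y w → 4 * s * k′ * x * d + y + w ≡ 2 * (s * (k′ * (2 * x * d))) + (y + w)
        go = solve-∀
      go₂ : ∀ k′ q → 2 * (2 * q) + ((3 * suc k′ * k′ + 4 * suc (suc k′)) * q + 8 * q) ≡ (3 * (k′ * k′) + 7 * k′ + 20) * q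
      go₂ = solve-∀
      go₃ : ∀ k′ q → (4 * (k′ * k′) + 8 * k′ + 8) * q ≡ 4 * suc (suc k′) * k′ * q + 8 * q
      go₃ = solve-∀
      ineq : 3 * (k′ * k′) + 7 * k′ + 20 ≤ 4 * (k′ * k′) + 8 * k′ + 8
      ineq = begin
        3 * (k′ * k′) + 7 * k′ + 20          ≡⟨ h₁ (k′ * k′) k′ ⟩
        3 * (k′ * k′) + 7 * k′ + 8 + (3 * 3 + 3) ≤⟨ +-monoʳ-≤ (3 * (k′ * k′) + 7 * k′ + 8) (+-mono-≤ (*-mono-≤ 3≤k′ 3≤k′) 3≤k′) ⟩
        3 * (k′ * k′) + 7 * k′ + 8 + (k′ * k′ + k′) ≡⟨ h₂ (k′ * k′) k′ ⟩
        4 * (k′ * k′) + 8 * k′ + 8           ∎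
        where
        h₁ : ∀ x k′ → 3 * x + 7 * k′ + 20 ≡ 3 * x + 7 * k′ + 8 + (3 * 3 + 3)
        h₁ = solve-∀
        h₂ : ∀ x k′ → 3 * x + 7 * k′ + 8 + (x + k′) ≡ 4 * x + 8 * k′ + 8
        h₂ = solve-∀
      lt : suc k * (k′ * (k′ * k * d)) < 2 * q
      lt = begin-strict
        suc k * (k′ * (k′ * k * d))    ≤⟨ *-monoˡ-≤ _ (≤-trans (+-monoˡ-≤ k (s≤s z≤n)) (≤-reflexive (cong (k +_) (sym (+-identityʳ k))))) ⟩
        2 * k * (k′ * (k′ * k * d))    ≡⟨ h k k′ d ⟩
        2 * (k * k′ * (k * k′) * d)    ≤⟨ *-monoʳ-≤ 2 (*-monoʳ-≤ (k * k′ * (k * k′)) (≤-trans (s≤s (m≤m+n r z)) (≤-trans (≤-reflexive (sym (*-identityʳ I))) (*-monoʳ-≤ I (s≤s z≤n))))) ⟩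
        2 * (k * k′ * (k * k′) * (I * I)) <⟨ *-monoʳ-< 2 kkII ⟩
        2 * q                          ∎
        where
        h : ∀ k k′ d → 2 * k * (k′ * (k′ * k * d)) ≡ 2 * (k * k′ * (k * k′) * d)
        h = solve-∀

-- Upper bounds for the classes of one character

module Equidistribution {q : ℕ} (F : FiniteField q) (g : FiniteField.Carrier F) (isGen : IsGenerator F g)
  (S : List (FiniteField.Carrier F)) (S-unique : Unique S) (r k′ z : ℕ) (length-S : length S ≡ suc r) (1≤r : 1 ≤ r) (1≤k′ : 1 ≤ k′)
  (I≡ : suc r * suc k′ ^ suc r ≡ suc (r + z)) (k∣N : suc k′ ∣ q ∸ 1)
  (big : (suc k′ * k′ * suc (r + z)) * (suc k′ * k′ * suc (r + z)) ≤ q ∸ 1) where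

  open FiniteField F using (Carrier)
  open FieldTheory F using (elements; elements-unique; length-elements) renaming (_≟_ to _≟F_)
  open FieldFacts.Generator F g isGen using (N; 1+N≡q; N-nonZero)
  open Characters F g isGen using (Points; Outside; χ)
  open NonVanishing F g isGen
  open Parameters r k′ z

  outside? : ∀ x → Dec (All (x ≢_) S)
  outside? x = All.all? (λ s → ¬? (x ≟F s)) S

  Out : List Carrier
  Out = filter outside? elements

  Out-unique : Unique Out
  Out-unique = filter⁺ outside? elements-unique

  q≤Out+d : q ≤ length Out + suc r
  q≤Out+d = subst₂ _≤_ length-elements (cong (length Out +_) length-S)
    (length-avoiding _≟F_ outside? elements S elements-unique inside)
    where
    inside : ∀ x → ¬ All (x ≢_) S → x ∈ S
    inside x ¬out = go S ¬out
      where
      go : ∀ S → ¬ All (x ≢_) S → x ∈ S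
      go []      ¬out = ⊥-elim (¬out [])
      go (s ∷ S) ¬out with x ≟F s
      ... | yes refl = here refl
      ... | no  x≢s  = there (go S (¬out ∘ (x≢s ∷_)))

  N≤q : N ≤ q
  N≤q = m∸n≤m q 1

  kkII≤N : (k * I) * (k * I) ≤ N
  kkII≤N = ≤-trans (*-mono-≤ kI≤ kI≤) big
    where
    kI≤ : k * I ≤ k * k′ * I
    kI≤ = *-monoˡ-≤ I (≤-trans (≤-reflexive (sym (*-identityʳ k))) (*-monoʳ-≤ k 1≤k′))

  oR≤N : ∀ {o} → o ≤ k → o * R ≤ N
  oR≤N o≤k = ≤-trans (*-monoˡ-≤ R o≤k) (≤-trans (≤-reflexive (go k I)) kkII≤N)
    where
    go : ∀ k I → k * (k * I * I) ≡ (k * I) * (k * I)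
    go = solve-∀

  λz≤q : ∀ {λ′} → λ′ ≤ k → λ′ * z ≤ q
  λz≤q λ≤k = ≤-trans (*-mono-≤ λ≤k (m≤n⇒m≤1+n (m≤n+m z r))) (≤-trans (m≤m*n (k * I) (k * I)) (≤-trans kkII≤N N≤q))

  module Character (L : Points) (points : map proj₁ L ≡ S) where

    length-L : length L ≡ suc r
    length-L = trans (sym (Listₚ.length-map proj₁ L)) (trans (cong length points) length-S)

    distinct : Distinct L
    distinct = subst Unique (sym points) S-unique

    class : (o : ℕ) .{{_ : NonZero o}} → ℕ → List Carrier
    class o = fibre (λ x → χ L x % o) Out

    class-spec : ∀ (o : ℕ) .{{_ : NonZero o}} {v x} → x ∈ class o v → Outside L x × χ L x % o ≡ v
    class-spec o {v} {x} x∈ with ∈-filter⁻ (λ x → χ L x % o ≟ v) {xs = Out} x∈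
    ... | x∈Out , eq = Allₚ.map⁻ (subst (All (x ≢_)) (sym points) (proj₂ (∈-filter⁻ outside? {xs = elements} x∈Out))) , eq

    class-unique : ∀ (o : ℕ) .{{_ : NonZero o}} v → Unique (class o v)
    class-unique o v = filter⁺ (λ x → χ L x % o ≟ v) Out-unique

    module _ (o Qo : ℕ) {{_ : NonZero o}} (o*Qo≡N : o * Qo ≡ N) (o≤k : o ≤ k) where

      ramified : ∀ {s e} → (s , e) ∈ L → Coprime e o → ∀ v → o * length (class o v) * a ≤ q * b
      ramified s∈ cop v = count-bound {o} o≤k (≤-trans (oR≤N o≤k) N≤q) (≤-trans (≤-reflexive o*Qo≡N) N≤q)
        (subst (λ d → length (class o v) * (o * z) ≤ ((R ∸ 1) + (I ∸ 1) * q) + d * ((o ∸ 1) * Qo)) length-L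
          (Ramified.ramified-bound o Qo o*Qo≡N L s∈ distinct cop I R R≤Qo length-L (class o v) (class-unique o v) (class-spec o)
            (λz≤q o≤k) (few-conditions {o} (ℕ.>-nonZero⁻¹ o) o≤k 1≤k′)))
        where
        R≤Qo : R ≤ Qo
        R≤Qo = *-cancelˡ-≤ o (≤-trans (oR≤N o≤k) (≤-reflexive (sym o*Qo≡N)))

      -- The threshold is `R` because a polynomial of degree below `R` is determined by its values
      -- on such a class.
      large : List ℕ
      large = filter (λ v → R ≤? length (class o v)) (upTo o)

      large≤o : length large ≤ o
      large≤o = ≤-trans (Listₚ.length-filter (λ v → R ≤? length (class o v)) (upTo o)) (≤-reflexive (Listₚ.length-upTo o))

      populated : ∀ v → length large * length (class o v) * a ≤ q * b
      populated v with 1 ≤? length large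
      ... | no  ≰ = ≤-trans (≤-reflexive (cong (λ l → l * length (class o v) * a) (n<1⇒n≡0 (≰⇒> ≰)))) z≤n
      ... | yes 1≤λ = count-bound {length large} {o} o≤k (≤-trans (oR≤N o≤k) N≤q) (≤-trans (≤-reflexive o*Qo≡N) N≤q)
        (subst (λ d → length (class o v) * (length large * z) ≤ ((R ∸ 1) + (I ∸ 1) * q) + d * ((o ∸ 1) * Qo)) length-L
          (Populated.populated-bound o Qo o*Qo≡N L I R large (filter⁺ (λ v → R ≤? length (class o v)) (upTo⁺ o)) (class o) (class-unique o)
            (λ {v} v∈ → let v∈upTo , R≤ = ∈-filter⁻ (λ v → R ≤? length (class o v)) {xs = upTo o} v∈
                        in ∈-upTo⁻ v∈upTo , R≤ , class-spec o)
            length-L (class o v) (class-unique o v) (class-spec o) (λz≤q (≤-trans large≤o o≤k)) (few-conditions {length large} 1≤λ (≤-trans large≤o o≤k) 1≤k′)))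

    -- If some prime power κ ∣ o did not divide the number λ of large classes, some class modulo κ would
    -- contain fewer than λ / κ of them, too few for the equidistribution modulo κ.
    uniform : ∀ (o : ℕ) {{_ : NonZero o}} → o ∣ k → (∀ {ℓ} → Prime ℓ → ℓ ∣ o → ∃[ s ] ∃[ e ] ((s , e) ∈ L × ℓ ∤ e)) →
      ∀ v → o * length (class o v) * a ≤ q * b
    uniform o o∣k faithful with Div.∣-trans o∣k k∣N
    ... | divides Qo N≡Qo*o with Any.any? (λ (s , e) → coprime? e o) L
    ... | yes any = let (s , e) , s∈ , cop = find any in ramified o Qo (trans (*-comm o Qo) (sym N≡Qo*o)) (Div.∣⇒≤ o∣k) s∈ cop
    ... | no none = subst (λ l → ∀ v → l * length (class o v) * a ≤ q * b) λ≡o (populated o Qo o*Qo≡N o≤k)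
      where
      o≤k : o ≤ k
      o≤k = Div.∣⇒≤ o∣k
      o*Qo≡N : o * Qo ≡ N
      o*Qo≡N = trans (*-comm o Qo) (sym N≡Qo*o)
      λ′ : ℕ
      λ′ = length (large o Qo o*Qo≡N o≤k)
      λ≤o : λ′ ≤ o
      λ≤o = large≤o o Qo o*Qo≡N o≤k

      -- For m = 1 the exponent e would be coprime to `o`, and that case is already settled by the
      -- ramified bound.
      proper : ∀ {κ s e} m → o ≡ m * κ → (s , e) ∈ L → Coprime e κ → 2 ≤ m
      proper zero o≡ s∈ cop = ⊥-elim (ℕ.≢-nonZero⁻¹ o o≡)
      proper (suc zero) o≡ s∈ cop = ⊥-elim (none (lose s∈ (subst (Coprime _) (sym (trans o≡ (+-identityʳ _))) cop)))
      proper (suc (suc m)) o≡ s∈ cop = s≤s (s≤s z≤n)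

      coprime-power : ∀ {ℓ e} a → Prime ℓ → ℓ ∤ e → Coprime e (ℓ ^ a)
      coprime-power a pℓ ℓ∤e = Cop.sym (coprime-^ a pℓ ℓ∤e)

      -- The order `o` is not 1 and is not a prime either, by `proper`; hence 4 ≤ o ≤ k.
      3≤k′ : 3 ≤ k′
      3≤k′ with o ≟ 1
      ... | yes refl = ⊥-elim (empty L length-L none)
        where
        empty : ∀ L → length L ≡ suc r → ¬ Any (λ (s , e) → Coprime e 1) L → ⊥
        empty (_ ∷ _) _ ¬any = ¬any (here λ {_} d∣ → Div.∣1⇒≡1 (proj₂ d∣))
      ... | no o≢1 with prime-divisor o o≢1
      ... | ℓ , pℓ , divides m o≡ with faithful pℓ (divides m o≡)
      ... | s , e , s∈ , ℓ∤e = ≤-pred (≤-trans (*-mono-≤ (proper m o≡ s∈ (subst (Coprime e) (*-identityʳ ℓ) (coprime-power 1 pℓ ℓ∤e)))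
              (ℕ.nonTrivial⇒n>1 ℓ {{prime⇒nonTrivial pℓ}})) (≤-trans (≤-reflexive (sym o≡)) o≤k))

      big< : (k * k′ * I) * (k * k′ * I) < q
      big< = ≤-trans (s≤s big) (≤-reflexive 1+N≡q)

      divisible : ∀ {ℓ} i → Prime ℓ → ℓ ^ i ∣ o → ℓ ^ i ∣ λ′
      divisible zero pℓ _ = Div.1∣ λ′
      divisible {ℓ} i@(suc i′) pℓ ℓ^i∣o@(divides m o≡) with ℓ ^ i ∣? λ′
      ... | yes div = div
      ... | no ¬div with faithful pℓ (Div.∣-trans (Div.m∣m*n (ℓ ^ i′)) ℓ^i∣o)
      ... | s , e , s∈ , ℓ∤e = ⊥-elim (uneven-contradiction {κ = κ} {λ′} {o} {suc r} 1≤r I≡ 3≤k′ big<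
              (≤-trans (*-monoˡ-≤ κ 2≤m) (≤-reflexive (sym o≡)))
              (≤∧≢⇒< λ≤o (λ λ≡o → ¬div (subst (κ ∣_) (sym λ≡o) (divides m o≡)))) o≤k ≤-refl inequality)
        where
        κ : ℕ
        κ = ℓ ^ i
        2≤m : 2 ≤ m
        2≤m = proper m o≡ s∈ (coprime-power i pℓ ℓ∤e)
        κ∣N : κ ∣ N
        κ∣N = Div.∣-trans ℓ^i∣o (Div.∣-trans o∣k k∣N)
        instance
          κ-nonZero : NonZero κ
          κ-nonZero = m^n≢0 ℓ i {{prime⇒nonZero pℓ}}
          mκ-nonZero : NonZero (m * κ)
          mκ-nonZero = ℕ.≢-nonZero (ℕ.≢-nonZero⁻¹ o ∘ trans o≡)
        open ≤-Reasoning
        n : ℕ → ℕ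
        n v = length (class o v)
        large? : ∀ v → Dec (R ≤ n v)
        large? v = R ≤? n v
        f : ℕ → ℕ
        f c = κ * length (class κ c) * a
        f≤ : ∀ c → f c ≤ q * b
        f≤ = ramified κ (Div.quotient κ∣N) (sym (Div.m∣n⇒n≡m*quotient κ∣N)) (≤-trans (Div.∣⇒≤ ℓ^i∣o) o≤k) s∈ (coprime-power i pℓ ℓ∤e)
        spread : ℕ → ℕ
        spread c = ∑< m (λ i → ⟦ large? (i * κ + c) ⟧)
        spread≡ : ∑< κ spread ≡ λ′
        spread≡ = begin-equality
          ∑< κ (λ c → ∑< m (λ i → ⟦ large? (i * κ + c) ⟧)) ≡⟨ ∑-swap (upTo κ) (upTo m) _ ⟩
          ∑< m (λ i → ∑< κ (λ c → ⟦ large? (i * κ + c) ⟧)) ≡⟨ ∑<-* m κ (λ v → ⟦ large? v ⟧) ⟨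
          ∑< (m * κ) (λ v → ⟦ large? v ⟧)                  ≡⟨ cong (λ o → ∑< o (λ v → ⟦ large? v ⟧)) o≡ ⟨
          ∑< o (λ v → ⟦ large? v ⟧)                        ≡⟨ length-filter large? (upTo o) ⟨
          λ′                                               ∎
        refine : ∀ c → c < κ → length (class κ c) ≡ ∑< m (λ i → n (i * κ + c))
        refine c c<κ = trans (fibre-refine κ m (χ L) Out c c<κ)
          (∑<-cong m (λ i _ → cong length (Listₚ.filter-≐ _ _ ((λ {x} e → trans (%≡ (χ L x)) e) , λ {x} e → trans (sym (%≡ (χ L x))) e) Out)))
          where
          %≡ : ∀ y → y % o ≡ y % (m * κ)
          %≡ y = DM.%-congʳ o≡
        scarce : ∃[ c ] (c < κ × κ * spread c ≤ λ′)
        scarce = below-average κ spread λ′ spread≡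
        c : ℕ
        c = proj₁ scarce
        c<κ : c < κ
        c<κ = proj₁ (proj₂ scarce)
        scarce< : suc (κ * spread c) ≤ λ′
        scarce< = ≤∧≢⇒< (proj₂ (proj₂ scarce)) (λ e → ¬div (divides (spread c) (trans (sym e) (*-comm κ (spread c)))))
        term : ∀ v → λ′ * n v * a ≤ ⟦ large? v ⟧ * (q * b) + λ′ * R * a
        term v with large? v
        ... | yes _ = ≤-trans (populated o Qo o*Qo≡N o≤k v) (≤-trans (≤-reflexive (sym (+-identityʳ (q * b)))) (m≤m+n (q * b + 0) (λ′ * R * a)))
        ... | no  ≰ = *-monoˡ-≤ a (*-monoʳ-≤ λ′ (<⇒≤ (≰⇒> ≰)))
        -- Class c modulo κ is the union of m classes modulo `o`. The large ones have at most q b /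
        -- (λ a) points each, and there are at most (λ - 1) / κ of them by `scarce<`; the missing 1
        -- / κ is the summand q b on the left. The other classes contribute fewer than `R` points
        -- each.
        λfc≤ : λ′ * f c + q * b ≤ λ′ * (q * b) + o * (a * (λ′ * R))
        λfc≤ = begin
          λ′ * (κ * length (class κ c) * a) + q * b
            ≡⟨ cong (_+ q * b) (trans (cong (λ n → λ′ * (κ * n * a)) (refine c c<κ)) (h₁ λ′ κ (∑< m (λ i → n (i * κ + c))) a)) ⟩
          κ * (λ′ * a * ∑< m (λ i → n (i * κ + c))) + q * b
            ≡⟨ cong (λ x → κ * x + q * b) (∑-*ˡ (upTo m) (λ′ * a) (λ i → n (i * κ + c))) ⟨
          κ * ∑< m (λ i → λ′ * a * n (i * κ + c)) + q * b
            ≤⟨ +-monoˡ-≤ (q * b) (*-monoʳ-≤ κ (∑<-mono m (λ i _ → ≤-trans (≤-reflexive (h₂ λ′ a (n (i * κ + c)))) (term (i * κ + c))))) ⟩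
          κ * ∑< m (λ i → ⟦ large? (i * κ + c) ⟧ * (q * b) + λ′ * R * a) + q * b
            ≡⟨ cong (λ x → κ * x + q * b) (trans (∑-+ (upTo m) (λ i → ⟦ large? (i * κ + c) ⟧ * (q * b)) (λ _ → λ′ * R * a)) (cong₂ _+_ (∑-*ʳ (upTo m) (q * b) _) (∑<-const m _))) ⟩
          κ * (spread c * (q * b) + m * (λ′ * R * a)) + q * b
            ≡⟨ h₃ κ (spread c) (q * b) m (λ′ * R) a ⟩
          suc (κ * spread c) * (q * b) + m * κ * (a * (λ′ * R))
            ≤⟨ +-mono-≤ (*-monoˡ-≤ (q * b) scarce<) (≤-reflexive (cong (_* (a * (λ′ * R))) (sym o≡))) ⟩
          λ′ * (q * b) + o * (a * (λ′ * R)) ∎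
          where
          h₁ : ∀ l κ x a → l * (κ * x * a) ≡ κ * (l * a * x)
          h₁ = solve-∀
          h₂ : ∀ l a x → l * a * x ≡ l * x * a
          h₂ = solve-∀
          h₃ : ∀ κ s y m x a → κ * (s * y + m * (x * a)) + y ≡ suc (κ * s) * y + m * κ * (a * x)
          h₃ = solve-∀
        total : ∑< κ f ≡ κ * a * length Out
        total = begin-equality
          ∑< κ (λ c → κ * length (class κ c) * a)    ≡⟨ ∑<-cong κ (λ c _ → h κ (length (class κ c)) a) ⟩
          ∑< κ (λ c → κ * a * length (class κ c))    ≡⟨ ∑-*ˡ (upTo κ) (κ * a) _ ⟩
          κ * a * ∑< κ (λ c → length (class κ c))    ≡⟨ cong (κ * a *_) (fibres-partition κ (λ x → χ L x % κ) Out (λ x → DM.m%n<n (χ L x) κ)) ⟩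
          κ * a * length Out                         ∎
          where
          h : ∀ κ x a → κ * x * a ≡ κ * a * x
          h = solve-∀
        -- The classes modulo κ exhaust `Out`, which has at least q - d points; class c is estimated
        -- by `λfc≤`, every other one by `f≤`.
        inequality : λ′ * (κ * a) * q + q * b ≤ λ′ * (κ * a) * suc r + λ′ * κ * (q * b) + o * (a * (λ′ * R))
        inequality = +-cancelʳ-≤ (λ′ * (q * b)) _ _ (begin
          λ′ * (κ * a) * q + q * b + λ′ * (q * b)
            ≤⟨ +-monoˡ-≤ _ (+-monoˡ-≤ _ (*-monoʳ-≤ (λ′ * (κ * a)) q≤Out+d)) ⟩
          λ′ * (κ * a) * (length Out + suc r) + q * b + λ′ * (q * b)
            ≡⟨ h₁ λ′ (κ * a) (length Out) (suc r) (q * b) ⟩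
          λ′ * (κ * a) * suc r + q * b + λ′ * (κ * a * length Out + q * b)
            ≡⟨ cong (λ x → λ′ * (κ * a) * suc r + q * b + λ′ * (x + q * b)) total ⟨
          λ′ * (κ * a) * suc r + q * b + λ′ * (∑< κ f + q * b)
            ≤⟨ +-monoʳ-≤ (λ′ * (κ * a) * suc r + q * b) (*-monoʳ-≤ λ′ (∑<-except κ f (q * b) c c<κ (λ c _ → f≤ c))) ⟩
          λ′ * (κ * a) * suc r + q * b + λ′ * (κ * (q * b) + f c)
            ≡⟨ h₂ (λ′ * (κ * a) * suc r) (q * b) λ′ κ (f c) ⟩
          λ′ * (κ * a) * suc r + λ′ * κ * (q * b) + (λ′ * f c + q * b)
            ≤⟨ +-monoʳ-≤ (λ′ * (κ * a) * suc r + λ′ * κ * (q * b)) λfc≤ ⟩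
          λ′ * (κ * a) * suc r + λ′ * κ * (q * b) + (λ′ * (q * b) + o * (a * (λ′ * R)))
            ≡⟨ h₃ (λ′ * (κ * a) * suc r + λ′ * κ * (q * b)) (λ′ * (q * b)) _ ⟩
          λ′ * (κ * a) * suc r + λ′ * κ * (q * b) + o * (a * (λ′ * R)) + λ′ * (q * b) ∎)
          where
          h₁ : ∀ l x y d w → l * x * (y + d) + w + l * w ≡ l * x * d + w + l * (x * y + w)
          h₁ = solve-∀
          h₂ : ∀ t w l κ y → t + w + l * (κ * w + y) ≡ t + l * κ * w + (l * y + w)
          h₂ = solve-∀
          h₃ : ∀ t w y → t + (w + y) ≡ t + y + w
          h₃ = solve-∀

      -- λ = 0 has every divisor, so it must be excluded before `o ∣ λ′` gives an inequality. At
      -- most k classes with at most `R` points each, together with S, are too few to fill the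
      -- field.
      some-large : 1 ≤ λ′
      some-large with 1 ≤? λ′
      ... | yes p = p
      ... | no ≰ = ⊥-elim (<⇒≱ big< (begin
          q                                   ≤⟨ q≤Out+d ⟩
          length Out + suc r                  ≡⟨ cong (_+ suc r) (fibres-partition o (λ x → χ L x % o) Out (λ x → DM.m%n<n (χ L x) o)) ⟨
          ∑< o (λ v → length (class o v)) + suc r ≤⟨ +-mono-≤ (∑<-mono o (λ v v<o → small v v<o)) (≤-trans (s≤s (m≤m+n r z)) (m≤n*m I k)) ⟩
          ∑< o (λ _ → R) + k * I              ≡⟨ cong (_+ k * I) (∑<-const o R) ⟩
          o * R + k * I                       ≤⟨ +-mono-≤ (*-monoˡ-≤ R o≤k) (m≤m*n (k * I) (k * I)) ⟩
          k * R + (k * I) * (k * I)           ≡⟨ h k I ⟩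
          2 * ((k * I) * (k * I))             ≤⟨ *-monoˡ-≤ ((k * I) * (k * I)) (≤-trans (n≤1+n 2) 3≤k′) ⟩
          k′ * ((k * I) * (k * I))            ≤⟨ *-monoˡ-≤ ((k * I) * (k * I)) (m≤m*n k′ k′ {{ℕ.>-nonZero 1≤k′}}) ⟩
          k′ * k′ * ((k * I) * (k * I))       ≡⟨ h₂ k k′ I ⟩
          (k * k′ * I) * (k * k′ * I)         ∎))
        where
        open ≤-Reasoning
        h : ∀ k I → k * (k * I * I) + (k * I) * (k * I) ≡ 2 * ((k * I) * (k * I))
        h = solve-∀
        h₂ : ∀ k k′ I → k′ * k′ * ((k * I) * (k * I)) ≡ (k * k′ * I) * (k * k′ * I)
        h₂ = solve-∀
        large? : ∀ v → Dec (R ≤ length (class o v))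
        large? v = R ≤? length (class o v)
        small : ∀ v → v < o → length (class o v) ≤ R
        small v v<o with ≤-total R (length (class o v))
        ... | inj₂ le = le
        ... | inj₁ R≤ = ⊥-elim (≰ (≤-trans (≤-reflexive (sym (⟦⟧-yes {P? = large? v} R≤))) (≤-trans (single o v v<o) (≤-reflexive (sym (length-filter large? (upTo o)))))))
          where
          single : ∀ n v → v < n → ⟦ large? v ⟧ ≤ ∑< n (λ v → ⟦ large? v ⟧)
          single n v v<n = member (upTo n) (∈-upTo⁺ v<n)
            where
            member : ∀ xs → v ∈ xs → ⟦ large? v ⟧ ≤ ∑ xs (λ v → ⟦ large? v ⟧)
            member (x ∷ xs) (here refl) = m≤m+n _ _
            member (x ∷ xs) (there v∈)  = ≤-trans (member xs v∈) (m≤n+m _ _)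

      λ≡o : λ′ ≡ o
      λ≡o = ≤-antisym λ≤o (Div.∣⇒≤ {{ℕ.>-nonZero some-large}} (prime-powers-∣ o divisible))

-- Inversion

%-+-congˡ : ∀ {k} .{{_ : NonZero k}} {u v} c → u % k ≡ v % k → (u + c) % k ≡ (v + c) % k
%-+-congˡ {k} {u} {v} c e = trans (DM.%-distribˡ-+ u c k) (trans (cong (λ x → (x + c % k) % k) e) (sym (DM.%-distribˡ-+ v c k)))

%-*-congˡ : ∀ {k} .{{_ : NonZero k}} {u v} c → u % k ≡ v % k → (c * u) % k ≡ (c * v) % k
%-*-congˡ {k} {u} {v} c e = trans (DM.%-distribˡ-* c u k) (trans (cong (λ x → (c % k * x) % k) e) (sym (DM.%-distribˡ-* c v k)))

bezout-% : ∀ m k .{{_ : NonZero k}} → ∃[ x ] ((x * m) % k ≡ gcd m k % k)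
bezout-% m k@(suc k′) with Bézout.identity (gcd-GCD m k)
... | Bézout.+- x y e = x , trans (cong (_% k) (sym e)) (DM.[m+kn]%n≡m%n (gcd m k) y k)
-- The coefficient of m in Bézout's identity is -x here; `k′` represents -1 modulo `k`.
... | Bézout.-+ x y e = k′ * x , (begin
  (k′ * x * m) % k             ≡⟨ DM.[m+kn]%n≡m%n (k′ * x * m) y k ⟨
  (k′ * x * m + y * k) % k     ≡⟨ cong (λ w → (k′ * x * m + w) % k) e ⟨
  (k′ * x * m + (gcd m k + x * m)) % k ≡⟨ cong (_% k) (arith k′ x m (gcd m k)) ⟩
  (gcd m k + x * m * k) % k    ≡⟨ DM.[m+kn]%n≡m%n (gcd m k) (x * m) k ⟩
  gcd m k % k                  ∎)
  where
  open ≡.≡-Reasoning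
  arith : ∀ k′ x m G → k′ * x * m + (G + x * m) ≡ G + x * m * suc k′
  arith = solve-∀

∑<-shift : ∀ k (G : ℕ → ℕ) → (∀ i → G (k + i) ≡ G i) → ∀ μ → ∑< k (λ i → G (i + μ)) ≡ ∑< k G
∑<-shift k G periodic zero    = ∑<-cong k (λ i _ → cong G (+-identityʳ i))
∑<-shift k G periodic (suc μ) = begin
  ∑< k (λ i → G (i + suc μ))         ≡⟨ ∑<-cong k (λ i _ → cong G (+-suc i μ)) ⟩
  ∑< k (λ i → H (suc i))             ≡⟨ +-cancelˡ-≡ (H 0) _ _ (begin
    H 0 + ∑< k (H ∘ suc)    ≡⟨ ∑<-suc k H ⟨
    ∑< (suc k) H            ≡⟨ cong (λ n → ∑< n H) (+-comm 1 k) ⟩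
    ∑< (k + 1) H            ≡⟨ ∑<-+ k 1 H ⟩
    ∑< k H + (H (k + 0) + 0) ≡⟨ cong (∑< k H +_) (trans (+-identityʳ _) (trans (cong G (+-assoc k 0 μ)) (periodic μ))) ⟩
    ∑< k H + H 0            ≡⟨ +-comm (∑< k H) (H 0) ⟩
    H 0 + ∑< k H            ∎) ⟩
  ∑< k H                             ≡⟨ ∑<-shift k G periodic μ ⟩
  ∑< k G                             ∎
  where
  open ≡.≡-Reasoning
  H : ℕ → ℕ
  H i = G (i + μ)

-- A weight on ℤ/k that vanishes at 0 and has mean 1 on every coset of every nontrivial subgroup:
-- w = 1 - t, where t is the convolution of the measures δ₀ - δ_{-k/ℓ} over the primes ℓ dividing k.
module Weight (k : ℕ) {{_ : NonZero k}} where

  -- The convolution over the primes up to `n`, split into its positive and negative part. `P`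
  -- accumulates the primes used, and `support` confines both parts to v with k ∣ P v, which keeps
  -- the two translates at the next prime apart. `balanced` is the cancellation over a progression
  -- whose steps reach k / ℓ modulo `k`.
  record SignedSet (n : ℕ) : Set where
    field
      pos neg : ℕ → ℕ
      pos-periodic : ∀ {u v} → u % k ≡ v % k → pos u ≡ pos v
      neg-periodic : ∀ {u v} → u % k ≡ v % k → neg u ≡ neg v
      disjoint : ∀ v → pos v + neg v ≤ 1
      P : ℕ
      P-primes : ∀ {ℓ} → Prime ℓ → ℓ ∣ P → ℓ ≤ n
      support : ∀ v → pos v + neg v ≢ 0 → k ∣ P * v
      pos-0 : 1 ≤ pos 0
      balanced : ∀ {ℓ σ} μ m → Prime ℓ → ℓ ≤ n → k ≡ σ * ℓ → (μ * m) % k ≡ σ % k →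
                 ∀ c → ∑< k (λ i → pos (c + i * m)) ≡ ∑< k (λ i → neg (c + i * m))

  private
    n*k-periodic : ∀ {f : ℕ → ℕ} → (∀ {u v} → u % k ≡ v % k → f u ≡ f v) → ∀ v t → f (v + t * k) ≡ f v
    n*k-periodic per v t = per (DM.[m+kn]%n≡m%n v t k)

    progression-shift : ∀ {f : ℕ → ℕ} → (∀ {u v} → u % k ≡ v % k → f u ≡ f v) → ∀ μ m {σ} → (μ * m) % k ≡ σ % k →
      ∀ c → ∑< k (λ i → f (c + i * m + σ)) ≡ ∑< k (λ i → f (c + i * m))
    progression-shift {f} per μ m {σ} e c = trans
      (∑<-cong k (λ i _ → per (begin
        (c + i * m + σ) % k       ≡⟨ cong (_% k) (+-comm (c + i * m) σ) ⟩
        (σ + (c + i * m)) % k     ≡⟨ %-+-congˡ (c + i * m) (sym e) ⟩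
        (μ * m + (c + i * m)) % k ≡⟨ cong (_% k) (arith μ m c i) ⟩
        (c + (i + μ) * m) % k     ∎)))
      (∑<-shift k (λ i → f (c + i * m)) (λ i → trans (cong f (arith₂ c k i m)) (n*k-periodic per (c + i * m) m)) μ)
      where
      open ≡.≡-Reasoning
      arith : ∀ μ m c i → μ * m + (c + i * m) ≡ c + (i + μ) * m
      arith = solve-∀
      arith₂ : ∀ c k i m → c + (k + i) * m ≡ c + i * m + m * k
      arith₂ = solve-∀

  signedSet : ∀ n → SignedSet n
  signedSet zero = record
    { pos = λ v → ⟦ v % k ≟ 0 ⟧ ; neg = λ _ → 0
    ; pos-periodic = cong (λ x → ⟦ x ≟ 0 ⟧) ; neg-periodic = λ _ → refl
    ; disjoint = λ v → ≤-trans (≤-reflexive (+-identityʳ _)) (bound (v % k ≟ 0))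
    ; P = 1 ; P-primes = λ pℓ ℓ∣1 → ⊥-elim (ℕ.nonTrivial⇒≢1 {{prime⇒nonTrivial pℓ}} (Div.∣1⇒≡1 ℓ∣1))
    ; support = λ v ≢0 → subst (k ∣_) (sym (+-identityʳ v)) (supp v ≢0)
    ; pos-0 = ≤-reflexive (sym (⟦⟧-yes (DM.m<n⇒m%n≡m (ℕ.>-nonZero⁻¹ k))))
    ; balanced = λ μ m pℓ ℓ≤0 → ⊥-elim (<⇒≱ (ℕ.>-nonZero⁻¹ _ {{prime⇒nonZero pℓ}}) ℓ≤0) }
    where
    bound : ∀ {A : Set} (d : Dec A) → ⟦ d ⟧ ≤ 1
    bound (yes _) = ≤-refl
    bound (no  _) = z≤n
    supp : ∀ v → ⟦ v % k ≟ 0 ⟧ + 0 ≢ 0 → k ∣ v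
    supp v ≢0 with v % k ≟ 0
    ... | yes e = Div.m%n≡0⇒n∣m v k e
    ... | no  _ = ⊥-elim (≢0 refl)
  signedSet (suc n) with signedSet n | prime? (suc n) | suc n ∣? k
  ... | S | no ¬p | _ = record
    { SignedSet S ; P-primes = λ pℓ ℓ∣ → m≤n⇒m≤1+n (P-primes pℓ ℓ∣)
    ; balanced = λ μ m pℓ ℓ≤ → balanced μ m pℓ (≤-pred (≤∧≢⇒< ℓ≤ λ { refl → ¬p pℓ })) }
    where open SignedSet S
  ... | S | yes _ | no ∤k = record
    { SignedSet S ; P-primes = λ pℓ ℓ∣ → m≤n⇒m≤1+n (P-primes pℓ ℓ∣)
    ; balanced = λ {ℓ} {σ} μ m pℓ ℓ≤ k≡ → balanced {ℓ} {σ} μ m pℓ (≤-pred (≤∧≢⇒< ℓ≤ λ { refl → ∤k (divides σ k≡) })) k≡ }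
    where open SignedSet S
  ... | S | yes pn | yes (divides σ k≡) = record
    { pos = λ v → pos v + neg (v + σ) ; neg = λ v → neg v + pos (v + σ)
    ; pos-periodic = λ e → cong₂ _+_ (pos-periodic e) (neg-periodic (%-+-congˡ σ e))
    ; neg-periodic = λ e → cong₂ _+_ (neg-periodic e) (pos-periodic (%-+-congˡ σ e))
    ; disjoint = disjoint′
    ; P = P * suc n ; P-primes = P-primes′ ; support = support′
    ; pos-0 = ≤-trans pos-0 (m≤m+n _ _)
    ; balanced = balanced′ }
    where
    open SignedSet S
    A : ℕ → ℕ
    A v = pos v + neg v
    regroup : ∀ a b c d → (a + d) + (b + c) ≡ (a + b) + (c + d)
    regroup = solve-∀
    σ-nonZero : NonZero σ
    σ-nonZero = ℕ.≢-nonZero λ { refl → ℕ.≢-nonZero⁻¹ k k≡ }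
    -- Otherwise k = σ (n + 1) would divide P σ, so the new prime n + 1 would divide `P`, whose
    -- prime factors are at most n.
    not-both : ∀ v → A v ≢ 0 → A (v + σ) ≢ 0 → ⊥
    not-both v h₁ h₂ = <⇒≱ (n<1+n n) (P-primes pn (Div.*-cancelʳ-∣ σ {{σ-nonZero}} (subst (_∣ P * σ) (trans k≡ (*-comm σ (suc n)))
      (Div.∣m+n∣m⇒∣n (subst (k ∣_) (*-distribˡ-+ P v σ) (support (v + σ) h₂)) (support v h₁)))))
    disjoint′ : ∀ v → (pos v + neg (v + σ)) + (neg v + pos (v + σ)) ≤ 1
    disjoint′ v with A v ≟ 0 | A (v + σ) ≟ 0
    ... | yes e | _ = ≤-trans (≤-reflexive (trans (regroup (pos v) (neg v) (pos (v + σ)) (neg (v + σ))) (cong (_+ A (v + σ)) e))) (disjoint (v + σ))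
    ... | no _ | yes e = ≤-trans (≤-reflexive (trans (regroup (pos v) (neg v) (pos (v + σ)) (neg (v + σ))) (trans (cong (A v +_) e) (+-identityʳ _)))) (disjoint v)
    ... | no h₁ | no h₂ = ⊥-elim (not-both v h₁ h₂)
    P-primes′ : ∀ {ℓ} → Prime ℓ → ℓ ∣ P * suc n → ℓ ≤ suc n
    P-primes′ pℓ ℓ∣ with euclidsLemma P (suc n) pℓ ℓ∣
    ... | inj₁ ℓ∣P = m≤n⇒m≤1+n (P-primes pℓ ℓ∣P)
    ... | inj₂ ℓ∣n = Div.∣⇒≤ ℓ∣n
    support′ : ∀ v → (pos v + neg (v + σ)) + (neg v + pos (v + σ)) ≢ 0 → k ∣ P * suc n * v
    support′ v h with A v ≟ 0
    ... | no h₁ = subst (k ∣_) (arith P v (suc n)) (Div.∣m⇒∣m*n (suc n) (support v h₁))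
      where
      arith : ∀ P v n → P * v * n ≡ P * n * v
      arith = solve-∀
    ... | yes e = Div.∣m+n∣m⇒∣n (subst (k ∣_) (trans (arith P v σ (suc n)) (cong (λ x → P * x + P * suc n * v) (sym k≡)))
                    (Div.∣m⇒∣m*n (suc n) (support (v + σ) (λ e′ → h (trans (regroup (pos v) (neg v) (pos (v + σ)) (neg (v + σ))) (cong₂ _+_ e e′))))))
                    (Div.n∣m*n P)
      where
      arith : ∀ P v σ n → P * (v + σ) * n ≡ P * (σ * n) + P * n * v
      arith = solve-∀
    split : ∀ m c (f f′ : ℕ → ℕ) → ∑< k (λ i → f (c + i * m) + f′ (c + i * m + σ)) ≡ ∑< k (λ i → f (c + i * m)) + ∑< k (λ i → f′ (c + i * m + σ))
    split m c f f′ = ∑-+ (upTo k) (λ i → f (c + i * m)) (λ i → f′ (c + i * m + σ))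
    -- For an earlier prime, the old cancellation applies both at c and at c + σ. For the new prime,
    -- translation by σ permutes the progression modulo `k`, so a function and its translate have
    -- equal sums.
    balanced′ : ∀ {ℓ σ′} μ m → Prime ℓ → ℓ ≤ suc n → k ≡ σ′ * ℓ → (μ * m) % k ≡ σ′ % k →
      ∀ c → ∑< k (λ i → pos (c + i * m) + neg (c + i * m + σ)) ≡ ∑< k (λ i → neg (c + i * m) + pos (c + i * m + σ))
    balanced′ {ℓ} {σ′} μ m pℓ ℓ≤ k≡′ e c with m≤n⇒m<n∨m≡n ℓ≤
    ... | inj₁ (s≤s ℓ≤n) = trans (split m c pos neg) (trans (cong₂ _+_ (bal c) (trans (moved neg) (trans (sym (bal (c + σ))) (sym (moved pos))))) (sym (split m c neg pos)))
      where
      bal = balanced {ℓ} {σ′} μ m pℓ ℓ≤n k≡′ e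
      arith : ∀ c x s → c + x + s ≡ c + s + x
      arith = solve-∀
      moved : ∀ f → ∑< k (λ i → f (c + i * m + σ)) ≡ ∑< k (λ i → f (c + σ + i * m))
      moved f = ∑<-cong k (λ i _ → cong f (arith c (i * m) σ))
    ... | inj₂ refl = trans (split m c pos neg) (trans (trans (cong₂ _+_ (sym (progression-shift pos-periodic μ m e′ c)) (progression-shift neg-periodic μ m e′ c)) (+-comm (∑< k (λ i → pos (c + i * m + σ))) (∑< k (λ i → neg (c + i * m))))) (sym (split m c neg pos)))
      where
      e′ : (μ * m) % k ≡ σ % k
      e′ = trans e (cong (_% k) (*-cancelʳ-≡ σ′ σ (suc n) (trans (sym k≡′) k≡)))

  open SignedSet (signedSet k)

  weight : ℕ → ℕ
  weight v = suc (neg v) ∸ pos v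

  weight-periodic : ∀ {u v} → u % k ≡ v % k → weight u ≡ weight v
  weight-periodic e = cong₂ (λ n p → suc n ∸ p) (neg-periodic e) (pos-periodic e)

  weight-+* : ∀ v t → weight (v + t * k) ≡ weight v
  weight-+* v t = weight-periodic (DM.[m+kn]%n≡m%n v t k)

  weight-0 : weight 0 ≡ 0
  weight-0 = m≤n⇒m∸n≡0 (≤-trans (+-monoˡ-≤ (neg 0) pos-0) (≤-trans (disjoint 0) pos-0))

  -- With G = gcd(m, k), the number k / G is not 1 and has a prime divisor ℓ. Then k / ℓ is a
  -- multiple of G, hence by Bézout a multiple of m modulo `k`, and `balanced` makes the deviation
  -- of the weight from 1 cancel.
  weight-progression : ∀ {m} → m % k ≢ 0 → ∀ c → ∑< k (λ i → weight (c + i * m)) ≡ k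
  weight-progression {m} m≢0 c with GCD.gcd[m,n]∣n m k
  ... | divides t k≡tG with prime-divisor t {{t-nonZero}} t≢1
    where
    t-nonZero : NonZero t
    t-nonZero = ℕ.≢-nonZero λ { refl → ℕ.≢-nonZero⁻¹ k k≡tG }
    t≢1 : t ≢ 1
    t≢1 refl = m≢0 (Div.n∣m⇒m%n≡0 m k (subst (_∣ m) (sym (trans k≡tG (+-identityʳ _))) (GCD.gcd[m,n]∣m m k)))
  ... | ℓ , pℓ , divides u t≡uℓ = +-cancelʳ-≡ _ _ _ (begin
    ∑< k (λ i → weight (c + i * m)) + ∑< k (λ i → pos (c + i * m)) ≡⟨ ∑-+ (upTo k) (λ i → weight (c + i * m)) (λ i → pos (c + i * m)) ⟨
    ∑< k (λ i → weight (c + i * m) + pos (c + i * m))              ≡⟨ ∑<-cong k (λ i _ → m∸n+n≡m {n = pos (c + i * m)} (≤-trans (m≤m+n (pos (c + i * m)) (neg (c + i * m))) (≤-trans (disjoint (c + i * m)) (s≤s z≤n)))) ⟩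
    ∑< k (λ i → 1 + neg (c + i * m))                               ≡⟨ ∑-+ (upTo k) (λ _ → 1) (λ i → neg (c + i * m)) ⟩
    ∑< k (λ _ → 1) + ∑< k (λ i → neg (c + i * m))                  ≡⟨ cong₂ _+_ (trans (∑<-const k 1) (*-identityʳ k)) (sym (balanced {ℓ} {σ} (u * x) m pℓ ℓ≤k k≡σℓ mod c)) ⟩
    k + ∑< k (λ i → pos (c + i * m))                               ∎)
    where
    open ≡.≡-Reasoning
    G = gcd m k
    σ = u * G
    k≡σℓ : k ≡ σ * ℓ
    k≡σℓ = trans k≡tG (trans (cong (_* G) t≡uℓ) (arith u ℓ G))
      where
      arith : ∀ u ℓ G → u * ℓ * G ≡ u * G * ℓ
      arith = solve-∀
    ℓ≤k : ℓ ≤ k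
    ℓ≤k = Div.∣⇒≤ (divides σ k≡σℓ)
    x = proj₁ (bezout-% m k)
    mod : (u * x * m) % k ≡ σ % k
    mod = trans (cong (_% k) (*-assoc u x m)) (%-*-congˡ u (proj₂ (bezout-% m k)))

  -- Weights summed over all characters

  tuples : ℕ → List (List ℕ)
  tuples zero    = [] ∷ []
  tuples (suc r) = concatMap (λ i → map (i ∷_) (tuples r)) (upTo k)

  ∑-concatMap : ∀ {A B : Set} (f : A → List B) xs (g : B → ℕ) → ∑ (concatMap f xs) g ≡ ∑ xs (λ x → ∑ (f x) g)
  ∑-concatMap f []       g = refl
  ∑-concatMap f (x ∷ xs) g = trans (∑-++ (f x) (concatMap f xs) g) (cong (∑ (f x) g +_) (∑-concatMap f xs g))

  ∑-tuples : ∀ r (f : List ℕ → ℕ) → ∑ (tuples (suc r)) f ≡ ∑< k (λ i → ∑ (tuples r) (λ e → f (i ∷ e)))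
  ∑-tuples r f = trans (∑-concatMap (λ i → map (i ∷_) (tuples r)) (upTo k) f) (∑<-cong k (λ i _ → ∑-map (i ∷_) (tuples r) f))

  dot : List ℕ → List ℕ → ℕ
  dot (e ∷ es) (t ∷ ts) = e * t + dot es ts
  dot _        _        = 0

  Trivial : List ℕ → Set
  Trivial = All (λ t → t % k ≡ 0)

  trivial? : ∀ ts → Dec (Trivial ts)
  trivial? = All.all? (λ t → t % k ≟ 0)

  private
    regroup : ∀ c x y → c + (x + y) ≡ c + x + y
    regroup c x y = sym (+-assoc c x y)

  sum-trivial : ∀ ts → Trivial ts → ∀ c → ∑ (tuples (length ts)) (λ e → weight (c + dot e ts)) ≡ k ^ length ts * weight c
  sum-trivial [] [] c = trans (+-identityʳ _) (trans (cong weight (+-identityʳ c)) (sym (+-identityʳ (weight c))))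
  sum-trivial (t ∷ ts) (t≡0 ∷ triv) c = begin
    ∑ (tuples (suc (length ts))) (λ e → weight (c + dot e (t ∷ ts)))        ≡⟨ ∑-tuples (length ts) _ ⟩
    ∑< k (λ i → ∑ (tuples (length ts)) (λ e → weight (c + (i * t + dot e ts)))) ≡⟨ ∑<-cong k (λ i _ → trans (∑-cong (tuples (length ts)) (λ {e} _ → cong weight (regroup c (i * t) (dot e ts)))) (sum-trivial ts triv (c + i * t))) ⟩
    ∑< k (λ i → k ^ length ts * weight (c + i * t))                         ≡⟨ ∑<-cong k (λ i _ → cong (k ^ length ts *_) (weight-periodic (it i))) ⟩
    ∑< k (λ i → k ^ length ts * weight c)                                   ≡⟨ ∑<-const k _ ⟩
    k * (k ^ length ts * weight c)                                          ≡⟨ *-assoc k (k ^ length ts) (weight c) ⟨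
    k ^ suc (length ts) * weight c                                          ∎
    where
    open ≡.≡-Reasoning
    it : ∀ i → (c + i * t) % k ≡ c % k
    it i = DM.%-remove-+ʳ c (Div.∣n⇒∣m*n i (Div.m%n≡0⇒n∣m t k t≡0))

  -- The last nontrivial coordinate does the averaging: the coordinates after it shift nothing
  -- modulo `k`, and those before it only change the starting point `c`, for which the statement is
  -- kept general.
  sum-nontrivial : ∀ ts → ¬ Trivial ts → ∀ c → ∑ (tuples (length ts)) (λ e → weight (c + dot e ts)) ≡ k ^ length ts
  sum-nontrivial [] nt c = ⊥-elim (nt [])
  sum-nontrivial (t ∷ ts) nt c = trans (∑-tuples (length ts) _)
    (trans (∑<-cong k (λ i _ → ∑-cong (tuples (length ts)) (λ {e} _ → cong weight (regroup c (i * t) (dot e ts))))) (helper (trivial? ts)))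
    where
    open ≡.≡-Reasoning
    helper : Dec (Trivial ts) → ∑< k (λ i → ∑ (tuples (length ts)) (λ e → weight (c + i * t + dot e ts))) ≡ k ^ suc (length ts)
    helper (no nt′) = trans (∑<-cong k (λ i _ → sum-nontrivial ts nt′ (c + i * t))) (∑<-const k _)
    helper (yes triv) = begin
      ∑< k (λ i → ∑ (tuples (length ts)) (λ e → weight (c + i * t + dot e ts))) ≡⟨ ∑<-cong k (λ i _ → sum-trivial ts triv (c + i * t)) ⟩
      ∑< k (λ i → k ^ length ts * weight (c + i * t)) ≡⟨ ∑-*ˡ (upTo k) (k ^ length ts) (λ i → weight (c + i * t)) ⟩
      k ^ length ts * ∑< k (λ i → weight (c + i * t)) ≡⟨ cong (k ^ length ts *_) (weight-progression (λ t≡0 → nt (t≡0 ∷ triv)) c) ⟩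
      k ^ length ts * k                               ≡⟨ *-comm (k ^ length ts) k ⟩
      k ^ suc (length ts)                             ∎

∑-fibres : ∀ {A : Set} n (f : A → ℕ) (w : ℕ → ℕ) xs → (∀ x → f x < n) →
           ∑ xs (w ∘ f) ≡ ∑< n (λ v → w v * length (fibre f xs v))
∑-fibres n f w xs f<n = sym (begin
  ∑< n (λ v → w v * length (fibre f xs v))          ≡⟨ ∑<-cong n (λ v _ → trans (cong (w v *_) (length-fibre f xs v)) (sym (∑-*ˡ xs (w v) _))) ⟩
  ∑< n (λ v → ∑ xs (λ x → w v * ⟦ f x ≟ v ⟧))       ≡⟨ ∑-swap (upTo n) xs _ ⟩
  ∑ xs (λ x → ∑< n (λ v → w v * ⟦ f x ≟ v ⟧))       ≡⟨ ∑-cong xs (λ {x} _ → trans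
     (∑<-single n _ (f x) (f<n x) (λ i _ i≢ → trans (cong (w i *_) (⟦⟧-no (i≢ ∘ sym))) (*-zeroʳ (w i))))
     (trans (cong (w (f x) *_) (⟦⟧-yes refl)) (*-identityʳ _))) ⟩
  ∑ xs (w ∘ f)                                      ∎)
  where open ≡.≡-Reasoning

divide-all : ∀ {δ} es → All (δ ∣_) es → ∃[ es′ ] (es ≡ map (_* δ) es′)
divide-all []       []                    = [] , refl
divide-all (e ∷ es) (divides t eq ∷ divs) = let es′ , eq′ = divide-all es divs in t ∷ es′ , cong₂ _∷_ eq eq′

gcdAll : ℕ → List ℕ → ℕ
gcdAll = foldr gcd

gcdAll-∣ : ∀ k es → gcdAll k es ∣ k × All (gcdAll k es ∣_) es
gcdAll-∣ k []       = Div.∣-refl , []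
gcdAll-∣ k (e ∷ es) = let δ∣k , δ∣es = gcdAll-∣ k es
                          G∣ = GCD.gcd[m,n]∣n e (gcdAll k es)
                      in Div.∣-trans G∣ δ∣k , GCD.gcd[m,n]∣m e (gcdAll k es) ∷ All.map (Div.∣-trans G∣) δ∣es

gcdAll-greatest : ∀ {d} k es → d ∣ k → All (d ∣_) es → d ∣ gcdAll k es
gcdAll-greatest k []       d∣k []          = d∣k
gcdAll-greatest k (e ∷ es) d∣k (d∣e ∷ d∣es) = GCD.gcd-greatest d∣e (gcdAll-greatest k es d∣k d∣es)

-- Points at which all characters are trivial

module Inversion {q : ℕ} (F : FiniteField q) (g : FiniteField.Carrier F) (isGen : IsGenerator F g)
  (s₀ : FiniteField.Carrier F) (S′ : List (FiniteField.Carrier F)) (S-unique : Unique (s₀ ∷ S′)) (r k′ z : ℕ)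
  (length-S′ : length S′ ≡ r) (1≤r : 1 ≤ r) (1≤k′ : 1 ≤ k′)
  (I≡ : suc r * suc k′ ^ suc r ≡ suc (r + z)) (k∣N : suc k′ ∣ q ∸ 1)
  (big : (suc k′ * k′ * suc (r + z)) * (suc k′ * k′ * suc (r + z)) ≤ q ∸ 1) where

  open FiniteField F using (Carrier)
  open FieldFacts.Generator F g isGen using (1+N≡q; ind)
  open FieldTheory F using (_-_)
  open Characters F g isGen using (Points; χ)
  open Parameters r k′ z
  open Weight k
  open Equidistribution F g isGen (s₀ ∷ S′) S-unique r k′ z (cong suc length-S′) 1≤r 1≤k′ I≡ k∣N big

  -- As `k′` acts as -1 modulo `k`, the entries are the differences of the classes of x - s and x -
  -- s₀; the points sought are those where all of them vanish.
  τ : Carrier → List ℕ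
  τ x = map (λ s → ind (x - s) + k′ * ind (x - s₀)) S′

  length-τ : ∀ x → length (τ x) ≡ r
  length-τ x = trans (Listₚ.length-map _ S′) length-S′

  -- The exponent at s₀ represents minus the sum of the others, so that `χ` becomes the pairing of
  -- `e` with `τ x`.
  points : List ℕ → Points
  points e = (s₀ , k′ * sum e) ∷ zip S′ e

  proj₁-zip : ∀ {A : Set} (ss : List A) (e : List ℕ) → length e ≡ length ss → map proj₁ (zip ss e) ≡ ss
  proj₁-zip []       []      _  = refl
  proj₁-zip (s ∷ ss) (_ ∷ e) eq = cong (s ∷_) (proj₁-zip ss e (suc-injective eq))

  χ≡dot : ∀ e x → length e ≡ r → χ (points e) x ≡ dot e (τ x)
  χ≡dot e x len = go S′ e (trans len (sym length-S′))
    where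
    i₀ = ind (x - s₀)
    go : ∀ ss e → length e ≡ length ss → k′ * sum e * i₀ + χ (zip ss e) x ≡ dot e (map (λ s → ind (x - s) + k′ * i₀) ss)
    go []       []       _  = trans (+-identityʳ _) (cong (_* i₀) (*-zeroʳ k′))
    go (s ∷ ss) (e ∷ es) eq = trans (arith k′ e (sum es) i₀ (ind (x - s)) (χ (zip ss es) x)) (cong (e * (ind (x - s) + k′ * i₀) +_) (go ss es (suc-injective eq)))
      where
      arith : ∀ k′ e s i j c → k′ * (e + s) * i + (e * j + c) ≡ e * (j + k′ * i) + (k′ * s * i + c)
      arith = solve-∀

  dot-scale : ∀ δ e t → dot (map (_* δ) e) t ≡ δ * dot e t
  dot-scale δ []       t        = sym (*-zeroʳ δ)
  dot-scale δ (e ∷ es) []       = sym (*-zeroʳ δ)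
  dot-scale δ (e ∷ es) (t ∷ ts) = trans (cong (e * δ * t +_) (dot-scale δ es ts)) (arith e δ t (dot es ts))
    where
    arith : ∀ e δ t x → e * δ * t + δ * x ≡ δ * (e * t + x)
    arith = solve-∀

  tuple-spec : ∀ r {e} → e ∈ tuples r → length e ≡ r × All (_< k) e
  tuple-spec zero    (here refl) = refl , []
  tuple-spec (suc r) e∈ with find (∈-concatMap⁻ (λ i → map (i ∷_) (tuples r)) {xs = upTo k} e∈)
  ... | i , i∈ , e∈′ with ∈-map⁻ (i ∷_) e∈′
  ... | e′ , e′∈ , refl = let len , small = tuple-spec r e′∈ in cong suc len , ∈-upTo⁻ i∈ ∷ small

  zero? : ∀ e → Dec (All (_≡ 0) e)
  zero? = All.all? (_≟ 0)

  -- Dividing e by δ, its common divisor with `k`, gives a character to which `uniform` applies with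
  -- order o = k / δ. All its classes obey the same bound, and the weights at the multiples of δ
  -- have mean 1, so the weighted sum obeys the bound for the plain number of points.
  nonzero-bound : ∀ {e} → e ∈ tuples r → ¬ All (_≡ 0) e → a * ∑ Out (λ x → weight (dot e (τ x))) ≤ q * b
  nonzero-bound {e} e∈ e≢0 with gcdAll-∣ k e
  ... | divides o k≡oδ , δ∣e with divide-all e δ∣e
  ... | e′ , e≡ = *-cancelˡ-≤ o (begin
    o * (a * ∑ Out (λ x → weight (dot e (τ x))))          ≡⟨ cong (λ s → o * (a * s)) (∑-cong Out (λ {x} _ → reduce x)) ⟩
    o * (a * ∑ Out (λ x → weight (χ L x % o * δ)))        ≡⟨ cong (λ s → o * (a * s)) (∑-fibres o (λ x → χ L x % o) (λ v → weight (v * δ)) Out (λ x → DM.m%n<n (χ L x) o)) ⟩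
    o * (a * ∑< o (λ v → weight (v * δ) * n v))           ≡⟨ trans (sym (*-assoc o a _)) (sym (∑-*ˡ (upTo o) (o * a) _)) ⟩
    ∑< o (λ v → o * a * (weight (v * δ) * n v))           ≡⟨ ∑<-cong o (λ v _ → arith o a (weight (v * δ)) (n v)) ⟩
    ∑< o (λ v → weight (v * δ) * (o * n v * a))           ≤⟨ ∑<-mono o (λ v _ → *-monoʳ-≤ (weight (v * δ)) (C.uniform o o∣k faithful v)) ⟩
    ∑< o (λ v → weight (v * δ) * (q * b))                 ≡⟨ ∑-*ʳ (upTo o) (q * b) (λ v → weight (v * δ)) ⟩
    ∑< o (λ v → weight (v * δ)) * (q * b)                 ≡⟨ cong (_* (q * b)) weights ⟩
    o * (q * b)                                           ∎)
    where
    open ≤-Reasoning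
    δ = gcdAll k e
    L = points e′
    instance
      o-nonZero : NonZero o
      o-nonZero = ℕ.≢-nonZero λ { refl → ℕ.≢-nonZero⁻¹ k k≡oδ }
      δ-nonZero : NonZero δ
      δ-nonZero = ℕ.≢-nonZero λ δ≡0 → ℕ.≢-nonZero⁻¹ k (trans k≡oδ (trans (cong (o *_) δ≡0) (*-zeroʳ o)))
    o∣k : o ∣ k
    o∣k = divides δ (trans k≡oδ (*-comm o δ))
    length-e′ : length e′ ≡ r
    length-e′ = trans (sym (Listₚ.length-map (_* δ) e′)) (trans (cong length (sym e≡)) (proj₁ (tuple-spec r e∈)))
    module C = Character L (cong (s₀ ∷_) (proj₁-zip S′ e′ (trans length-e′ (sym length-S′))))
    n : ℕ → ℕ
    n v = length (C.class o v)
    arith : ∀ o a w n → o * a * (w * n) ≡ w * (o * n * a)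
    arith = solve-∀
    reduce : ∀ x → weight (dot e (τ x)) ≡ weight (χ L x % o * δ)
    reduce x = trans (cong weight (begin-equality
      dot e (τ x)                                     ≡⟨ cong (λ e → dot e (τ x)) e≡ ⟩
      dot (map (_* δ) e′) (τ x)                       ≡⟨ dot-scale δ e′ (τ x) ⟩
      δ * dot e′ (τ x)                                ≡⟨ cong (δ *_) (χ≡dot e′ x length-e′) ⟨
      δ * c                                           ≡⟨ cong (δ *_) (DM.m≡m%n+[m/n]*n c o) ⟩
      δ * (c % o + c / o * o)                         ≡⟨ h δ (c % o) (c / o) o ⟩
      c % o * δ + c / o * (o * δ)                     ≡⟨ cong (λ k → c % o * δ + c / o * k) k≡oδ ⟨
      c % o * δ + c / o * k                           ∎)) (weight-+* (c % o * δ) (c / o))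
      where
      c = χ L x
      h : ∀ δ x y o → δ * (x + y * o) ≡ x * δ + y * (o * δ)
      h = solve-∀
    δ<k : δ < k
    δ<k = go e δ∣e (proj₂ (tuple-spec r e∈)) e≢0
      where
      go : ∀ es → All (δ ∣_) es → All (_< k) es → ¬ All (_≡ 0) es → δ < k
      go []       []          []          ≢0 = ⊥-elim (≢0 [])
      go (zero ∷ es)  (_ ∷ ds)   (_ ∷ ls)    ≢0 = go es ds ls (≢0 ∘ (refl ∷_))
      go (suc e ∷ es) (δ∣e ∷ _) (e<k ∷ _)   ≢0 = ≤-<-trans (Div.∣⇒≤ δ∣e) e<k
    weights : ∑< o (λ v → weight (v * δ)) ≡ o
    weights = *-cancelˡ-≡ _ _ δ (begin-equality
      δ * ∑< o (λ v → weight (v * δ))                       ≡⟨ ∑<-const δ _ ⟨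
      ∑< δ (λ j → ∑< o (λ v → weight (v * δ)))              ≡⟨ ∑<-cong δ (λ j _ → ∑<-cong o (λ v _ → sym (trans (cong weight (trans (h j o v δ) (cong (λ k → v * δ + j * k) (sym k≡oδ)))) (weight-+* (v * δ) j)))) ⟩
      ∑< δ (λ j → ∑< o (λ v → weight ((j * o + v) * δ)))    ≡⟨ ∑<-* δ o (λ i → weight (i * δ)) ⟨
      ∑< (δ * o) (λ i → weight (i * δ))                     ≡⟨ cong (λ k → ∑< k (λ i → weight (i * δ))) (trans (*-comm δ o) (sym k≡oδ)) ⟩
      ∑< k (λ i → weight (0 + i * δ))                       ≡⟨ weight-progression (λ e → ℕ.≢-nonZero⁻¹ δ (trans (sym (DM.m<n⇒m%n≡m δ<k)) e)) 0 ⟩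
      k                                                     ≡⟨ trans k≡oδ (*-comm o δ) ⟩
      δ * o                                                 ∎)
      where
      h : ∀ j o v δ → (j * o + v) * δ ≡ v * δ + j * (o * δ)
      h = solve-∀
    -- Were all entries of e′ divisible by ℓ, then ℓ δ would be a common divisor of `k` and all of
    -- e, contrary to the choice of δ.
    faithful : ∀ {ℓ} → Prime ℓ → ℓ ∣ o → ∃[ s ] ∃[ e ] ((s , e) ∈ L × ℓ ∤ e)
    faithful {ℓ} pℓ ℓ∣o with Any.any? (λ (s , e) → ¬? (ℓ ∣? e)) (zip S′ e′)
    ... | yes any = let (s , e) , s∈ , ∤ = find any in s , e , there s∈ , ∤
    ... | no none = ⊥-elim (ℕ.nonTrivial⇒≢1 {{prime⇒nonTrivial pℓ}} (Div.∣1⇒≡1 (Div.*-cancelʳ-∣ δ (subst (ℓ * δ ∣_) (sym (+-identityʳ δ))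
            (gcdAll-greatest k e (subst (ℓ * δ ∣_) (sym k≡oδ) (Div.*-monoˡ-∣ δ ℓ∣o))
              (subst (All (ℓ * δ ∣_)) (sym e≡) (Allₚ.map⁺ (All.map (Div.*-monoˡ-∣ δ) (all S′ e′ (trans length-e′ (sym length-S′)) none)))))))))
      where
      all : ∀ (ss : List Carrier) es → length es ≡ length ss → ¬ Any (λ (s , e) → ℓ ∤ e) (zip ss es) → All (ℓ ∣_) es
      all []       []       _  _    = []
      all (s ∷ ss) (e ∷ es) eq none with ℓ ∣? e
      ... | yes ℓ∣e = ℓ∣e ∷ all ss es (suc-injective eq) (none ∘ there)
      ... | no  ℓ∤e = ⊥-elim (none (here ℓ∤e))

  good? : ∀ x → Dec (Trivial (τ x))
  good? x = trivial? (τ x)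

  Good : List Carrier
  Good = filter good? Out

  K : ℕ
  K = k ^ r

  dot-zero : ∀ e t → All (_≡ 0) e → dot e t ≡ 0
  dot-zero []       t        []           = refl
  dot-zero (e ∷ es) []       _            = refl
  dot-zero (e ∷ es) (t ∷ ts) (refl ∷ e≡0) = dot-zero es ts e≡0

  -- Double counting of the weights over all characters and all points.
  inversion : K * a * length Out + q * b ≤ K * (q * b) + K * a * length Good
  inversion = begin
    K * a * length Out + q * b
      ≡⟨ cong (_+ q * b) (trans (cong (K * a *_) (sym (trans (∑ℕ-const Out 1) (*-identityʳ _)))) (h₁ (∑ Out (λ _ → 1)))) ⟩
    a * (K * ∑ Out (λ _ → 1)) + q * b
      ≡⟨ cong (λ x → a * x + q * b) (sym (∑-*ˡ Out K (λ _ → 1))) ⟩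
    a * ∑ Out (λ _ → K * 1) + q * b
      ≡⟨ cong (λ x → a * x + q * b) (∑-cong Out (λ {x} _ → sym (split x))) ⟩
    a * ∑ Out (λ x → ∑ (tuples r) (λ e → weight (dot e (τ x))) + K * ⟦ good? x ⟧) + q * b
      ≡⟨ cong (λ x → a * x + q * b) (∑-+ Out _ (λ x → K * ⟦ good? x ⟧)) ⟩
    a * (∑ Out (λ x → ∑ (tuples r) (λ e → weight (dot e (τ x)))) + ∑ Out (λ x → K * ⟦ good? x ⟧)) + q * b
      ≡⟨ cong₂ (λ u v → a * (u + v) + q * b) (∑-swap Out (tuples r) _) (trans (∑-*ˡ Out K _) (cong (K *_) (sym (length-filter good? Out)))) ⟩
    a * (∑ (tuples r) (λ e → ∑ Out (λ x → weight (dot e (τ x)))) + K * length Good) + q * b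
      ≡⟨ h₂ (∑ (tuples r) (λ e → ∑ Out (λ x → weight (dot e (τ x))))) (length Good) ⟩
    a * ∑ (tuples r) (λ e → ∑ Out (λ x → weight (dot e (τ x)))) + q * b + K * a * length Good
      ≡⟨ cong (λ x → x + q * b + K * a * length Good) (∑-*ˡ (tuples r) a _) ⟨
    ∑ (tuples r) (λ e → a * ∑ Out (λ x → weight (dot e (τ x)))) + q * b + K * a * length Good
      ≤⟨ +-monoˡ-≤ (K * a * length Good) characters ⟩
    K * (q * b) + K * a * length Good ∎
    where
    open ≤-Reasoning
    h₁ : ∀ x → K * a * x ≡ a * (K * x)
    h₁ x = h K a x
      where
      h : ∀ K a x → K * a * x ≡ a * (K * x)
      h = solve-∀
    h₂ : ∀ x y → a * (x + K * y) + q * b ≡ a * x + q * b + K * a * y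
    h₂ x y = h a x K y (q * b)
      where
      h : ∀ a x K y w → a * (x + K * y) + w ≡ a * x + w + K * a * y
      h = solve-∀
    split : ∀ x → ∑ (tuples r) (λ e → weight (dot e (τ x))) + K * ⟦ good? x ⟧ ≡ K * 1
    split x = subst (λ r → ∑ (tuples r) (λ e → weight (dot e (τ x))) + k ^ r * ⟦ good? x ⟧ ≡ k ^ r * 1) (length-τ x) (go (good? x))
      where
      go : (d : Dec (Trivial (τ x))) → ∑ (tuples (length (τ x))) (λ e → weight (dot e (τ x))) + k ^ length (τ x) * ⟦ d ⟧ ≡ k ^ length (τ x) * 1
      go (yes triv) = cong (_+ k ^ length (τ x) * 1) (trans (sum-trivial (τ x) triv 0) (trans (cong (k ^ length (τ x) *_) weight-0) (*-zeroʳ (k ^ length (τ x)))))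
      go (no  nt)   = trans (cong₂ _+_ (sum-nontrivial (τ x) nt 0) (*-zeroʳ (k ^ length (τ x)))) (trans (+-identityʳ _) (sym (*-identityʳ _)))
    zeros : ∀ r → 1 ≤ ∑ (tuples r) (λ e → ⟦ zero? e ⟧)
    zeros zero    = s≤s z≤n
    zeros (suc r) = begin
      1                                                     ≤⟨ zeros r ⟩
      ∑ (tuples r) (λ e → ⟦ zero? e ⟧)                      ≡⟨ ∑-cong (tuples r) (λ {e} _ → ⟦⟧-cong {P? = zero? e} {zero? (0 ∷ e)} (refl ∷_) All.tail) ⟩
      ∑ (tuples r) (λ e → ⟦ zero? (0 ∷ e) ⟧)                ≤⟨ m≤m+n _ _ ⟩
      ∑ (tuples r) (λ e → ⟦ zero? (0 ∷ e) ⟧) + ∑< k′ (λ i → ∑ (tuples r) (λ e → ⟦ zero? (suc i ∷ e) ⟧)) ≡⟨ ∑<-suc k′ (λ i → ∑ (tuples r) (λ e → ⟦ zero? (i ∷ e) ⟧)) ⟨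
      ∑< k (λ i → ∑ (tuples r) (λ e → ⟦ zero? (i ∷ e) ⟧))   ≡⟨ ∑-tuples r _ ⟨
      ∑ (tuples (suc r)) (λ e → ⟦ zero? e ⟧)                ∎
    tuples-count : ∀ r → ∑ (tuples r) (λ _ → 1) ≡ k ^ r
    tuples-count zero    = refl
    tuples-count (suc r) = trans (∑-tuples r _) (trans (∑<-cong k (λ _ _ → tuples-count r)) (∑<-const k (k ^ r)))
    -- The zero tuple has weight 0 at every point; the q b that it saves is the entire gain of the
    -- argument.
    characters : ∑ (tuples r) (λ e → a * ∑ Out (λ x → weight (dot e (τ x)))) + q * b ≤ K * (q * b)
    characters = begin
      ∑ (tuples r) (λ e → a * ∑ Out (λ x → weight (dot e (τ x)))) + q * b
        ≤⟨ +-monoʳ-≤ _ (≤-trans (≤-reflexive (sym (+-identityʳ (q * b)))) (*-monoˡ-≤ (q * b) (zeros r))) ⟩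
      ∑ (tuples r) (λ e → a * ∑ Out (λ x → weight (dot e (τ x)))) + ∑ (tuples r) (λ e → ⟦ zero? e ⟧) * (q * b)
        ≡⟨ cong (∑ (tuples r) (λ e → a * ∑ Out (λ x → weight (dot e (τ x)))) +_) (∑-*ʳ (tuples r) (q * b) _) ⟨
      ∑ (tuples r) (λ e → a * ∑ Out (λ x → weight (dot e (τ x)))) + ∑ (tuples r) (λ e → ⟦ zero? e ⟧ * (q * b))
        ≡⟨ ∑-+ (tuples r) _ _ ⟨
      ∑ (tuples r) (λ e → a * ∑ Out (λ x → weight (dot e (τ x))) + ⟦ zero? e ⟧ * (q * b))
        ≤⟨ ∑-mono (tuples r) (λ {e} e∈ → bound e∈) ⟩
      ∑ (tuples r) (λ _ → 1 * (q * b))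
        ≡⟨ trans (∑-*ʳ (tuples r) (q * b) (λ _ → 1)) (cong (_* (q * b)) (tuples-count r)) ⟩
      K * (q * b) ∎
      where
      bound : ∀ {e} → e ∈ tuples r → a * ∑ Out (λ x → weight (dot e (τ x))) + ⟦ zero? e ⟧ * (q * b) ≤ 1 * (q * b)
      bound {e} e∈ with zero? e
      ... | yes e≡0 = ≤-reflexive (cong (_+ 1 * (q * b)) (trans (cong (a *_) (∑-zero Out (λ {x} _ → trans (cong weight (dot-zero e (τ x) e≡0)) weight-0))) (*-zeroʳ a)))
      ... | no  e≢0 = ≤-trans (≤-reflexive (+-identityʳ _)) (≤-trans (nonzero-bound e∈ e≢0) (≤-reflexive (sym (+-identityʳ (q * b)))))

  -- `inversion` amounts to q ≤ I (d + |Good|), because a ≤ k I. The summand 3 leaves more than k³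
  -- points after 0 and 1 are removed.
  many-good : k * k * k + 3 ≤ length Good
  many-good = ≮⇒≥ λ G< → <⇒≱ (≤-trans (s≤s big) (≤-reflexive 1+N≡q)) (few G<)
    where
    open ≤-Reasoning
    d c P : ℕ
    d = suc r
    c = k * d + r * k′
    P = k * K
    b≡ : b ≡ a + c
    b≡ = h k r z k′
      where
      h : ∀ k r z k′ → k * suc (r + z) + r * k′ ≡ k * z + (k * suc r + r * k′)
      h = solve-∀
    -- I = d k^d is chosen for this: the errors of k^r characters and the gain together cost at most
    -- 2 d k^d, which is covered by k I as k ≥ 2.
    main : K * c + P ≤ a + c
    main = begin
      K * (k * d + r * k′) + P              ≡⟨ h₁ K k d r k′ P ⟩
      P * d + (r * (K * k′) + P)            ≤⟨ +-monoʳ-≤ (P * d) (+-monoˡ-≤ P (*-monoʳ-≤ r (≤-trans (*-monoʳ-≤ K (n≤1+n k′)) (≤-reflexive (*-comm K k))))) ⟩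
      P * d + (r * P + P)                   ≡⟨ h₂ P r ⟩
      2 * (d * P)                           ≤⟨ *-monoˡ-≤ (d * P) (s≤s 1≤k′) ⟩
      k * (d * P)                           ≡⟨ cong (k *_) I≡ ⟩
      k * suc (r + z)                       ≤⟨ m≤m+n _ (r * k′) ⟩
      b                                     ≡⟨ b≡ ⟩
      a + c                                 ∎
      where
      h₁ : ∀ K k d r k′ P → K * (k * d + r * k′) + P ≡ k * K * d + (r * (K * k′) + P)
      h₁ = solve-∀
      h₂ : ∀ P r → P * suc r + (r * P + P) ≡ 2 * (suc r * P)
      h₂ = solve-∀
    few : length Good < k * k * k + 3 → q ≤ (k * k′ * I) * (k * k′ * I)
    few G< = *-cancelˡ-≤ P {{m*n≢0 k K {{_}} {{m^n≢0 k r}}}} (begin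
      P * q                                  ≤⟨ +-cancelˡ-≤ (K * a * q + K * (q * c)) _ _ bounded ⟩
      K * a * (d + length Good)              ≤⟨ *-mono-≤ (*-monoʳ-≤ K (*-monoʳ-≤ k (≤-trans (m≤n+m z r) (n≤1+n _)))) (+-monoʳ-≤ d (≤-pred (≤-trans G< (≤-reflexive (+-suc (k * k * k) 2))))) ⟩
      K * (k * I) * (d + (k * k * k + 2))    ≡⟨ h₁ K k I (d + (k * k * k + 2)) ⟩
      P * (I * (d + (k * k * k + 2)))        ≤⟨ *-monoʳ-≤ P (*-monoʳ-≤ I small) ⟩
      P * (I * (k * k * I))                  ≤⟨ *-monoʳ-≤ P last ⟩
      P * ((k * k′ * I) * (k * k′ * I))      ∎)
      where
      h₁ : ∀ K k I x → K * (k * I) * x ≡ k * K * (I * x)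
      h₁ = solve-∀
      bounded : K * a * q + K * (q * c) + P * q ≤ K * a * q + K * (q * c) + K * a * (d + length Good)
      bounded = begin
        K * a * q + K * (q * c) + P * q     ≡⟨ h₂ (K * a * q) K q c P ⟩
        K * a * q + q * (K * c + P)         ≤⟨ +-monoʳ-≤ (K * a * q) (*-monoʳ-≤ q main) ⟩
        K * a * q + q * (a + c)             ≤⟨ +-monoˡ-≤ (q * (a + c)) (*-monoʳ-≤ (K * a) q≤Out+d) ⟩
        K * a * (length Out + d) + q * (a + c) ≡⟨ cong (λ x → K * a * (length Out + d) + q * x) (sym b≡) ⟩
        K * a * (length Out + d) + q * b    ≡⟨ h₃ (K * a) (length Out) d (q * b) ⟩
        K * a * d + (K * a * length Out + q * b) ≤⟨ +-monoʳ-≤ (K * a * d) inversion ⟩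
        K * a * d + (K * (q * b) + K * a * length Good) ≡⟨ cong (λ x → K * a * d + (K * (q * x) + K * a * length Good)) b≡ ⟩
        K * a * d + (K * (q * (a + c)) + K * a * length Good) ≡⟨ h₄ K a d q c (length Good) ⟩
        K * a * q + K * (q * c) + K * a * (d + length Good) ∎
        where
        h₂ : ∀ x K q c P → x + K * (q * c) + P * q ≡ x + q * (K * c + P)
        h₂ = solve-∀
        h₃ : ∀ x y d w → x * (y + d) + w ≡ x * d + (x * y + w)
        h₃ = solve-∀
        h₄ : ∀ K a d q c x → K * a * d + (K * (q * (a + c)) + K * a * x) ≡ K * a * q + K * (q * c) + K * a * (d + x)
        h₄ = solve-∀
      k≥2 : 2 ≤ k
      k≥2 = s≤s 1≤k′
      -- k³ + 2 ≤ k⁴ and k² I = d k^(d+2) ≥ d k⁴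
      small : d + (k * k * k + 2) ≤ k * k * I
      small = begin
        d + (k * k * k + 2)             ≤⟨ +-monoʳ-≤ d (+-monoʳ-≤ (k * k * k) (≤-trans k≥2 (≤-trans (m≤m*n k k) (m≤m*n (k * k) k)))) ⟩
        d + (k * k * k + k * k * k)     ≡⟨ cong (d +_) (h (k * k * k)) ⟩
        d + 2 * (k * k * k)             ≤⟨ +-monoʳ-≤ d (≤-trans (*-monoˡ-≤ (k * k * k) k≥2) (≤-reflexive (h′ k))) ⟩
        d + x                           ≤⟨ +-monoˡ-≤ x (≤-trans (+-monoˡ-≤ r 1≤r) (≤-trans (≤-reflexive (h₂ r)) (*-monoʳ-≤ r (≤-trans k≥2 (≤-trans (m≤m*n k k) (m≤m*n (k * k) (k * k))))))) ⟩
        r * x + x                       ≡⟨ +-comm (r * x) x ⟩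
        d * x                           ≡⟨ h₃ d k ⟩
        k * k * (d * (k * k))           ≤⟨ *-monoʳ-≤ (k * k) (*-monoʳ-≤ d (*-monoʳ-≤ k (≤-trans (≤-reflexive (sym (*-identityʳ k))) (^-monoʳ-≤ k 1≤r)))) ⟩
        k * k * (d * k ^ d)             ≡⟨ cong (k * k *_) I≡ ⟩
        k * k * I                       ∎
        where
        x = k * k * (k * k)
        h : ∀ y → y + y ≡ 2 * y
        h = solve-∀
        h′ : ∀ k → k * (k * k * k) ≡ k * k * (k * k)
        h′ = solve-∀
        h₂ : ∀ r → r + r ≡ r * 2
        h₂ = solve-∀
        h₃ : ∀ d k → d * (k * k * (k * k)) ≡ k * k * (d * (k * k))
        h₃ = solve-∀
      last : I * (k * k * I) ≤ (k * k′ * I) * (k * k′ * I)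
      last = begin
        I * (k * k * I)                 ≡⟨ h k I ⟩
        (k * I) * (k * I)               ≤⟨ *-mono-≤ kI≤ kI≤ ⟩
        (k * k′ * I) * (k * k′ * I)     ∎
        where
        h : ∀ k I → I * (k * k * I) ≡ (k * I) * (k * I)
        h = solve-∀
        kI≤ : k * I ≤ k * k′ * I
        kI≤ = *-monoˡ-≤ I (m≤m*n k k′ {{ℕ.>-nonZero 1≤k′}})

-- The condition on q₀

private
  fromℕᵘ : ℕ → ℚᵘ.ℚᵘ
  fromℕᵘ n = ℚᵘ.mkℚᵘ (ℤ.+ n) 0

  toℚᵘ-fromℕ : ∀ n → ℚ.toℚᵘ (fromℕ n) ℚᵘ.≃ fromℕᵘ n
  toℚᵘ-fromℕ n = ℚₚ.toℚᵘ-fromℚᵘ (fromℕᵘ n)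

fromℕ-+ : ∀ m n → fromℕ (m + n) ≡ fromℕ m ℚ.+ fromℕ n
fromℕ-+ m n = ℚₚ.toℚᵘ-injective (ℚᵘₚ.≃-trans (toℚᵘ-fromℕ (m + n)) (ℚᵘₚ.≃-trans
  (ℚᵘ.*≡* (cong (ℤ._* ℤ.1ℤ) (trans (ℤₚ.pos-+ m n) (sym (cong₂ ℤ._+_ (ℤₚ.*-identityʳ (ℤ.+ m)) (ℤₚ.*-identityʳ (ℤ.+ n)))))))
  (ℚᵘₚ.≃-sym (ℚᵘₚ.≃-trans (ℚₚ.toℚᵘ-homo-+ (fromℕ m) (fromℕ n)) (ℚᵘₚ.+-cong (toℚᵘ-fromℕ m) (toℚᵘ-fromℕ n))))))

fromℕ-* : ∀ m n → fromℕ (m * n) ≡ fromℕ m ℚ.* fromℕ n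
fromℕ-* m n = ℚₚ.toℚᵘ-injective (ℚᵘₚ.≃-trans (toℚᵘ-fromℕ (m * n)) (ℚᵘₚ.≃-trans
  (ℚᵘ.*≡* (cong (ℤ._* ℤ.1ℤ) (ℤₚ.pos-* m n)))
  (ℚᵘₚ.≃-sym (ℚᵘₚ.≃-trans (ℚₚ.toℚᵘ-homo-* (fromℕ m) (fromℕ n)) (ℚᵘₚ.*-cong (toℚᵘ-fromℕ m) (toℚᵘ-fromℕ n))))))

fromℕ-cancel-< : ∀ {m n} → fromℕ m ℚ.< fromℕ n → m < n
fromℕ-cancel-< {m} {n} lt with ℚᵘₚ.<-respˡ-≃ (toℚᵘ-fromℕ m) (ℚᵘₚ.<-respʳ-≃ (toℚᵘ-fromℕ n) (ℚₚ.toℚᵘ-mono-< lt))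
... | ℚᵘ.*<* p = ℤₚ.drop‿+<+ (subst₂ ℤ._<_ (ℤₚ.*-identityʳ (ℤ.+ m)) (ℤₚ.*-identityʳ (ℤ.+ n)) p)

fromℕ-nonneg : ∀ n → 0ℚ ℚ.≤ fromℕ n
fromℕ-nonneg n = ℚₚ.toℚᵘ-cancel-≤ (ℚᵘₚ.≤-respʳ-≃ (ℚᵘₚ.≃-sym (toℚᵘ-fromℕ n)) (ℚᵘ.*≤* (subst (ℤ.0ℤ ℤ.≤_) (sym (ℤₚ.*-identityʳ (ℤ.+ n))) (ℤ.+≤+ z≤n))))

fromℕ-pos : ∀ n .{{_ : NonZero n}} → ℚ.Positive (fromℕ n)
fromℕ-pos n@(suc m) = ℚ.positive (ℚₚ.toℚᵘ-cancel-< (ℚᵘₚ.<-respʳ-≃ (ℚᵘₚ.≃-sym (toℚᵘ-fromℕ n)) (ℚᵘ.*<* (subst (ℤ.0ℤ ℤ.<_) (sym (ℤₚ.*-identityʳ (ℤ.+ n))) (ℤ.+<+ (s≤s z≤n))))))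

fromℕ-recipℕ : ∀ n .{{_ : NonZero n}} → fromℕ n ℚ.* recipℕ n ≡ 1ℚ
fromℕ-recipℕ n@(suc m) = ℚₚ.toℚᵘ-injective (ℚᵘₚ.≃-trans (ℚₚ.toℚᵘ-homo-* (fromℕ n) (recipℕ n))
  (ℚᵘₚ.≃-trans (ℚᵘₚ.*-cong (toℚᵘ-fromℕ n) (ℚₚ.toℚᵘ-fromℚᵘ (ℚᵘ.mkℚᵘ (ℤ.+ 1) m)))
    (ℚᵘ.*≡* (trans (ℤₚ.*-identityʳ _) (trans (ℤₚ.*-identityʳ (ℤ.+ n)) (sym (trans (ℤₚ.*-identityˡ _) (ℤₚ.*-identityˡ (ℤ.+ n)))))))))

-- The condition on q₀ multiplied by k^t, with t = t′ + 1: the coefficient of √x becomes the natural number α.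
module Threshold (t′ k : ℕ) {{_ : NonZero k}} (1≤t′ : 1 ≤ t′) where
  t K P T α : ℕ
  t = suc t′
  K = k ^ t
  P = k ^ t′
  T = K + t * P
  α = K * t′ + 1 ∸ t * P

  instance
    P-nonZero : NonZero P
    P-nonZero = m^n≢0 k t′
    K-nonZero : NonZero K
    K-nonZero = m^n≢0 k t

  -- It makes the subtraction in `α` exact. For k = 1 both sides agree and α = 0.
  tP≤ : t * P ≤ K * t′ + 1
  tP≤ = go k refl
    where
    go : ∀ n → n ≡ k → t * P ≤ K * t′ + 1
    go zero          e = ⊥-elim (ℕ.≢-nonZero⁻¹ k (sym e))
    go (suc zero)    e = ≤-reflexive (subst (λ k → t * k ^ t′ ≡ k ^ t * t′ + 1) e (trans (cong (t *_) (^-zeroˡ t′))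
                           (trans (*-identityʳ t) (trans (+-comm 1 t′) (cong (_+ 1) (sym (trans (cong (_* t′) (^-zeroˡ t)) (*-identityˡ t′))))))))
    go (suc (suc n)) e = ≤-trans (≤-trans (*-monoˡ-≤ P (+-monoˡ-≤ t′ 1≤t′)) (≤-reflexive (arith t′ P)))
      (≤-trans (*-monoˡ-≤ t′ (*-monoˡ-≤ P (≤-trans (s≤s (s≤s z≤n)) (≤-reflexive e)))) (m≤m+n (K * t′) 1))
      where
      arith : ∀ t′ P → (t′ + t′) * P ≡ 2 * P * t′
      arith = solve-∀

  α+tP : α + t * P ≡ K * t′ + 1
  α+tP = m∸n+n≡m tP≤

  Above : ℕ → Set
  Above x = T < x × α * α * x < (x ∸ T) * (x ∸ T)

  private
    f = fromℕ
    A : ℚ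
    A = f t ℚ.- 1ℚ ℚ.- f t ℚ.* recipℕ k ℚ.+ recipℕ K
    ρ : ℕ → ℚ
    ρ x = f x ℚ.* recipℕ K ℚ.- f t ℚ.* recipℕ k ℚ.- 1ℚ
    open +-*-Solver

    K*recip-k : f K ℚ.* recipℕ k ≡ f P
    K*recip-k = trans (cong (ℚ._* recipℕ k) (fromℕ-* k P)) (trans
      (solve 3 (λ k P r → k :* P :* r := k :* r :* P) refl (f k) (f P) (recipℕ k))
      (trans (cong (ℚ._* f P) (fromℕ-recipℕ k)) (ℚₚ.*-identityˡ (f P))))

    KA : f K ℚ.* A ≡ f α
    KA = trans (solve 4 (λ K t r R → K :* (t :- con 1ℚ :- t :* r :+ R) := K :* t :- K :- t :* (K :* r) :+ K :* R) refl (f K) (f t) (recipℕ k) (recipℕ K))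
      (trans (cong₂ (λ x y → f K ℚ.* f t ℚ.- f K ℚ.- f t ℚ.* x ℚ.+ y) K*recip-k (fromℕ-recipℕ K))
      (trans (cong (λ x → f K ℚ.* x ℚ.- f K ℚ.- f t ℚ.* f P ℚ.+ 1ℚ) (fromℕ-+ 1 t′))
      (trans (solve 4 (λ K t′ t P → K :* (con 1ℚ :+ t′) :- K :- t :* P :+ con 1ℚ := K :* t′ :+ con 1ℚ :- t :* P) refl (f K) (f t′) (f t) (f P))
      (trans (cong (ℚ._- f t ℚ.* f P) (sym total))
             (solve 2 (λ a x → a :+ x :- x := a) refl (f α) (f t ℚ.* f P))))))
      where
      total : f α ℚ.+ f t ℚ.* f P ≡ f K ℚ.* f t′ ℚ.+ 1ℚ
      total = trans (cong (f α ℚ.+_) (sym (fromℕ-* t P))) (trans (sym (fromℕ-+ α (t * P))) (trans (cong f α+tP)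
        (trans (fromℕ-+ (K * t′) 1) (cong (ℚ._+ 1ℚ) (fromℕ-* K t′)))))

    Kρ : ∀ x → f K ℚ.* ρ x ≡ f x ℚ.- f T
    Kρ x = trans (solve 5 (λ K x R t r → K :* (x :* R :- t :* r :- con 1ℚ) := K :* R :* x :- t :* (K :* r) :- K) refl (f K) (f x) (recipℕ K) (f t) (recipℕ k))
      (trans (cong₂ (λ u v → u ℚ.* f x ℚ.- f t ℚ.* v ℚ.- f K) (fromℕ-recipℕ K) K*recip-k)
      (trans (solve 4 (λ x t P K → con 1ℚ :* x :- t :* P :- K := x :- (K :+ t :* P)) refl (f x) (f t) (f P) (f K))
             (cong (λ y → f x ℚ.- y) (sym (trans (fromℕ-+ K (t * P)) (cong (f K ℚ.+_) (fromℕ-* t P)))))))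

    instance
      fK-pos : ℚ.Positive (f K)
      fK-pos = fromℕ-pos K

  above : ∀ {x} → Q0Cond t k x → Above x
  -- The coefficient of the square root is α / k^t with α a natural number, so it cannot be
  -- negative.
  above {x} (inj₂ (A<0 , _)) = ⊥-elim (ℚₚ.<-irrefl refl (ℚₚ.<-≤-trans (subst₂ ℚ._<_ KA (ℚₚ.*-zeroʳ (f K)) (ℚₚ.*-monoʳ-<-pos (f K) A<0)) (fromℕ-nonneg α)))
  above {x} (inj₁ (_ , 0<ρ , lt)) = T<x , fromℕ-cancel-< (subst₂ ℚ._<_ left right (ℚₚ.*-monoʳ-<-pos (f K ℚ.* f K) {{ℚₚ.pos*pos⇒pos (f K) (f K)}} lt))
    where
    T<x : T < x
    T<x = fromℕ-cancel-< (subst₂ ℚ._<_ (ℚₚ.+-identityˡ (f T)) (solve 2 (λ x T → x :- T :+ T := x) refl (f x) (f T))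
      (ℚₚ.+-monoˡ-< (f T) (subst₂ ℚ._<_ (ℚₚ.*-zeroʳ (f K)) (Kρ x) (ℚₚ.*-monoʳ-<-pos (f K) 0<ρ))))
    x-T : f x ℚ.- f T ≡ f (x ∸ T)
    x-T = trans (cong (λ y → f y ℚ.- f T) (sym (m∸n+n≡m (<⇒≤ T<x)))) (trans (cong (ℚ._- f T) (fromℕ-+ (x ∸ T) T))
      (solve 2 (λ a b → a :+ b :- b := a) refl (f (x ∸ T)) (f T)))
    left : f K ℚ.* f K ℚ.* (A ℚ.* A ℚ.* f x) ≡ f (α * α * x)
    left = trans (solve 3 (λ K A x → K :* K :* (A :* A :* x) := (K :* A) :* (K :* A) :* x) refl (f K) A (f x))
      (trans (cong (λ y → y ℚ.* y ℚ.* f x) KA) (sym (trans (fromℕ-* (α * α) x) (cong (ℚ._* f x) (fromℕ-* α α)))))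
    right : f K ℚ.* f K ℚ.* (ρ x ℚ.* ρ x) ≡ f ((x ∸ T) * (x ∸ T))
    right = trans (solve 2 (λ K r → K :* K :* (r :* r) := (K :* r) :* (K :* r)) refl (f K) (ρ x))
      (trans (cong (λ y → y ℚ.* y) (trans (Kρ x) x-T)) (sym (fromℕ-* (x ∸ T) (x ∸ T))))

  above⇒α²< : ∀ {x} → Above x → α * α < x
  above⇒α²< {x} (T<x , lt) = *-cancelʳ-< x (α * α) x (<-≤-trans lt (*-mono-≤ (m∸n≤m x T) (m∸n≤m x T)))

  -- With s = x - T, the condition α² (T + s) < s² is preserved by s ↦ s + 1 since α² < s.
  above-mono : ∀ {x y} → x ≤ y → Above x → Above y
  above-mono {x} {y} x≤y (T<x , lt) = <-≤-trans T<x x≤y , (begin-strict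
    α * α * y                        ≡⟨ cong (α * α *_) y≡ ⟩
    α * α * (T + (s + δ))            ≡⟨ arith₁ (α * α) T s δ ⟩
    α * α * (T + s) + α * α * δ      <⟨ +-mono-<-≤ lt′ (*-monoˡ-≤ δ (<⇒≤ α²<s)) ⟩
    s * s + s * δ                    ≤⟨ m≤m+n _ (s * δ + δ * δ) ⟩
    s * s + s * δ + (s * δ + δ * δ)  ≡⟨ arith₂ s δ ⟩
    (s + δ) * (s + δ)                ≡⟨ cong (λ u → u * u) (trans (sym (m+n∸m≡n T (s + δ))) (cong (_∸ T) (sym y≡))) ⟩
    (y ∸ T) * (y ∸ T)                ∎)
    where
    open ≤-Reasoning
    s δ : ℕ
    s = x ∸ T
    δ = y ∸ x
    x≡ : x ≡ T + s
    x≡ = sym (m+[n∸m]≡n (<⇒≤ T<x))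
    y≡ : y ≡ T + (s + δ)
    y≡ = trans (sym (m+[n∸m]≡n x≤y)) (trans (cong (_+ δ) x≡) (+-assoc T s δ))
    lt′ : α * α * (T + s) < s * s
    lt′ = subst (λ x → α * α * x < s * s) x≡ lt
    α²<s : α * α < s
    α²<s = *-cancelʳ-< s (α * α) s (≤-<-trans (*-monoʳ-≤ (α * α) (m≤n+m s T)) lt′)
    arith₁ : ∀ a T s δ → a * (T + (s + δ)) ≡ a * (T + s) + a * δ
    arith₁ = solve-∀
    arith₂ : ∀ s δ → s * s + s * δ + (s * δ + δ * δ) ≡ (s + δ) * (s + δ)
    arith₂ = solve-∀

-- Near-linear orthomorphisms

unique-lookup : ∀ {A : Set} {xs : List A} → Unique xs → ∀ {i j} → toℕ i < toℕ j → lookup xs i ≢ lookup xs j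
unique-lookup (x∉ ∷ un) {Fin.zero}  {Fin.suc j} _         = All.lookup x∉ (∈-lookup j)
unique-lookup (x∉ ∷ un) {Fin.suc i} {Fin.suc j} (s≤s i<j) = unique-lookup un i<j

list-pigeonhole : ∀ {A : Set} (xs : List A) → Unique xs → ∀ n → (f : A → ℕ) → (∀ x → f x < n) → n < length xs →
  ∃[ x ] ∃[ y ] (x ∈ xs × y ∈ xs × x ≢ y × f x ≡ f y)
list-pigeonhole xs un n f f<n n< = let i , j , i<j , e = Finₚ.pigeonhole n< (λ i → fromℕ< (f<n (lookup xs i)))
  in lookup xs i , lookup xs j , ∈-lookup i , ∈-lookup j , unique-lookup un i<j ,
     trans (sym (Finₚ.toℕ-fromℕ< (f<n (lookup xs i)))) (trans (cong toℕ e) (Finₚ.toℕ-fromℕ< (f<n (lookup xs j))))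

%-+-cancelˡ : ∀ k .{{_ : NonZero k}} {a b i j} → a % k ≡ b % k → (a + i) % k ≡ (b + j) % k → i % k ≡ j % k
%-+-cancelˡ k@(suc k′) {a} {b} {i} {j} a≡b e = begin
  i % k                    ≡⟨ DM.[m+kn]%n≡m%n i a k ⟨
  (i + a * k) % k          ≡⟨ cong (_% k) (arith a i k′) ⟩
  (a + i + k′ * a) % k     ≡⟨ %-+-congˡ {k} {a + i} {b + j} (k′ * a) e ⟩
  (b + j + k′ * a) % k     ≡⟨ cong (_% k) (trans (+-assoc b j (k′ * a)) refl) ⟩
  (b + (j + k′ * a)) % k   ≡⟨ %-+-congˡ {k} {b} {a} (j + k′ * a) (sym a≡b) ⟩
  (a + (j + k′ * a)) % k   ≡⟨ cong (_% k) (arith₂ a j k′) ⟩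
  (j + a * k) % k          ≡⟨ DM.[m+kn]%n≡m%n j a k ⟩
  j % k                    ∎
  where
  open ≡.≡-Reasoning
  arith : ∀ a i k′ → i + a * suc k′ ≡ a + i + k′ * a
  arith = solve-∀
  arith₂ : ∀ a j k′ → a + (j + k′ * a) ≡ j + a * suc k′
  arith₂ = solve-∀

%-coarsen : ∀ {c k} .{{_ : NonZero c}} .{{_ : NonZero k}} → c ∣ k → ∀ {i j} → i % k ≡ j % k → i % c ≡ j % c
%-coarsen {c} {k} c∣k {i} {j} e = trans (sym (DM.m∣n⇒o%n%m≡o%m c k i c∣k)) (trans (cong (_% c) e) (DM.m∣n⇒o%n%m≡o%m c k j c∣k))

lcm-nonZero : ∀ m n .{{_ : NonZero m}} .{{_ : NonZero n}} → NonZero (lcm m n)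
lcm-nonZero m n = ℕ.≢-nonZero λ e → ℕ.≢-nonZero⁻¹ (m * n) {{m*n≢0 m n}} (trans (sym (gcd*lcm m n)) (trans (cong (gcd m n *_) e) (*-zeroʳ (gcd m n))))
  where open import Data.Nat.GCD using (gcd)

kOf-nonZero : ∀ n b c → (∀ i → NonZero (b i)) → .{{_ : NonZero c}} → NonZero (kOf n b c)
kOf-nonZero zero    b c bpos = ℕ.≢-nonZero (ℕ.≢-nonZero⁻¹ c)
kOf-nonZero (suc n) b c bpos = lcm-nonZero (b Fin.zero) (kOf n (b ∘ Fin.suc) c) {{bpos Fin.zero}} {{kOf-nonZero n (b ∘ Fin.suc) c (bpos ∘ Fin.suc)}}

c∣kOf : ∀ n b c → c ∣ kOf n b c
c∣kOf zero    b c = Div.∣-refl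
c∣kOf (suc n) b c = Div.∣-trans (c∣kOf n (b ∘ Fin.suc) c) (n∣lcm[m,n] (b Fin.zero) _)

b∣kOf : ∀ n b c i → b i ∣ kOf n b c
b∣kOf (suc n) b c Fin.zero    = m∣lcm[m,n] (b Fin.zero) _
b∣kOf (suc n) b c (Fin.suc i) = Div.∣-trans (b∣kOf n (b ∘ Fin.suc) c i) (n∣lcm[m,n] (b Fin.zero) _)

-- Two multipliers with equal classes

module Existence {q : ℕ} (F : FiniteField q) (g : FiniteField.Carrier F) (isGen : IsGenerator F g) where
  open FiniteField F using (Carrier)
  open FieldTheory F using (elements; elements-unique; length-elements; 0#; 1#; _-_) renaming (_≟_ to _≟F_)
  open FieldFacts.Generator F g isGen using (N; 1+N≡q; ind)

  SameClasses : (k : ℕ) .{{_ : NonZero k}} → List Carrier → Carrier → Set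
  SameClasses k S x = ∀ {s s′} → s ∈ S → s′ ∈ S → ind (x - s) % k ≡ ind (x - s′) % k

  -- k³ is the number of triples of classes of x, x - 1 and the common class of the x - s.
  Candidates : (k : ℕ) .{{_ : NonZero k}} → List Carrier → Set
  Candidates k S = ∃[ xs ] (Unique xs × k * k * k < length xs ×
    ∀ {x} → x ∈ xs → x ≢ 0# × x ≢ 1# × All (x ≢_) S × SameClasses k S x)

  private
    avoiding : ∀ (S : List Carrier) x → Dec (All (x ≢_) S)
    avoiding S x = All.all? (λ s → ¬? (x ≟F s)) S

    avoiding-length : ∀ S xs → Unique xs → length xs ≤ length (filter (avoiding S) xs) + length S
    avoiding-length S xs un = length-avoiding _≟F_ (avoiding S) xs S un (λ x → go S x)
      where
      go : ∀ S x → ¬ All (x ≢_) S → x ∈ S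
      go []      x ¬av = ⊥-elim (¬av [])
      go (s ∷ S) x ¬av with x ≟F s
      ... | yes refl = here refl
      ... | no  x≢s  = there (go S x (¬av ∘ (x≢s ∷_)))

  unconditional : ∀ (k : ℕ) .{{_ : NonZero k}} S → (∀ x → SameClasses k S x) → k * k * k + 3 + length S ≤ q → Candidates k S
  unconditional k S same le = xs , filter⁺ (avoiding S′) elements-unique , enough , spec
    where
    S′ = 0# ∷ 1# ∷ S
    xs = filter (avoiding S′) elements
    enough : k * k * k < length xs
    enough = +-cancelʳ-≤ (2 + length S) _ _ (≤-trans (≤-reflexive (arith (k * k * k) (length S)))
      (≤-trans le (subst (_≤ length xs + (2 + length S)) length-elements (avoiding-length S′ elements elements-unique))))
      where
      arith : ∀ x s → suc x + (2 + s) ≡ x + 3 + s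
      arith = solve-∀
    spec : ∀ {x} → x ∈ xs → x ≢ 0# × x ≢ 1# × All (x ≢_) S × SameClasses k S x
    spec {x} x∈ with proj₂ (∈-filter⁻ (avoiding S′) {xs = elements} x∈)
    ... | x≢0 ∷ x≢1 ∷ x∉ = x≢0 , x≢1 , x∉ , same x

  -- If S has at most one element or k = 1, all points qualify apart from 0, 1 and S, and only a
  -- lower bound for q is at stake. Otherwise the inversion applies, with the size of q provided by
  -- `above⇒α²<`.
  candidates : ∀ t′ k {{_ : NonZero k}} (1≤t′ : 1 ≤ t′) → Threshold.Above t′ k 1≤t′ q → k ∣ N →
    ∀ S → Unique S → length S + 2 ≤ suc t′ → Candidates k S
  candidates t′ k 1≤t′ above@(T<q , α²q<) k∣N [] un _ = unconditional k [] (λ x ()) (subst (_≤ q) (sym (+-identityʳ _)) (k³+3≤q t′ 1≤t′ T<q α²q<))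
    where
    k³+3≤q : ∀ t′ (1≤t′ : 1 ≤ t′) → Threshold.T t′ k 1≤t′ < q → let α = Threshold.α t′ k 1≤t′; T = Threshold.T t′ k 1≤t′ in α * α * q < (q ∸ T) * (q ∸ T) → k * k * k + 3 ≤ q
    k³+3≤q (suc (suc t″)) 1≤t′ T<q _ = ≤-trans (+-mono-≤ k³≤ 3≤) (<⇒≤ T<q)
      where
      open Threshold (suc (suc t″)) k 1≤t′ using (P; P-nonZero)
      k³≤ : k * k * k ≤ k ^ suc (suc (suc t″))
      k³≤ = ≤-trans (≤-reflexive (arith k)) (^-monoʳ-≤ k (s≤s (s≤s (s≤s (z≤n {t″})))))
        where
        arith : ∀ k → k * k * k ≡ k ^ 3
        arith k = trans (*-assoc k k k) (cong (λ x → k * (k * x)) (sym (*-identityʳ k)))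
      3≤ : 3 ≤ suc (suc (suc t″)) * P
      3≤ = *-mono-≤ (s≤s (s≤s (s≤s (z≤n {t″})))) (ℕ.>-nonZero⁻¹ P)
    -- For t = 2 the inequality T = k² + 2 k < q alone does not reach k³. But it gives q ≥ (k + 1)²,
    -- and then α² q < (q - T)² forces α (k + 1) < q - T, where α = (k - 1)².
    k³+3≤q (suc zero) 1≤t′ T<q α²q< = go k refl
      where
      module Th = Threshold 1 k 1≤t′
      go : ∀ m → m ≡ k → k * k * k + 3 ≤ q
      go zero e = ⊥-elim (ℕ.≢-nonZero⁻¹ k (sym e))
      go (suc m) refl = begin
        k * k * k + 3                              ≤⟨ m≤m+n _ m ⟩
        k * k * k + 3 + m                          ≡⟨ arith m ⟩
        suc (T + m * m * suc k)                    ≤⟨ s≤s (+-monoʳ-≤ T (≤-reflexive (cong (_* suc k) (sym α≡)))) ⟩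
        suc (T + α * suc k)                        ≤⟨ T+α<q ⟩
        q                                          ∎
        where
        open ≤-Reasoning
        T α : ℕ
        T = Th.T
        α = Th.α
        arith : ∀ m → suc m * suc m * suc m + 3 + m ≡ suc (suc m * (suc m * 1) + 2 * (suc m * 1) + m * m * suc (suc m))
        arith = solve-∀
        α≡ : α ≡ m * m
        α≡ = +-cancelʳ-≡ _ _ _ (trans Th.α+tP (arith₂ m))
          where
          arith₂ : ∀ m → suc m * (suc m * 1) * 1 + 1 ≡ m * m + 2 * (suc m * 1)
          arith₂ = solve-∀
        [k+1]²≤q : suc k * suc k ≤ q
        [k+1]²≤q = ≤-trans (≤-reflexive (arith₃ m)) T<q
          where
          arith₃ : ∀ m → suc (suc m) * suc (suc m) ≡ suc (suc m * (suc m * 1) + 2 * (suc m * 1))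
          arith₃ = solve-∀
        α[k+1]<q-T : α * suc k < q ∸ T
        α[k+1]<q-T = ≰⇒> λ le → <⇒≱ α²q< (≤-trans (*-mono-≤ le le) (≤-trans (≤-reflexive (arith₄ α (suc k))) (*-monoʳ-≤ (α * α) [k+1]²≤q)))
          where
          arith₄ : ∀ a s → (a * s) * (a * s) ≡ a * a * (s * s)
          arith₄ = solve-∀
        T+α<q : suc (T + α * suc k) ≤ q
        T+α<q = ≤-trans (≤-reflexive (sym (+-suc T (α * suc k)))) (≤-trans (+-monoʳ-≤ T α[k+1]<q-T) (≤-reflexive (m+[n∸m]≡n (<⇒≤ T<q))))
  candidates t′ k 1≤t′ (T<q , _) k∣N (s₀ ∷ []) un d≤ = unconditional k (s₀ ∷ []) (λ { x (here refl) (here refl) → refl })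
    (≤-trans (≤-reflexive (+-assoc (k * k * k) 3 1)) (≤-trans (≤-reflexive (sym (+-assoc (k * k * k) 3 1))) (≤-trans (≤-reflexive (+-comm (k * k * k + 3) 1)) (≤-trans (s≤s (+-mono-≤ k³≤ 3≤)) T<q))))
    where
    open Threshold t′ k 1≤t′ using (P; P-nonZero)
    3≤t : 3 ≤ suc t′
    3≤t = d≤
    k³≤ : k * k * k ≤ k ^ suc t′
    k³≤ = ≤-trans (≤-reflexive (trans (*-assoc k k k) (cong (λ x → k * (k * x)) (sym (*-identityʳ k))))) (^-monoʳ-≤ k 3≤t)
    3≤ : 3 ≤ suc t′ * P
    3≤ = *-mono-≤ 3≤t (ℕ.>-nonZero⁻¹ P)
  candidates t′ k@(suc zero) 1≤t′ (T<q , _) k∣N S@(_ ∷ _ ∷ _) un d≤ = unconditional k S (λ x {s} {s′} _ _ → trans (DM.n%1≡0 (ind (x - s))) (sym (DM.n%1≡0 (ind (x - s′)))))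
    (≤-trans (≤-reflexive (arith (length S))) (≤-trans (s≤s (s≤s d≤)) (≤-trans (≤-reflexive (cong suc (sym T≡))) T<q)))
    where
    open Threshold t′ k 1≤t′ using (T)
    arith : ∀ d → 1 + 3 + d ≡ 2 + (d + 2)
    arith = solve-∀
    T≡ : T ≡ suc (suc t′)
    T≡ = cong₂ _+_ (^-zeroˡ (suc t′)) (trans (cong (suc t′ *_) (^-zeroˡ t′)) (*-identityʳ (suc t′)))
  candidates t′ k@(suc k′@(suc _)) 1≤t′ above k∣N S@(s₀ ∷ S′@(_ ∷ S″)) un d≤ = xs , filter⁺ (avoiding (0# ∷ 1# ∷ [])) good-unique , enough , spec
    where
    module Th = Threshold t′ k 1≤t′
    open Th using (P; α)
    r d z : ℕ
    r = length S′
    d = suc r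
    z = d * k ^ d ∸ d
    I≡ : d * k ^ d ≡ suc (r + z)
    I≡ = sym (m+[n∸m]≡n (≤-trans (≤-reflexive (sym (*-identityʳ d))) (*-monoʳ-≤ d (m^n>0 k d))))
    d≤t′ : d + 1 ≤ t′
    d≤t′ = ≤-pred (≤-trans (≤-reflexive (sym (+-suc d 1))) d≤)
    α+P : α + P ≡ k′ * P * t′ + 1
    α+P = +-cancelʳ-≡ (t′ * P) _ _ (trans (arith₁ α P t′) (trans Th.α+tP (arith₂ k′ P t′)))
      where
      arith₁ : ∀ α P t′ → α + P + t′ * P ≡ α + suc t′ * P
      arith₁ = solve-∀
      arith₂ : ∀ k′ P t′ → suc k′ * P * t′ + 1 ≡ k′ * P * t′ + 1 + t′ * P
      arith₂ = solve-∀
    -- As d + 1 ≤ t′, the left side k′ d k^(d+1) is at most k′ d P. The remaining k′ P of k′ t′ P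
    -- pays for the P by which α falls short of k′ t′ P + 1.
    kk′I≤α : k * k′ * suc (r + z) ≤ α
    kk′I≤α = +-cancelʳ-≤ P _ _ (begin
      k * k′ * suc (r + z) + P       ≡⟨ cong (λ I → k * k′ * I + P) I≡ ⟨
      k * k′ * (d * k ^ d) + P       ≡⟨ arith₁ k k′ d (k ^ d) P ⟩
      k′ * d * k ^ suc d + P         ≤⟨ +-monoˡ-≤ P (*-monoʳ-≤ (k′ * d) (^-monoʳ-≤ k (≤-trans (≤-reflexive (+-comm 1 d)) d≤t′))) ⟩
      k′ * d * P + P                 ≤⟨ +-monoʳ-≤ (k′ * d * P) (m≤n*m P k′) ⟩
      k′ * d * P + k′ * P            ≡⟨ arith₂ k′ d P ⟩
      k′ * P * (d + 1)               ≤⟨ *-monoʳ-≤ (k′ * P) d≤t′ ⟩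
      k′ * P * t′                    ≤⟨ m≤m+n _ 1 ⟩
      k′ * P * t′ + 1                ≡⟨ α+P ⟨
      α + P                          ∎)
      where
      open ≤-Reasoning
      arith₁ : ∀ k k′ d x P → k * k′ * (d * x) + P ≡ k′ * d * (k * x) + P
      arith₁ = solve-∀
      arith₂ : ∀ k′ d P → k′ * d * P + k′ * P ≡ k′ * P * (d + 1)
      arith₂ = solve-∀
    big : (k * k′ * suc (r + z)) * (k * k′ * suc (r + z)) ≤ q ∸ 1
    big = ≤-trans (*-mono-≤ kk′I≤α kk′I≤α) (≤-pred (≤-trans (Th.above⇒α²< above) (≤-reflexive (sym 1+N≡q))))
    module Inv = Inversion F g isGen s₀ S′ un r k′ z refl (s≤s z≤n) (s≤s z≤n) I≡ k∣N big
    module Eq = Equidistribution F g isGen S un r k′ z refl (s≤s z≤n) (s≤s z≤n) I≡ k∣N big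
    good-unique : Unique Inv.Good
    good-unique = filter⁺ Inv.good? Eq.Out-unique
    xs : List Carrier
    xs = filter (avoiding (0# ∷ 1# ∷ [])) Inv.Good
    enough : k * k * k < length xs
    enough = +-cancelʳ-≤ 2 _ _ (≤-trans (≤-reflexive (sym (+-suc (k * k * k) 2))) (≤-trans Inv.many-good (avoiding-length (0# ∷ 1# ∷ []) Inv.Good good-unique)))
    spec : ∀ {x} → x ∈ xs → x ≢ 0# × x ≢ 1# × All (x ≢_) S × SameClasses k S x
    spec {x} x∈ with ∈-filter⁻ (avoiding (0# ∷ 1# ∷ [])) {xs = Inv.Good} x∈
    ... | x∈Good , (x≢0 ∷ x≢1 ∷ []) with ∈-filter⁻ Inv.good? {xs = Eq.Out} x∈Good
    ... | x∈Out , trivial = x≢0 , x≢1 , proj₂ (∈-filter⁻ Eq.outside? {xs = elements} x∈Out) , λ s∈ s′∈ → trans (base s∈) (sym (base s′∈))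
      where
      i₀ : ℕ
      i₀ = ind (x - s₀)
      base : ∀ {s} → s ∈ S → ind (x - s) % k ≡ i₀ % k
      base (here refl) = refl
      base {s} (there s∈) = begin
        ind (x - s) % k                       ≡⟨ DM.[m+kn]%n≡m%n (ind (x - s)) i₀ k ⟨
        (ind (x - s) + i₀ * k) % k            ≡⟨ cong (_% k) (arith (ind (x - s)) i₀ k′) ⟩
        (ind (x - s) + k′ * i₀ + i₀) % k      ≡⟨ DM.%-remove-+ˡ {ind (x - s) + k′ * i₀} i₀ (Div.m%n≡0⇒n∣m (ind (x - s) + k′ * i₀) k (All.lookup trivial (∈-map⁺ (λ s → ind (x - s) + k′ * i₀) s∈))) ⟩
        i₀ % k                                ∎
        where
        open ≡.≡-Reasoning
        arith : ∀ i j k′ → i + j * suc k′ ≡ i + k′ * j + j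
        arith = solve-∀

  baseIndex : List Carrier → Carrier → ℕ
  -- For empty S there is no class to record, and any constant serves.
  baseIndex []      x = 0
  baseIndex (s ∷ _) x = ind (x - s)

  class-pair : ∀ (k : ℕ) .{{_ : NonZero k}} S → Candidates k S →
    ∃[ a ] ∃[ a′ ] (a ≢ a′ × (∀ x → x ≡ a ⊎ x ≡ a′ → x ≢ 0# × x ≢ 1# × All (x ≢_) S) ×
      ∃[ ρ₀ ] ∃[ ρ₁ ] ∃[ ρ ] (∀ x → x ≡ a ⊎ x ≡ a′ → ind x % k ≡ ρ₀ × ind (x - 1#) % k ≡ ρ₁ × (∀ {s} → s ∈ S → ind (x - s) % k ≡ ρ)))
  class-pair k S (xs , un , large , spec) =
    let a , a′ , a∈ , a′∈ , a≢a′ , same = list-pigeonhole xs un (k * k * k) code code< large in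
    a , a′ , a≢a′ ,
    (λ { x (inj₁ refl) → outside a∈ ; x (inj₂ refl) → outside a′∈ }) ,
    ind a % k , ind (a - 1#) % k , baseIndex S a % k ,
    (λ { x (inj₁ refl) → refl , refl , classes S a (proj₂ (proj₂ (proj₂ (spec a∈))))
       ; x (inj₂ refl) → let step₁ , last = div-unique k (DM.m%n<n (ind (a - 1#)) k) (DM.m%n<n (ind (a′ - 1#)) k) same
                             first , middle = div-unique k (DM.m%n<n (ind a) k) (DM.m%n<n (ind a′) k) step₁
                         in sym middle , sym last , λ s∈ → trans (classes S a′ (proj₂ (proj₂ (proj₂ (spec a′∈)))) s∈) (sym first) })
    where
    code : Carrier → ℕ
    code x = (baseIndex S x % k * k + ind x % k) * k + ind (x - 1#) % k
    code< : ∀ x → code x < k * k * k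
    code< x = two (two (DM.m%n<n (baseIndex S x) k) (DM.m%n<n (ind x) k)) (DM.m%n<n (ind (x - 1#)) k)
      where
      two : ∀ {u v m} → u < m → v < k → u * k + v < m * k
      two {u} {v} {m} u<m v<k = <-≤-trans (+-monoʳ-< (u * k) v<k) (≤-trans (≤-reflexive (+-comm (u * k) k)) (*-monoˡ-≤ k u<m))
    outside : ∀ {x} → x ∈ xs → x ≢ 0# × x ≢ 1# × All (x ≢_) S
    outside x∈ = proj₁ (spec x∈) , proj₁ (proj₂ (spec x∈)) , proj₁ (proj₂ (proj₂ (spec x∈)))
    classes : ∀ S x → SameClasses k S x → ∀ {s} → s ∈ S → ind (x - s) % k ≡ baseIndex S x % k
    classes (s₀ ∷ S) x same s∈ = same s∈ (here refl)

-- Construction of the orthomorphism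

module Construction {q : ℕ} (F : FiniteField q) (g : FiniteField.Carrier F) (isGen : IsGenerator F g) where
  open FiniteField F using (Carrier; card)
  open FieldTheory F using (0#; 1#; -≢0; *-cancelˡ; distribʳ; ^-homo-*; _-_; -0≡0) renaming (_^_ to _^ᶠ_; *-identityˡ to ·-identityˡ; +-identityʳ to ⊹-identityʳ; _≟_ to _≟F_; _*_ to _·_; _+_ to _⊹_; -_ to ─_; *-≢0 to ·-≢0)
  open FieldFacts F using (^-≢0)
  open FieldFacts.Generator F g isGen using (N; N-nonZero; ind; g^ind; g≢0; g^-injective; ^-agrees)
  private module card = Inverse card

  injective⇒perm : ∀ {f : Carrier → Carrier} → Injective _≡_ _≡_ f → IsPerm F f
  injective⇒perm {f} inj = inj , λ y → let x , fx≡y = preimage y in x , λ { refl → fx≡y }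
    where
    to-injective : ∀ {x y} → card.to x ≡ card.to y → x ≡ y
    to-injective {x} {y} e = trans (sym (card.strictlyInverseʳ x)) (trans (cong card.from e) (card.strictlyInverseʳ y))
    preimage : ∀ y → ∃[ x ] (f x ≡ y)
    preimage y = go (Finₚ.pigeonhole ≤-refl probe)
      where
      probe : Fin (suc q) → Fin q
      probe Fin.zero    = card.to y
      probe (Fin.suc i) = card.to (f (card.from i))
      go : (∃[ i ] ∃[ j ] (toℕ i < toℕ j × probe i ≡ probe j)) → ∃[ x ] (f x ≡ y)
      go (Fin.zero , Fin.suc j , _ , e) = card.from j , sym (to-injective e)
      go (Fin.suc i , Fin.suc j , s≤s i<j , e) = ⊥-elim (<⇒≢ i<j (cong toℕ (trans (sym (card.strictlyInverseˡ i))
        (trans (cong card.to (inj (to-injective e))) (card.strictlyInverseˡ j)))))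

  -- The class of the multiplier being constant, the class of f x determines the class of x, hence the multiplier, hence x.
  multiplier-perm : ∀ (k : ℕ) .{{_ : NonZero k}} → k ∣ N → ∀ (f : Carrier → Carrier) (m : ℕ → Carrier) ρ → f 0# ≡ 0# →
    (∀ x → x ≢ 0# → f x ≡ m (ind x) · x) → (∀ i j → i % k ≡ j % k → m i ≡ m j) →
    (∀ i → m i ≢ 0# × ind (m i) % k ≡ ρ) → IsPerm F f
  multiplier-perm k k∣N f m ρ f0 f≡ periodic m-spec = injective⇒perm inj
    where
    f≢0 : ∀ {x} → x ≢ 0# → f x ≢ 0#
    f≢0 {x} x≢0 e = ·-≢0 (proj₁ (m-spec (ind x))) x≢0 (trans (sym (f≡ x x≢0)) e)
    f-power : ∀ {x} → x ≢ 0# → f x ≡ g ^ᶠ (ind (m (ind x)) + ind x)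
    f-power {x} x≢0 = trans (f≡ x x≢0) (trans (cong₂ _·_ (sym (g^ind (proj₁ (m-spec (ind x))))) (sym (g^ind x≢0)))
      (sym (^-homo-* g (ind (m (ind x))) (ind x))))
    inj : Injective _≡_ _≡_ f
    inj {x} {y} e with x ≟F 0# | y ≟F 0#
    ... | yes refl | yes refl = refl
    ... | yes refl | no y≢0  = ⊥-elim (f≢0 y≢0 (trans (sym e) f0))
    ... | no x≢0   | yes refl = ⊥-elim (f≢0 x≢0 (trans e f0))
    ... | no x≢0   | no y≢0 = *-cancelˡ (proj₁ (m-spec (ind x)))
      (trans (sym (f≡ x x≢0)) (trans e (trans (f≡ y y≢0) (cong (_· y) (sym (periodic (ind x) (ind y) ind≡))))))
      where
      ind≡ : ind x % k ≡ ind y % k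
      ind≡ = %-+-cancelˡ k (trans (proj₂ (m-spec (ind x))) (sym (proj₂ (m-spec (ind y)))))
        (%-coarsen k∣N (g^-injective _ _ (trans (sym (f-power x≢0)) (trans e (f-power y≢0)))))

  sub-· : ∀ a b x → a · x - b · x ≡ (a - b) · x
  sub-· a b x = sym (trans (distribʳ x a (─ b)) (cong (a · x ⊹_) (sym (-‿distribˡ-* b x))))
    where open import Algebra.Properties.Ring (CommutativeRing.ring (FieldTheory.fieldRing F)) using (-‿distribˡ-*)

  module NearLinear (k c : ℕ) .{{_ : NonZero k}} .{{cnz : NonZero c}} (k∣N : k ∣ N) (c∣k : c ∣ k) (a a′ : Carrier) (a≢a′ : a ≢ a′)
    (S : List Carrier) (outside : ∀ x → x ≡ a ⊎ x ≡ a′ → x ≢ 0# × x ≢ 1# × All (x ≢_) S)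
    (ρ₀ ρ₁ ρ : ℕ) (classes : ∀ x → x ≡ a ⊎ x ≡ a′ → ind x % k ≡ ρ₀ × ind (x - 1#) % k ≡ ρ₁ × (∀ {s} → s ∈ S → ind (x - s) % k ≡ ρ)) where

    choose : ℕ → Carrier
    choose zero    = a
    choose (suc _) = a′

    multiplier : ℕ → Carrier
    multiplier i = choose (i % c)

    choose-either : ∀ i → choose i ≡ a ⊎ choose i ≡ a′
    choose-either zero    = inj₁ refl
    choose-either (suc _) = inj₂ refl

    multiplier-either : ∀ i → multiplier i ≡ a ⊎ multiplier i ≡ a′
    multiplier-either i = choose-either (i % c)

    multiplier-periodic : ∀ i j → i % k ≡ j % k → multiplier i ≡ multiplier j
    multiplier-periodic i j e = cong choose (%-coarsen c∣k e)

    -- The zero test of `φ` is an argument, so that its equations can be proved by matching on an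
    -- arbitrary decision.
    scaled : ∀ {x} → Dec (x ≡ 0#) → Carrier → Carrier
    scaled     (yes _) m = 0#
    scaled {x} (no _)  m = m · x

    scaled-0 : (d : Dec (0# ≡ 0#)) → ∀ m → scaled d m ≡ 0#
    scaled-0 (yes _) m = refl
    scaled-0 (no ≢)  m = ⊥-elim (≢ refl)

    scaled-≢0 : ∀ {x} → x ≢ 0# → (d : Dec (x ≡ 0#)) → ∀ m → scaled d m ≡ m · x
    scaled-≢0 x≢0 (yes x≡0) m = ⊥-elim (x≢0 x≡0)
    scaled-≢0 x≢0 (no _)    m = refl

    φ : Carrier → Carrier
    φ x = scaled (x ≟F 0#) (multiplier (ind x))

    φ-0 : φ 0# ≡ 0#
    φ-0 = scaled-0 (0# ≟F 0#) (multiplier (ind 0#))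

    φ-≢0 : ∀ x → x ≢ 0# → φ x ≡ multiplier (ind x) · x
    φ-≢0 x x≢0 = scaled-≢0 x≢0 (x ≟F 0#) (multiplier (ind x))

    ind-g^ : ∀ j → ind (g ^ᶠ j) % N ≡ j % N
    ind-g^ j = g^-injective _ _ (g^ind (^-≢0 j g≢0))

    ind-g^-% : ∀ {m} .{{_ : NonZero m}} → m ∣ k → ∀ j → ind (g ^ᶠ j) % m ≡ j % m
    ind-g^-% m∣k j = %-coarsen (Div.∣-trans m∣k k∣N) (ind-g^ j)

    toℕ-mod : ∀ j {m} .{{_ : NonZero m}} → toℕ (j DM.mod m) ≡ j % m
    toℕ-mod j {m} = Finₚ.toℕ-fromℕ< (DM.m%n<n j m)

    cyclotomic : IsCyclotomicWith F g c (choose ∘ toℕ) φ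
    cyclotomic = φ-0 , λ j → subst (λ y → φ y ≡ choose (toℕ (j DM.mod c)) · y) (sym (^-agrees g j))
      (trans (φ-≢0 (g ^ᶠ j) (^-≢0 j g≢0)) (cong (λ i → choose i · (g ^ᶠ j)) (trans (ind-g^-% c∣k j) (sym (toℕ-mod j)))))

    perm : IsPerm F φ
    perm = multiplier-perm k k∣N φ multiplier ρ₀ φ-0 φ-≢0 multiplier-periodic
      (λ i → proj₁ (outside _ (multiplier-either i)) , proj₁ (classes _ (multiplier-either i)))

    orthomorphism : IsOrthomorphism F φ
    orthomorphism = perm , multiplier-perm k k∣N (λ x → φ x - x) (λ i → multiplier i - 1#) ρ₁
      (trans (cong (_- 0#) φ-0) (trans (cong (0# ⊹_) -0≡0) (⊹-identityʳ 0#)))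
      (λ x x≢0 → trans (cong₂ _-_ (φ-≢0 x x≢0) (sym (·-identityˡ x))) (sub-· (multiplier (ind x)) 1# x))
      (λ i j e → cong (_- 1#) (multiplier-periodic i j e))
      (λ i → -≢0 (proj₁ (proj₂ (outside _ (multiplier-either i)))) , proj₁ (proj₂ (classes _ (multiplier-either i))))

    inC : InC F g c φ
    inC = orthomorphism , choose ∘ toℕ , cyclotomic

    -- For c = 1 there is no nonzero index: both conditions on the multipliers are vacuous, and φ is
    -- x ↦ a x.
    near-linear : IsNearLinear F g c φ
    near-linear = inC , choose ∘ toℕ , cyclotomic ,
      (λ i j i≡0 j≢0 e → a≢a′ (trans (cong choose (sym i≡0)) (trans e (choose-≢0 j≢0)))) ,
      (λ i j i≢0 j≢0 → trans (choose-≢0 i≢0) (sym (choose-≢0 j≢0)))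
      where
      choose-≢0 : ∀ {i} → i ≢ 0 → choose i ≡ a′
      choose-≢0 {zero}  i≢0 = ⊥-elim (i≢0 refl)
      choose-≢0 {suc _} i≢0 = refl

    -- Comparing the values at g^0 and g^ℓ, both in the class 0 modulo ℓ.
    inD : InD F g c φ
    inD = inC , λ ℓ nz ℓ<c _ (_ , α , _ , α≡) → a≢a′ (begin
      a                             ≡⟨ cong choose (DM.m<n⇒m%n≡m (≤-<-trans z≤n ℓ<c)) ⟨
      multiplier 0                  ≡⟨ value ℓ nz α α≡ 0 ⟩
      α (DM._mod_ 0 ℓ {{nz}})       ≡⟨ cong α (Finₚ.toℕ-injective (trans (toℕ-mod 0 {ℓ} {{nz}}) (trans (trans (DM.m<n⇒m%n≡m {{nz}} (ℕ.>-nonZero⁻¹ ℓ {{nz}})) (sym (DM.n%n≡0 ℓ {{nz}}))) (sym (toℕ-mod ℓ {ℓ} {{nz}}))))) ⟩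
      α (DM._mod_ ℓ ℓ {{nz}})       ≡⟨ value ℓ nz α α≡ ℓ ⟨
      multiplier ℓ                  ≡⟨ cong choose (DM.m<n⇒m%n≡m ℓ<c) ⟩
      choose ℓ                      ≡⟨ positive ℓ nz ⟩
      a′                            ∎)
      where
      open ≡.≡-Reasoning
      positive : ∀ ℓ → NonZero ℓ → choose ℓ ≡ a′
      positive (suc _) _ = refl
      value : ∀ ℓ (nz : NonZero ℓ) (α : Fin ℓ → Carrier) →
        (∀ j → φ (FiniteField._^_ F g j) ≡ α (DM._mod_ j ℓ {{nz}}) · FiniteField._^_ F g j) → ∀ j → multiplier j ≡ α (DM._mod_ j ℓ {{nz}})
      value ℓ nz α α≡ j = *-cancelˡ (^-≢0 j g≢0) (trans (·-comm (g ^ᶠ j) (multiplier j)) (trans (begin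
        multiplier j · (g ^ᶠ j)                 ≡⟨ cong (λ i → choose i · (g ^ᶠ j)) (ind-g^-% c∣k j) ⟨
        multiplier (ind (g ^ᶠ j)) · (g ^ᶠ j)     ≡⟨ φ-≢0 (g ^ᶠ j) (^-≢0 j g≢0) ⟨
        φ (g ^ᶠ j)                              ≡⟨ subst (λ y → φ y ≡ α (DM._mod_ j ℓ {{nz}}) · y) (^-agrees g j) (α≡ j) ⟩
        α (DM._mod_ j ℓ {{nz}}) · (g ^ᶠ j)      ∎) (·-comm (α (DM._mod_ j ℓ {{nz}})) (g ^ᶠ j))))
        where open CommutativeRing (FieldTheory.fieldRing F) using () renaming (*-comm to ·-comm)

    orthogonal : ∀ (θ : Carrier → Carrier) (b : ℕ) .{{_ : NonZero b}} → b ∣ k → (A : Fin b → Carrier) → (∀ j → A j ∈ S) →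
      IsCyclotomicWith F g b A θ → Orthogonal F φ θ
    orthogonal θ b b∣k A A∈S (θ0 , θ≡) = multiplier-perm k k∣N (λ x → φ x - θ x) (λ i → multiplier i - A (i DM.mod b)) ρ
      (trans (cong₂ _-_ φ-0 θ0) (trans (cong (0# ⊹_) -0≡0) (⊹-identityʳ 0#)))
      (λ x x≢0 → trans (cong₂ _-_ (φ-≢0 x x≢0) (θ-≢0 x x≢0)) (sub-· (multiplier (ind x)) (A (ind x DM.mod b)) x))
      (λ i j e → cong₂ (λ u v → u - A v) (multiplier-periodic i j e)
        (Finₚ.toℕ-injective (trans (toℕ-mod i) (trans (%-coarsen b∣k e) (sym (toℕ-mod j))))))
      (λ i → -≢0 (All.lookup (proj₂ (proj₂ (outside _ (multiplier-either i)))) (A∈S (i DM.mod b))) ,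
             proj₂ (proj₂ (classes _ (multiplier-either i))) (A∈S (i DM.mod b)))
      where
      θ-≢0 : ∀ x → x ≢ 0# → θ x ≡ A (ind x DM.mod b) · x
      θ-≢0 x x≢0 = subst (λ y → θ y ≡ A (ind x DM.mod b) · y) (trans (^-agrees g (ind x)) (g^ind x≢0)) (θ≡ (ind x))

length-deduplicate : ∀ {A : Set} (_≟′_ : ∀ (x y : A) → Dec (x ≡ y)) xs → length (deduplicate _≟′_ xs) ≤ length xs
length-deduplicate _≟′_ []       = z≤n
length-deduplicate _≟′_ (x ∷ xs) = s≤s (≤-trans (Listₚ.length-filter (¬? ∘ (x ≟′_)) (deduplicate _≟′_ xs)) (length-deduplicate _≟′_ xs))

length-concat-tabulate : ∀ {A : Set} n (b : Fin n → ℕ) (f : ∀ i → Fin (b i) → A) →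
  length (concat (tabulate (λ i → tabulate (f i)))) ≡ sum (tabulate b)
length-concat-tabulate zero    b f = refl
length-concat-tabulate (suc n) b f = trans (Listₚ.length-++ (tabulate (f Fin.zero)))
  (cong₂ _+_ (Listₚ.length-tabulate (f Fin.zero)) (length-concat-tabulate n (b ∘ Fin.suc) (λ i → f (Fin.suc i))))

theorem4p3 : (n : ℕ) (b : Fin n → ℕ) (bpos : ∀ i → NonZero (b i))
    (c : ℕ) .{{cpos : NonZero c}}
    (q₀ : ℕ) → IsLeastQ0 (tOf n b) (kOf n b c) q₀ →
    (q : ℕ) → IsPrimePower q → kOf n b c ∣ (q ∸ 1) → q₀ ≤ q →
    (F : FiniteField q) (g : FiniteField.Carrier F) → IsGenerator F g →
    (θ : Fin n → FiniteField.Carrier F → FiniteField.Carrier F) →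
    (∀ i → InC F g (b i) {{bpos i}} (θ i)) →
    ∃[ φ ] (IsNearLinear F g c φ × InD F g c φ × (∀ i → Orthogonal F φ (θ i)))
theorem4p3 n b bpos c q₀ (_ , q₀-cond , _) q _ k∣N q₀≤q F g isGen θ θ∈C =
  let a , a′ , a≢a′ , outside , ρ₀ , ρ₁ , ρ , classes = class-pair k S (candidates t′ k 1≤t′ above k∣N S S-unique length-S)
      module φ = NearLinear k c k∣N (c∣kOf n b c) a a′ a≢a′ S outside ρ₀ ρ₁ ρ classes
  in φ.φ , φ.near-linear , φ.inD , λ i →
     φ.orthogonal (θ i) (b i) {{bpos i}} (b∣kOf n b c i) (A i) (A∈S i) (proj₂ (proj₂ (θ∈C i)))
  where
  open Existence F g isGen
  open Construction F g isGen
  open FieldTheory F using () renaming (_≟_ to _≟F_)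
  k t′ : ℕ
  k = kOf n b c
  t′ = suc (sum (tabulate b))
  1≤t′ : 1 ≤ t′
  1≤t′ = s≤s z≤n
  instance
    k-nonZero : NonZero k
    k-nonZero = kOf-nonZero n b c bpos
  A : ∀ i → Fin (b i) → FiniteField.Carrier F
  A i = proj₁ (proj₂ (θ∈C i))
  multipliers : List (FiniteField.Carrier F)
  multipliers = concat (tabulate (λ i → tabulate (A i)))
  -- Orders of vanishing are compared at distinct points, so repeated multipliers are merged; |S| is
  -- then at most t - 2.
  S : List (FiniteField.Carrier F)
  S = deduplicate _≟F_ multipliers
  S-unique : Unique S
  S-unique = deduplicate-! _≟F_ multipliers
  A∈S : ∀ i j → A i j ∈ S
  A∈S i j = ∈-deduplicate⁺ _≟F_ (∈-concat⁺′ (∈-tabulate⁺ j) (∈-tabulate⁺ i))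
  length-S : length S + 2 ≤ suc t′
  length-S = ≤-trans (≤-reflexive (+-comm (length S) 2)) (s≤s (s≤s (≤-trans (length-deduplicate _≟F_ multipliers)
    (≤-reflexive (length-concat-tabulate n b A)))))
  above : Threshold.Above t′ k 1≤t′ q
  above = Threshold.above-mono t′ k 1≤t′ q₀≤q (Threshold.above t′ k 1≤t′ q₀-cond)
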